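{- Let $M,N$ be typable $\mu\mathsf{DCLL}$-terms. If $M\doteq N$ in $\mu\mathsf{DCLL}$, then $M^{\mathsf H}\doteq N^{\mathsf H}$ in $\lambda_{\mathrm{MELL}}$.
   Context: The calculus $\mu\mathsf{DCLL}$. Types: $A,B::=\bot\mid\alpha\mid A\supset B\mid A\multimap B$ ($\alpha$ atomic). Terms: $M,N::=x\mid u\mid\Lambda u.M\mid M\,@\,N\mid\lambda x.M\mid M\bullet N\mid[\gamma]M\mid\mu\gamma.M$, with $x$ linear variables, $u$ non-linear variables, $\gamma$ (linear) continuation variables. Judgements $\Delta;\Gamma\vdash M:A\mid\Sigma$ ($\Delta$ types non-linear variables, $\Gamma$ linear variables, $\Sigma$ continuation variables; in $\Gamma,\Gamma'$ and $\Sigma,\Sigma'$ domains are disjoint; $\cdot$ is empty). Rules (premises $\Rightarrow$ conclusion): $\Rightarrow\Delta,u:A;\cdot\vdash u:A\mid\cdot$; $\Rightarrow\Delta;x:A\vdash x:A\mid\cdot$; $\Delta,u:A;\Gamma\vdash M:B\mid\Sigma$ $\Rightarrow$ $\Delta;\Gamma\vdash\Lambda u.M:A\supset B\mid\Sigma$; $\Delta;\Gamma\vdash M:A\supset B\mid\Sigma$ and $\Delta;\cdot\vdash N:A\mid\cdot$ $\Rightarrow$ $\Delta;\Gamma\vdash M\,@\,N:B\mid\Sigma$; $\Delta;\Gamma,x:A\vdash M:B\mid\Sigma$ $\Rightarrow$ $\Delta;\Gamma\vdash\lambda x.M:A\multimap B\mid\Sigma$; $\Delta;\Gamma\vdash M:A\multimap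 B\mid\Sigma$ and $\Delta;\Gamma'\vdash N:A\mid\Sigma'$ $\Rightarrow$ $\Delta;\Gamma,\Gamma'\vdash M\bullet N:B\mid\Sigma,\Sigma'$; $\Delta;\Gamma\vdash M:A\mid\Sigma$ $\Rightarrow$ $\Delta;\Gamma\vdash[\gamma]M:\bot\mid\Sigma,\gamma:A$; $\Delta;\Gamma\vdash M:\bot\mid\Sigma,\gamma:A$ $\Rightarrow$ $\Delta;\Gamma\vdash\mu\gamma.M:A\mid\Sigma$. $\mu\mathsf{DCLL}$-equivalence $\doteq$ (between typable terms with the same type and contexts) is the least congruent equivalence relation containing: $(\Lambda u.M)\,@\,N\doteq M\{u:=N\}$; $(\lambda x.M)\bullet N\doteq M\{x:=N\}$; $N\bullet(\mu\gamma.M)\doteq\mu\gamma.(M\{\gamma\lhd^\star N\})$, where $M\{\gamma\lhd^\star N\}$ replaces the (unique) subterm $[\gamma]P$ of $M$ by $[\gamma](N\bullet P)$ in a capture-avoiding way; $\mu\gamma.[\gamma]M\doteq M$ if $\gamma\notin\mathrm{fv}(M)$. MELL formulae: $A,B::=\alpha\mid\overline\alpha\mid A\otimes B\mid A\wp B\mid\mathbf 1\mid\bot\mid{!}A\mid{?}A$ ($\alpha$ atomic, $\overline\alpha$ its negative version, $\wp$ is "par"). Linear negation is the involution $\alpha^\perp=\overline\alpha$, $\overline\alpha^\perp=\alpha$, $(A\otimes B)^\perp=A^\perp\wp B^\perp$, $(A\wp B)^\perp=A^\perp\otimes B^\perp$, $\mathbf1^\perp=\bot$, $\bot^\perp=\mathbf1$,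 $({!}A)^\perp={?}(A^\perp)$, $({?}A)^\perp={!}(A^\perp)$. Terms of $\lambda_{\mathrm{MELL}}$, over linear variables $a,b,c,\dots$ and unrestricted variables $u,v,\dots$: $t,s::=a\mid u\mid\langle t,s\rangle\mid t[\langle a,b\rangle:=s]\mid\wp(a,b).t\mid t\bullet s\mid t\blacktriangledown s\mid{!}a.t\mid t[{!}u:=s]\mid{?}u.t\mid t\blacktriangleright^{a}s\mid t\,\sharp\,s\mid\star\mid t[\star:=s]$. Binding: $t[\langle a,b\rangle:=s]$ and $\wp(a,b).t$ bind $a,b$ in $t$; ${!}a.t$ and $t\blacktriangleright^a s$ bind $a$ in $t$; $t[{!}u:=s]$ and ${?}u.t$ bind $u$ in $t$. Terms are taken up to $\alpha$-renaming, and bound variables are always chosen to avoid capture. Typing judgements $\Delta;\Gamma\vdash t:A$, where $\Delta$ (resp. $\Gamma$) is a finite partial function from unrestricted (resp. linear) variables to formulae; $\Gamma,\Gamma'$ denotes union with disjoint domains. Typing rules: $\Rightarrow\Delta;a:A\vdash a:A$; $\Rightarrow\Delta,u:A;\cdot\vdash u:A$; $\Delta;\Gamma\vdash t:A$ and $\Delta;\Gamma'\vdash s:B$ $\Rightarrow$ $\Delta;\Gamma,\Gamma'\vdash\langle t,s\rangle:A\otimes B$; $\Delta;\Gamma\vdash s:A\otimes B$ and $\Delta;\Gamma',a:A,b:B\vdash t:C$ $\Rightarrow$ $\Delta;\Gamma,\Gamma'\vdash t[\langle a,b\rangle:=s]:C$; $\Delta;\Gamma,a:A,b:B\vdash t:\bot$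 $\Rightarrow$ $\Delta;\Gamma\vdash\wp(a,b).t:A^\perp\wp B^\perp$; $\Delta;\Gamma\vdash t:A\wp B$ and $\Delta;\Gamma'\vdash s:A^\perp$ $\Rightarrow$ $\Delta;\Gamma,\Gamma'\vdash t\bullet s:B$; $\Delta;\Gamma\vdash t:A\wp B$ and $\Delta;\Gamma'\vdash s:B^\perp$ $\Rightarrow$ $\Delta;\Gamma,\Gamma'\vdash t\blacktriangledown s:A$; $\Delta;a:A\vdash t:\bot$ $\Rightarrow$ $\Delta;\cdot\vdash{!}a.t:{!}(A^\perp)$; $\Delta;\Gamma\vdash s:{!}A$ and $\Delta,u:A;\Gamma'\vdash t:B$ $\Rightarrow$ $\Delta;\Gamma,\Gamma'\vdash t[{!}u:=s]:B$; $\Delta,u:A^\perp;\Gamma\vdash t:\bot$ $\Rightarrow$ $\Delta;\Gamma\vdash{?}u.t:{?}A$; $\Delta;\Gamma\vdash s:{?}A$ and $\Delta;a:A\vdash t:\bot$ $\Rightarrow$ $\Delta;\Gamma\vdash t\blacktriangleright^a s:\bot$; $\Delta;\Gamma\vdash t:B$ and $\Delta;\Gamma'\vdash s:B^\perp$ $\Rightarrow$ $\Delta;\Gamma,\Gamma'\vdash t\,\sharp\,s:\bot$; $\Rightarrow\Delta;\cdot\vdash\star:\mathbf1$; $\Delta;\Gamma\vdash s:\mathbf1$ and $\Delta;\Gamma'\vdash t:A$ $\Rightarrow$ $\Delta;\Gamma,\Gamma'\vdash t[\star:=s]:A$. A term is linear if: each free linear variable occurs exactly once; each bound linear variable occurs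 exactly once in the scope of its binder; subterms ${!}a.t$ have no free linear variables; in subterms $t\blacktriangleright^a s$ only $a$ occurs as a free linear variable in $t$. $t\{a:=s\}$, $t\{u:=s\}$ denote capture-avoiding substitution. For a linear term $t$ with $a\in\mathrm{fv}(t)$, the contra-substitution $t\{a\backslash\!\backslash s\}$ is defined by induction on $t$ (case "$i$" applies when $a\in\mathrm{fv}(t_i)$): $a\{a\backslash\!\backslash s\}=s$; $\langle t_1,t_2\rangle\{a\backslash\!\backslash s\}=t_1\{a\backslash\!\backslash s\blacktriangledown t_2\}$ (case 1), $t_2\{a\backslash\!\backslash s\bullet t_1\}$ (case 2); $(t_1\bullet t_2)\{a\backslash\!\backslash s\}=t_1\{a\backslash\!\backslash\langle t_2,s\rangle\}$ (1), $t_2\{a\backslash\!\backslash t_1\blacktriangledown s\}$ (2); $(t_1\blacktriangledown t_2)\{a\backslash\!\backslash s\}=t_1\{a\backslash\!\backslash\langle s,t_2\rangle\}$ (1), $t_2\{a\backslash\!\backslash t_1\bullet s\}$ (2); $(t_1[\langle b,c\rangle:=t_2])\{a\backslash\!\backslash s\}=(t_1\{a\backslash\!\backslash s\})[\langle b,c\rangle:=t_2]$ (1, $a\notin\{b,c\}$), $t_2\{a\backslash\!\backslash\wp(b,c).(t_1\sharp s)\}$ (2); $(\wp(b,c).t)\{a\backslash\!\backslash s\}=(t\{a\backslash\!\backslash\star\})[\langle b,c\rangle:=s]$; $(t_1[{!}u:=t_2])\{a\backslash\!\backslash s\}=(t_1\{a\backslash\!\backslash s\})[{!}u:=t_2]$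 (1), $t_2\{a\backslash\!\backslash{?}u.(t_1\sharp s)\}$ (2); $({?}u.t)\{a\backslash\!\backslash s\}=(t\{a\backslash\!\backslash\star\})[{!}u:=s]$; $(t_1\blacktriangleright^b t_2)\{a\backslash\!\backslash s\}=(t_2\{a\backslash\!\backslash{!}b.t_1\})[\star:=s]$ (only case 2 is possible); $(t_1\sharp t_2)\{a\backslash\!\backslash s\}=(t_1\{a\backslash\!\backslash t_2\})[\star:=s]$ (1), $(t_2\{a\backslash\!\backslash t_1\})[\star:=s]$ (2); $(t_1[\star:=t_2])\{a\backslash\!\backslash s\}=(t_1\{a\backslash\!\backslash s\})[\star:=t_2]$ (1), $t_2\{a\backslash\!\backslash t_1\sharp s\}$ (2). (Terms ${!}b.t$ and $\star$ have no free linear variables, so no clause is needed.) Positive elimination contexts: $L,K::=\Box\mid L[\langle a,b\rangle:=t]\mid L[{!}u:=t]\mid L[\star:=t]$; $tL$ denotes filling the hole of $L$ with $t$ (free variables of $t$ may be captured by $L$). Pre-reduction $\to^-$ is the contextual closure (under all term constructors) of the following axioms, where both sides are assumed typed with the same type in the same contexts: $(\wp(a,b).t)L\bullet r\mapsto t\{a:=r\}\{b\backslash\!\backslash\star\}L$ ($b\notin\mathrm{fv}(r)$); $(\wp(a,b).t)L\blacktriangledown r\mapsto t\{b:=r\}\{a\backslash\!\backslash\star\}L$ ($a\notin\mathrm{fv}(r)$); $t[\langle a,b\rangle:=\langle s,r\rangle L]\mapsto t\{a:=s\}\{b:=r\}L$ ($b\notin\mathrm{fv}(s)$); $t[{!}u:=({!}a.s)L]\mapsto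 t\{u:=s\{a\backslash\!\backslash\star\}\}L$; $t\blacktriangleright^a({?}u.s)L\mapsto s\{u:=t\{a\backslash\!\backslash\star\}\}L$; $(\wp(a,b).t)L\,\sharp\,\langle s,r\rangle K\mapsto t\{a:=s\}\{b:=r\}LK$ ($b\notin\mathrm{fv}(s)$); $\langle s,r\rangle L\,\sharp\,(\wp(a,b).t)K\mapsto t\{a:=s\}\{b:=r\}LK$ ($b\notin\mathrm{fv}(s)$); $({!}a.t)L\,\sharp\,({?}u.r)K\mapsto r\{u:=t\{a\backslash\!\backslash\star\}\}LK$; $({?}u.r)L\,\sharp\,({!}a.t)K\mapsto r\{u:=t\{a\backslash\!\backslash\star\}\}LK$. Positive eliminators $[\langle a,b\rangle:=t]$, $[{!}u:=t]$, $[\star:=t]$ are written $[p:=t]$, with $\mathrm{fv}(\langle a,b\rangle)=\{a,b\}$, $\mathrm{fv}({!}u)=\{u\}$, $\mathrm{fv}(\star)=\emptyset$. Surface contexts $S$ are: $\wp(a,b).\Box$, $\langle\Box,t\rangle$, $\langle t,\Box\rangle$, $\Box\bullet t$, $t\bullet\Box$, $\Box\blacktriangledown t$, $t\blacktriangledown\Box$, $\Box\,\sharp\,t$, $t\,\sharp\,\Box$, ${?}u.\Box$, $\Box[p:=t]$, $t[p:=\Box]$, $t\blacktriangleright^a\Box$. A term $r$ is free for $S$ if $S\langle r\rangle$ does not bind free variables of $r$. Structural equivalence $\equiv$ is the reflexive, symmetric, transitive and contextual closure of the following axioms, where both sides are assumed typed with the same type in the same contexts: $S\langle t\rangle[p:=r]\equiv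 S\langle t[p:=r]\rangle$ if $\mathrm{fv}(p)\cap\mathrm{fv}(S)=\emptyset$ and $r$ is free for $S$; $t[\star:=\star]\equiv t$; $t[\star:=s]\equiv s[\star:=t]$; $t\{a\backslash\!\backslash\star\}\,\sharp\,r\equiv t\{a:=r\}$. $\lambda_{\mathrm{MELL}}$-reduction: $t\to s$ iff there exist $t',s'$ with $t\equiv t'\to^-s'\equiv s$. Reduction is considered modulo $\equiv$; $\doteq$ in $\lambda_{\mathrm{MELL}}$ is the reflexive, symmetric, transitive closure of $\to\cup\equiv$. Translation $(\cdot)^{\mathsf H}$. Write ${!}t:={!}a.(t\,\sharp\,a)$ with $a$ fresh. Linear and continuation variables of $\mu\mathsf{DCLL}$ are regarded as linear variables, non-linear ones as unrestricted variables. Types: $\bot^{\mathsf H}=\bot$, $\alpha^{\mathsf H}=\alpha$, $(A\supset B)^{\mathsf H}={?}(A^{\mathsf H})^\perp\wp B^{\mathsf H}$, $(A\multimap B)^{\mathsf H}=(A^{\mathsf H})^\perp\wp B^{\mathsf H}$; a judgement $\Delta;\Gamma\vdash M:A\mid\Sigma$ is translated to $\Delta^{\mathsf H};\Gamma^{\mathsf H},(\Sigma^{\mathsf H})^\perp\vdash M^{\mathsf H}:A^{\mathsf H}$. Terms ($a,k$ fresh linear variables): $x^{\mathsf H}=x$, $u^{\mathsf H}=u$; $(\Lambda u.M)^{\mathsf H}=\wp(a,k).(M^{\mathsf H}[{!}u:=a]\,\sharp\,k)$; $(M\,@\,N)^{\mathsf H}=M^{\mathsf H}\bullet{!}N^{\mathsf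 H}$; $(\lambda x.M)^{\mathsf H}=\wp(x,k).(M^{\mathsf H}\,\sharp\,k)$; $(M\bullet N)^{\mathsf H}=M^{\mathsf H}\bullet N^{\mathsf H}$; $([\gamma]M)^{\mathsf H}=M^{\mathsf H}\,\sharp\,\gamma$; $(\mu\gamma.M)^{\mathsf H}=M^{\mathsf H}\{\gamma\backslash\!\backslash\star\}$. -}

module Defs where

open import Data.Bool.Base using (Bool; if_then_else_)
open import Data.Fin.Base using (Fin; zero; suc; _↑ˡ_; _↑ʳ_; splitAt; lift)
open import Data.Fin.Properties using (_≟_)
open import Data.Maybe.Base using (Maybe; just; nothing)
import Data.Maybe.Base as Maybe
open import Data.Nat.Base using (ℕ; zero; suc; _+_; _≤_; _<ᵇ_)
open import Data.Product.Base using (_×_; ∃₂)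
open import Data.Sum.Base using (_⊎_; [_,_]′)
open import Data.Unit.Base using (⊤)
open import Data.Vec.Base using (Vec; []; _∷_; _++_; lookup; replicate; _[_]≔_; map)
open import Data.Vec.Functional using (insertAt)
open import Function.Base using (_∘_; id)
open import Relation.Binary.Construct.Closure.Equivalence using (EqClosure)
open import Relation.Binary.PropositionalEquality using (_≡_)
open import Relation.Nullary.Decidable using (does)

infix  30 _^⊥ _ᵀ _ᴴ
infixr 25 _⊗_ _⅋_ _⊃_ _⊸_
infix  30 !_ ¿_
infixl 18 elim _⟪_≔_⟫ _⟪_⟫ᵘ
infixl 17 _•_ _▼_ _＠_
infix  16 _▶_ _♯_
infix  4 _⊎_≃_ _⨾_⊢_∶_ _⨾_⊢_∶_∣_ _⨾_⊢_≐_∶_∣_ _↦_ _≈_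
infix  4 _⨾_⊢_⟶⁻_∶_ _⨾_⊢_≋_∶_ _⨾_⊢_⟶_∶_ _⨾_⊢_≐_∶_

private
  variable
    X : Set
    m n m′ n′ k k′ i j l : ℕ

------------------------------------------------------------------------
-- Contexts

-- Variables are well-scoped de Bruijn indices, so α-equivalent terms are
-- identical.  Unrestricted variables, linear variables and (in μDCLL)
-- continuation variables are numbered separately.  A linear context is a
-- partial function from the linear variables in scope, which need not all
-- be assigned a type.

LCtx : Set → ℕ → Set
LCtx T n = Vec (Maybe T) n

∅ : {T : Set} → LCtx T n
∅ = replicate _ nothing

single : {T : Set} → Fin n → T → LCtx T n
single a A = ∅ [ a ]≔ just A

-- Γ₁ ⊎ Γ₂ ≃ Γ : the domains of Γ₁ and Γ₂ are disjoint and Γ is their union.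
data _⊎_≃_ {T : Set} : LCtx T n → LCtx T n → LCtx T n → Set where
  []    : [] ⊎ [] ≃ []
  none  : {Γ₁ Γ₂ Γ : LCtx T n} → Γ₁ ⊎ Γ₂ ≃ Γ →
          (nothing ∷ Γ₁) ⊎ (nothing ∷ Γ₂) ≃ (nothing ∷ Γ)
  left  : {Γ₁ Γ₂ Γ : LCtx T n} {A : T} → Γ₁ ⊎ Γ₂ ≃ Γ →
          (just A ∷ Γ₁) ⊎ (nothing ∷ Γ₂) ≃ (just A ∷ Γ)
  right : {Γ₁ Γ₂ Γ : LCtx T n} {A : T} → Γ₁ ⊎ Γ₂ ≃ Γ →
          (nothing ∷ Γ₁) ⊎ (just A ∷ Γ₂) ≃ (just A ∷ Γ)

------------------------------------------------------------------------
-- The calculus μDCLL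

data Type (X : Set) : Set where
  ⊥       : Type X
  atom    : X → Type X
  _⊃_ _⊸_ : Type X → Type X → Type X

-- Terms with m non-linear, n linear and k continuation variables in scope.
data μTerm (m n k : ℕ) : Set where
  lin  : Fin n → μTerm m n k
  unr  : Fin m → μTerm m n k
  Λ_   : μTerm (suc m) n k → μTerm m n k
  _＠_ : μTerm m n k → μTerm m n k → μTerm m n k
  ƛ_   : μTerm m (suc n) k → μTerm m n k
  _•_  : μTerm m n k → μTerm m n k → μTerm m n k
  [_]_ : Fin k → μTerm m n k → μTerm m n k
  μ_   : μTerm m n (suc k) → μTerm m n k

data _⨾_⊢_∶_∣_ {X : Set} {m n k : ℕ} (Δ : Vec (Type X) m) :
     LCtx (Type X) n → μTerm m n k → Type X → LCtx (Type X) k → Set where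

  unr : (u : Fin m) → Δ ⨾ ∅ ⊢ unr u ∶ lookup Δ u ∣ ∅

  lin : {A : Type X} (x : Fin n) → Δ ⨾ single x A ⊢ lin x ∶ A ∣ ∅

  ⊃I  : ∀ {Γ Σ A B M} →
        (A ∷ Δ) ⨾ Γ ⊢ M ∶ B ∣ Σ →
        Δ ⨾ Γ ⊢ Λ M ∶ A ⊃ B ∣ Σ

  ⊃E  : ∀ {Γ Σ A B M N} →
        Δ ⨾ Γ ⊢ M ∶ A ⊃ B ∣ Σ →
        Δ ⨾ ∅ ⊢ N ∶ A ∣ ∅ →
        Δ ⨾ Γ ⊢ M ＠ N ∶ B ∣ Σ

  ⊸I  : ∀ {Γ Σ A B M} →
        Δ ⨾ (just A ∷ Γ) ⊢ M ∶ B ∣ Σ →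
        Δ ⨾ Γ ⊢ ƛ M ∶ A ⊸ B ∣ Σ

  ⊸E  : ∀ {Γ Γ₁ Γ₂ Σ Σ₁ Σ₂ A B M N} →
        Γ₁ ⊎ Γ₂ ≃ Γ → Σ₁ ⊎ Σ₂ ≃ Σ →
        Δ ⨾ Γ₁ ⊢ M ∶ A ⊸ B ∣ Σ₁ →
        Δ ⨾ Γ₂ ⊢ N ∶ A ∣ Σ₂ →
        Δ ⨾ Γ ⊢ M • N ∶ B ∣ Σ

  name : ∀ {Γ Σ Σ′ γ A M} →
        Σ ⊎ single γ A ≃ Σ′ →
        Δ ⨾ Γ ⊢ M ∶ A ∣ Σ →
        Δ ⨾ Γ ⊢ [ γ ] M ∶ ⊥ ∣ Σ′

  unname : ∀ {Γ Σ A M} →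
        Δ ⨾ Γ ⊢ M ∶ ⊥ ∣ (just A ∷ Σ) →
        Δ ⨾ Γ ⊢ μ M ∶ A ∣ Σ

μren : (Fin m → Fin m′) → (Fin n → Fin n′) → (Fin k → Fin k′) →
       μTerm m n k → μTerm m′ n′ k′
μren ρ σ κ (lin x)   = lin (σ x)
μren ρ σ κ (unr u)   = unr (ρ u)
μren ρ σ κ (Λ M)     = Λ μren (lift 1 ρ) σ κ M
μren ρ σ κ (M ＠ N)  = μren ρ σ κ M ＠ μren ρ σ κ N
μren ρ σ κ (ƛ M)     = ƛ μren ρ (lift 1 σ) κ M
μren ρ σ κ (M • N)   = μren ρ σ κ M • μren ρ σ κ N
μren ρ σ κ ([ γ ] M) = [ κ γ ] μren ρ σ κ M
μren ρ σ κ (μ M)     = μ μren ρ σ (lift 1 κ) M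

wkᵘ : μTerm m n k → μTerm (suc m) n k
wkᵘ = μren suc id id

wkˡ : μTerm m n k → μTerm m (suc n) k
wkˡ = μren id suc id

wkᶜ : μTerm m n k → μTerm m n (suc k)
wkᶜ = μren id id suc

μsub : (Fin m → μTerm m′ n′ k) → (Fin n → μTerm m′ n′ k) →
       μTerm m n k → μTerm m′ n′ k
μsub σ τ (lin x)   = τ x
μsub σ τ (unr u)   = σ u
μsub σ τ (Λ M)     = Λ μsub (insertAt (wkᵘ ∘ σ) zero (unr zero)) (wkᵘ ∘ τ) M
μsub σ τ (M ＠ N)  = μsub σ τ M ＠ μsub σ τ N
μsub σ τ (ƛ M)     = ƛ μsub (wkˡ ∘ σ) (insertAt (wkˡ ∘ τ) zero (lin zero)) M
μsub σ τ (M • N)   = μsub σ τ M • μsub σ τ N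
μsub σ τ ([ γ ] M) = [ γ ] μsub σ τ M
μsub σ τ (μ M)     = μ μsub (wkᶜ ∘ σ) (wkᶜ ∘ τ) M

-- M{u:=N} and M{x:=N} for the most recently bound u, x.
_⟦_⟧ᵘ : μTerm (suc m) n k → μTerm m n k → μTerm m n k
M ⟦ N ⟧ᵘ = μsub (insertAt unr zero N) lin M

_⟦_⟧ˡ : μTerm m (suc n) k → μTerm m n k → μTerm m n k
M ⟦ N ⟧ˡ = μsub unr (insertAt lin zero N) M

-- M{γ◁⋆N} replaces the subterm [γ]P of M by [γ](N•P).
_⟦_◁_⟧ : μTerm m n k → Fin k → μTerm m n k → μTerm m n k
lin x     ⟦ γ ◁ N ⟧ = lin x
unr u     ⟦ γ ◁ N ⟧ = unr u
(Λ M)     ⟦ γ ◁ N ⟧ = Λ (M ⟦ γ ◁ wkᵘ N ⟧)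
(M ＠ M′) ⟦ γ ◁ N ⟧ = (M ⟦ γ ◁ N ⟧) ＠ (M′ ⟦ γ ◁ N ⟧)
(ƛ M)     ⟦ γ ◁ N ⟧ = ƛ (M ⟦ γ ◁ wkˡ N ⟧)
(M • M′)  ⟦ γ ◁ N ⟧ = (M ⟦ γ ◁ N ⟧) • (M′ ⟦ γ ◁ N ⟧)
([ δ ] P) ⟦ γ ◁ N ⟧ = if does (γ ≟ δ) then [ γ ] (N • P) else [ δ ] (P ⟦ γ ◁ N ⟧)
(μ M)     ⟦ γ ◁ N ⟧ = μ (M ⟦ suc γ ◁ wkᶜ N ⟧)

data _⨾_⊢_≐_∶_∣_ {X : Set} {m n k : ℕ} (Δ : Vec (Type X) m)
     (Γ : LCtx (Type X) n) : μTerm m n k → μTerm m n k →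
     Type X → LCtx (Type X) k → Set where

  refl  : ∀ {Σ A M} → Δ ⨾ Γ ⊢ M ∶ A ∣ Σ → Δ ⨾ Γ ⊢ M ≐ M ∶ A ∣ Σ
  sym   : ∀ {Σ A M N} → Δ ⨾ Γ ⊢ M ≐ N ∶ A ∣ Σ → Δ ⨾ Γ ⊢ N ≐ M ∶ A ∣ Σ
  trans : ∀ {Σ A L M N} → Δ ⨾ Γ ⊢ L ≐ M ∶ A ∣ Σ → Δ ⨾ Γ ⊢ M ≐ N ∶ A ∣ Σ →
          Δ ⨾ Γ ⊢ L ≐ N ∶ A ∣ Σ

  Λ-cong : ∀ {Σ A B M M′} →
    (A ∷ Δ) ⨾ Γ ⊢ M ≐ M′ ∶ B ∣ Σ →
    Δ ⨾ Γ ⊢ Λ M ≐ Λ M′ ∶ A ⊃ B ∣ Σ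

  ＠-cong : ∀ {Σ A B M M′ N N′} →
    Δ ⨾ Γ ⊢ M ≐ M′ ∶ A ⊃ B ∣ Σ →
    Δ ⨾ ∅ ⊢ N ≐ N′ ∶ A ∣ ∅ →
    Δ ⨾ Γ ⊢ M ＠ N ≐ M′ ＠ N′ ∶ B ∣ Σ

  ƛ-cong : ∀ {Σ A B M M′} →
    Δ ⨾ (just A ∷ Γ) ⊢ M ≐ M′ ∶ B ∣ Σ →
    Δ ⨾ Γ ⊢ ƛ M ≐ ƛ M′ ∶ A ⊸ B ∣ Σ

  •-cong : ∀ {Γ₁ Γ₂ Σ Σ₁ Σ₂ A B M M′ N N′} →
    Γ₁ ⊎ Γ₂ ≃ Γ → Σ₁ ⊎ Σ₂ ≃ Σ →
    Δ ⨾ Γ₁ ⊢ M ≐ M′ ∶ A ⊸ B ∣ Σ₁ →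
    Δ ⨾ Γ₂ ⊢ N ≐ N′ ∶ A ∣ Σ₂ →
    Δ ⨾ Γ ⊢ M • N ≐ M′ • N′ ∶ B ∣ Σ

  name-cong : ∀ {Σ Σ′ γ A M M′} →
    Σ ⊎ single γ A ≃ Σ′ →
    Δ ⨾ Γ ⊢ M ≐ M′ ∶ A ∣ Σ →
    Δ ⨾ Γ ⊢ [ γ ] M ≐ [ γ ] M′ ∶ ⊥ ∣ Σ′

  μ-cong : ∀ {Σ A M M′} →
    Δ ⨾ Γ ⊢ M ≐ M′ ∶ ⊥ ∣ (just A ∷ Σ) →
    Δ ⨾ Γ ⊢ μ M ≐ μ M′ ∶ A ∣ Σ

  β⊃ : ∀ {Σ A M N} →
    Δ ⨾ Γ ⊢ (Λ M) ＠ N ∶ A ∣ Σ →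
    Δ ⨾ Γ ⊢ M ⟦ N ⟧ᵘ ∶ A ∣ Σ →
    Δ ⨾ Γ ⊢ (Λ M) ＠ N ≐ M ⟦ N ⟧ᵘ ∶ A ∣ Σ

  β⊸ : ∀ {Σ A M N} →
    Δ ⨾ Γ ⊢ (ƛ M) • N ∶ A ∣ Σ →
    Δ ⨾ Γ ⊢ M ⟦ N ⟧ˡ ∶ A ∣ Σ →
    Δ ⨾ Γ ⊢ (ƛ M) • N ≐ M ⟦ N ⟧ˡ ∶ A ∣ Σ

  •μ : ∀ {Σ A M N} →
    Δ ⨾ Γ ⊢ N • (μ M) ∶ A ∣ Σ →
    Δ ⨾ Γ ⊢ μ (M ⟦ zero ◁ wkᶜ N ⟧) ∶ A ∣ Σ →
    Δ ⨾ Γ ⊢ N • (μ M) ≐ μ (M ⟦ zero ◁ wkᶜ N ⟧) ∶ A ∣ Σ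

  μη : ∀ {Σ A M} →
    Δ ⨾ Γ ⊢ μ ([ zero ] wkᶜ M) ∶ A ∣ Σ →
    Δ ⨾ Γ ⊢ M ∶ A ∣ Σ →
    Δ ⨾ Γ ⊢ μ ([ zero ] wkᶜ M) ≐ M ∶ A ∣ Σ

------------------------------------------------------------------------
-- MELL formulae and the terms of λ_MELL

data Formula (X : Set) : Set where
  atom natom : X → Formula X
  _⊗_ _⅋_    : Formula X → Formula X → Formula X
  𝟏 ⊥        : Formula X
  !_ ¿_      : Formula X → Formula X

_^⊥ : Formula X → Formula X
atom α  ^⊥ = natom α
natom α ^⊥ = atom α
(A ⊗ B) ^⊥ = (A ^⊥) ⅋ (B ^⊥)
(A ⅋ B) ^⊥ = (A ^⊥) ⊗ (B ^⊥)
𝟏       ^⊥ = ⊥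
⊥       ^⊥ = 𝟏
(! A)   ^⊥ = ¿ (A ^⊥)
(¿ A)   ^⊥ = ! (A ^⊥)

-- The binders ⟨a,b⟩, !u and ⋆ of positive eliminators [p:=t], and the
-- numbers of unrestricted and linear variables they bind.
data Pat : Set where
  pair bang star : Pat

#ᵘ #ˡ : Pat → ℕ
#ᵘ pair = 0
#ᵘ bang = 1
#ᵘ star = 0
#ˡ pair = 2
#ˡ bang = 0
#ˡ star = 0

-- Terms with m unrestricted and n linear variables in scope.  Wherever a
-- and b are bound together, as in ℘(a,b).t, a is index 0 and b is index 1.
data Term (m n : ℕ) : Set where
  lvar    : Fin n → Term m n
  uvar    : Fin m → Term m n
  ⟨_,_⟩   : Term m n → Term m n → Term m n
  elim    : (p : Pat) → Term (#ᵘ p + m) (#ˡ p + n) → Term m n → Term m n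
  ⅋λ_     : Term m (2 + n) → Term m n
  _•_ _▼_ : Term m n → Term m n → Term m n
  !λ_     : Term m (1 + n) → Term m n
  ¿λ_     : Term (1 + m) n → Term m n
  _▶_     : Term m (1 + n) → Term m n → Term m n
  _♯_     : Term m n → Term m n → Term m n
  ⋆       : Term m n

syntax elim p t s = t [ p ≔ s ]

data _⨾_⊢_∶_ {X : Set} {m n : ℕ} (Δ : Vec (Formula X) m) :
     LCtx (Formula X) n → Term m n → Formula X → Set where

  lvar : {A : Formula X} (a : Fin n) → Δ ⨾ single a A ⊢ lvar a ∶ A

  uvar : (u : Fin m) → Δ ⨾ ∅ ⊢ uvar u ∶ lookup Δ u

  ⊗I : ∀ {Γ Γ₁ Γ₂ A B t s} → Γ₁ ⊎ Γ₂ ≃ Γ →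
       Δ ⨾ Γ₁ ⊢ t ∶ A →
       Δ ⨾ Γ₂ ⊢ s ∶ B →
       Δ ⨾ Γ ⊢ ⟨ t , s ⟩ ∶ A ⊗ B

  ⊗E : ∀ {Γ Γ₁ Γ₂ A B C t s} → Γ₁ ⊎ Γ₂ ≃ Γ →
       Δ ⨾ Γ₁ ⊢ s ∶ A ⊗ B →
       Δ ⨾ (just A ∷ just B ∷ Γ₂) ⊢ t ∶ C →
       Δ ⨾ Γ ⊢ t [ pair ≔ s ] ∶ C

  ⅋I : ∀ {Γ A B t} →
       Δ ⨾ (just A ∷ just B ∷ Γ) ⊢ t ∶ ⊥ →
       Δ ⨾ Γ ⊢ ⅋λ t ∶ (A ^⊥) ⅋ (B ^⊥)

  ⅋E₁ : ∀ {Γ Γ₁ Γ₂ A B t s} → Γ₁ ⊎ Γ₂ ≃ Γ →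
       Δ ⨾ Γ₁ ⊢ t ∶ A ⅋ B →
       Δ ⨾ Γ₂ ⊢ s ∶ A ^⊥ →
       Δ ⨾ Γ ⊢ t • s ∶ B

  ⅋E₂ : ∀ {Γ Γ₁ Γ₂ A B t s} → Γ₁ ⊎ Γ₂ ≃ Γ →
       Δ ⨾ Γ₁ ⊢ t ∶ A ⅋ B →
       Δ ⨾ Γ₂ ⊢ s ∶ B ^⊥ →
       Δ ⨾ Γ ⊢ t ▼ s ∶ A

  !I : ∀ {A t} →
       Δ ⨾ (just A ∷ ∅) ⊢ t ∶ ⊥ →
       Δ ⨾ ∅ ⊢ !λ t ∶ ! (A ^⊥)

  !E : ∀ {Γ Γ₁ Γ₂ A B t s} → Γ₁ ⊎ Γ₂ ≃ Γ →
       Δ ⨾ Γ₁ ⊢ s ∶ ! A →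
       (A ∷ Δ) ⨾ Γ₂ ⊢ t ∶ B →
       Δ ⨾ Γ ⊢ t [ bang ≔ s ] ∶ B

  ¿I : ∀ {Γ A t} →
       ((A ^⊥) ∷ Δ) ⨾ Γ ⊢ t ∶ ⊥ →
       Δ ⨾ Γ ⊢ ¿λ t ∶ ¿ A

  ¿E : ∀ {Γ A t s} →
       Δ ⨾ Γ ⊢ s ∶ ¿ A →
       Δ ⨾ (just A ∷ ∅) ⊢ t ∶ ⊥ →
       Δ ⨾ Γ ⊢ t ▶ s ∶ ⊥

  cut : ∀ {Γ Γ₁ Γ₂ B t s} → Γ₁ ⊎ Γ₂ ≃ Γ →
       Δ ⨾ Γ₁ ⊢ t ∶ B →
       Δ ⨾ Γ₂ ⊢ s ∶ B ^⊥ →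
       Δ ⨾ Γ ⊢ t ♯ s ∶ ⊥

  𝟏I : Δ ⨾ ∅ ⊢ ⋆ ∶ 𝟏

  𝟏E : ∀ {Γ Γ₁ Γ₂ A t s} → Γ₁ ⊎ Γ₂ ≃ Γ →
       Δ ⨾ Γ₁ ⊢ s ∶ 𝟏 →
       Δ ⨾ Γ₂ ⊢ t ∶ A →
       Δ ⨾ Γ ⊢ t [ star ≔ s ] ∶ A

------------------------------------------------------------------------
-- Renaming and substitution

ren : (Fin m → Fin m′) → (Fin n → Fin n′) → Term m n → Term m′ n′
ren ρ σ (lvar a)      = lvar (σ a)
ren ρ σ (uvar u)      = uvar (ρ u)
ren ρ σ ⟨ t , s ⟩     = ⟨ ren ρ σ t , ren ρ σ s ⟩
ren ρ σ (t [ p ≔ s ]) = ren (lift (#ᵘ p) ρ) (lift (#ˡ p) σ) t [ p ≔ ren ρ σ s ]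
ren ρ σ (⅋λ t)        = ⅋λ ren ρ (lift 2 σ) t
ren ρ σ (t • s)       = ren ρ σ t • ren ρ σ s
ren ρ σ (t ▼ s)       = ren ρ σ t ▼ ren ρ σ s
ren ρ σ (!λ t)        = !λ ren ρ (lift 1 σ) t
ren ρ σ (¿λ t)        = ¿λ ren (lift 1 ρ) σ t
ren ρ σ (t ▶ s)       = ren ρ (lift 1 σ) t ▶ ren ρ σ s
ren ρ σ (t ♯ s)       = ren ρ σ t ♯ ren ρ σ s
ren ρ σ ⋆             = ⋆

wk : ∀ i j → Term m n → Term (i + m) (j + n)
wk i j = ren (i ↑ʳ_) (j ↑ʳ_)

liftᵘ : ∀ i j → (Fin m → Term m′ n′) → Fin (i + m) → Term (i + m′) (j + n′)
liftᵘ i j σ u = [ (λ v → uvar (v ↑ˡ _)) , (λ v → wk i j (σ v)) ]′ (splitAt i u)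

liftˡ : ∀ i j → (Fin n → Term m′ n′) → Fin (j + n) → Term (i + m′) (j + n′)
liftˡ i j τ a = [ (λ b → lvar (b ↑ˡ _)) , (λ b → wk i j (τ b)) ]′ (splitAt j a)

sub : (Fin m → Term m′ n′) → (Fin n → Term m′ n′) → Term m n → Term m′ n′
sub σ τ (lvar a)      = τ a
sub σ τ (uvar u)      = σ u
sub σ τ ⟨ t , s ⟩     = ⟨ sub σ τ t , sub σ τ s ⟩
sub σ τ (t [ p ≔ s ]) =
  sub (liftᵘ (#ᵘ p) (#ˡ p) σ) (liftˡ (#ᵘ p) (#ˡ p) τ) t [ p ≔ sub σ τ s ]
sub σ τ (⅋λ t)        = ⅋λ sub (liftᵘ 0 2 σ) (liftˡ 0 2 τ) t
sub σ τ (t • s)       = sub σ τ t • sub σ τ s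
sub σ τ (t ▼ s)       = sub σ τ t ▼ sub σ τ s
sub σ τ (!λ t)        = !λ sub (liftᵘ 0 1 σ) (liftˡ 0 1 τ) t
sub σ τ (¿λ t)        = ¿λ sub (liftᵘ 1 0 σ) (liftˡ 1 0 τ) t
sub σ τ (t ▶ s)       = sub (liftᵘ 0 1 σ) (liftˡ 0 1 τ) t ▶ sub σ τ s
sub σ τ (t ♯ s)       = sub σ τ t ♯ sub σ τ s
sub σ τ ⋆             = ⋆

-- t{a:=s}; the variable a leaves the scope.
_⟪_≔_⟫ : Term m (suc n) → Fin (suc n) → Term m n → Term m n
t ⟪ a ≔ s ⟫ = sub uvar (insertAt lvar a s) t

-- t{u:=s} for the most recently bound u.
_⟪_⟫ᵘ : Term (suc m) n → Term m n → Term m n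
t ⟪ s ⟫ᵘ = sub (insertAt uvar zero s) lvar t

------------------------------------------------------------------------
-- Linear terms and contra-substitution

-- The number of free occurrences of a linear variable.
occ : Fin n → Term m n → ℕ
occ a (lvar b)      = if does (a ≟ b) then 1 else 0
occ a (uvar u)      = 0
occ a ⟨ t , s ⟩     = occ a t + occ a s
occ a (t [ p ≔ s ]) = occ (#ˡ p ↑ʳ a) t + occ a s
occ a (⅋λ t)        = occ (2 ↑ʳ a) t
occ a (t • s)       = occ a t + occ a s
occ a (t ▼ s)       = occ a t + occ a s
occ a (!λ t)        = occ (1 ↑ʳ a) t
occ a (¿λ t)        = occ a t
occ a (t ▶ s)       = occ (1 ↑ʳ a) t + occ a s
occ a (t ♯ s)       = occ a t + occ a s
occ a ⋆             = 0

_∈fv_ : Fin n → Term m n → Bool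
a ∈fv t = 0 <ᵇ occ a t

-- The conditions that linearity imposes on bound variables and on the
-- subterms !a.t and t ▶ᵃ s.
BoundLinear : Term m n → Set
BoundLinear (lvar a)         = ⊤
BoundLinear (uvar u)         = ⊤
BoundLinear ⟨ t , s ⟩        = BoundLinear t × BoundLinear s
BoundLinear (t [ pair ≔ s ]) =
  occ zero t ≡ 1 × occ (suc zero) t ≡ 1 × BoundLinear t × BoundLinear s
BoundLinear (t [ bang ≔ s ]) = BoundLinear t × BoundLinear s
BoundLinear (t [ star ≔ s ]) = BoundLinear t × BoundLinear s
BoundLinear (⅋λ t)           =
  occ zero t ≡ 1 × occ (suc zero) t ≡ 1 × BoundLinear t
BoundLinear (t • s)          = BoundLinear t × BoundLinear s
BoundLinear (t ▼ s)          = BoundLinear t × BoundLinear s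
BoundLinear (!λ t)           =
  occ zero t ≡ 1 × (∀ a → occ (suc a) t ≡ 0) × BoundLinear t
BoundLinear (¿λ t)           = BoundLinear t
BoundLinear (t ▶ s)          =
  occ zero t ≡ 1 × (∀ a → occ (suc a) t ≡ 0) × BoundLinear t × BoundLinear s
BoundLinear (t ♯ s)          = BoundLinear t × BoundLinear s
BoundLinear ⋆                = ⊤

Linear : Term m n → Set
Linear t = (∀ a → occ a t ≤ 1) × BoundLinear t

-- contra a t s is t{a\\s}.  It is meaningful only for linear t with
-- a ∈ fv(t); the values on uvar, !λ, ⋆, on the first argument of ▶ and on
-- variables other than a are never reached from such t and are arbitrary.
-- The scope of t is kept, although a no longer occurs (unless it does in s).
contra : Fin n → Term m n → Term m n → Term m n
contra a (lvar b) s = s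
contra a (uvar u) s = uvar u
contra a ⟨ t₁ , t₂ ⟩ s =
  if a ∈fv t₁ then contra a t₁ (s ▼ t₂)
              else contra a t₂ (s • t₁)
contra a (t₁ • t₂) s =
  if a ∈fv t₁ then contra a t₁ ⟨ t₂ , s ⟩
              else contra a t₂ (t₁ ▼ s)
contra a (t₁ ▼ t₂) s =
  if a ∈fv t₁ then contra a t₁ ⟨ s , t₂ ⟩
              else contra a t₂ (t₁ • s)
contra a (t₁ [ pair ≔ t₂ ]) s =
  if (2 ↑ʳ a) ∈fv t₁ then contra (2 ↑ʳ a) t₁ (wk 0 2 s) [ pair ≔ t₂ ]
                     else contra a t₂ (⅋λ (t₁ ♯ wk 0 2 s))
contra a (⅋λ t) s = contra (2 ↑ʳ a) t ⋆ [ pair ≔ s ]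
contra a (t₁ [ bang ≔ t₂ ]) s =
  if a ∈fv t₁ then contra a t₁ (wk 1 0 s) [ bang ≔ t₂ ]
              else contra a t₂ (¿λ (t₁ ♯ wk 1 0 s))
contra a (¿λ t) s = contra a t ⋆ [ bang ≔ s ]
contra a (t₁ ▶ t₂) s = contra a t₂ (!λ t₁) [ star ≔ s ]
contra a (t₁ ♯ t₂) s =
  if a ∈fv t₁ then contra a t₁ t₂ [ star ≔ s ]
              else contra a t₂ t₁ [ star ≔ s ]
contra a (t₁ [ star ≔ t₂ ]) s =
  if a ∈fv t₁ then contra a t₁ s [ star ≔ t₂ ]
              else contra a t₂ (t₁ ♯ s)
contra a (!λ t) s = !λ t
contra a ⋆ s = ⋆

-- t{a\\⋆} for the most recently bound a.  Since a does not occur in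
-- contra zero t ⋆, the substitution only removes a from the scope.
contra⋆ : Term m (suc n) → Term m n
contra⋆ t = contra zero t ⋆ ⟪ zero ≔ ⋆ ⟫

------------------------------------------------------------------------
-- Contexts with a hole

-- A surface context whose hole binds i unrestricted and j linear variables.
data Surface (m n : ℕ) : ℕ → ℕ → Set where
  ⅋λ□     : Surface m n 0 2
  ⟨□,_⟩   : Term m n → Surface m n 0 0
  ⟨_,□⟩   : Term m n → Surface m n 0 0
  □•_     : Term m n → Surface m n 0 0
  _•□     : Term m n → Surface m n 0 0
  □▼_     : Term m n → Surface m n 0 0
  _▼□     : Term m n → Surface m n 0 0
  □♯_     : Term m n → Surface m n 0 0
  _♯□     : Term m n → Surface m n 0 0
  ¿λ□     : Surface m n 1 0
  □[_≔_]  : (p : Pat) → Term m n → Surface m n (#ᵘ p) (#ˡ p)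
  elim□   : (p : Pat) → Term (#ᵘ p + m) (#ˡ p + n) → Surface m n 0 0
  _▶□     : Term m (1 + n) → Surface m n 0 0

plugˢ : Surface m n i j → Term (i + m) (j + n) → Term m n
plugˢ ⅋λ□          r = ⅋λ r
plugˢ ⟨□, t ⟩      r = ⟨ r , t ⟩
plugˢ ⟨ t ,□⟩      r = ⟨ t , r ⟩
plugˢ (□• t)       r = r • t
plugˢ (t •□)       r = t • r
plugˢ (□▼ t)       r = r ▼ t
plugˢ (t ▼□)       r = t ▼ r
plugˢ (□♯ t)       r = r ♯ t
plugˢ (t ♯□)       r = t ♯ r
plugˢ ¿λ□          r = ¿λ r
plugˢ □[ p ≔ t ]   r = r [ p ≔ t ]
plugˢ (elim□ p t)  r = t [ p ≔ r ]
plugˢ (t ▶□)       r = t ▶ r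

renˢ : (Fin m → Fin m′) → (Fin n → Fin n′) → Surface m n i j → Surface m′ n′ i j
renˢ ρ σ ⅋λ□          = ⅋λ□
renˢ ρ σ ⟨□, t ⟩      = ⟨□, ren ρ σ t ⟩
renˢ ρ σ ⟨ t ,□⟩      = ⟨ ren ρ σ t ,□⟩
renˢ ρ σ (□• t)       = □• ren ρ σ t
renˢ ρ σ (t •□)       = ren ρ σ t •□
renˢ ρ σ (□▼ t)       = □▼ ren ρ σ t
renˢ ρ σ (t ▼□)       = ren ρ σ t ▼□
renˢ ρ σ (□♯ t)       = □♯ ren ρ σ t
renˢ ρ σ (t ♯□)       = ren ρ σ t ♯□
renˢ ρ σ ¿λ□          = ¿λ□
renˢ ρ σ □[ p ≔ t ]   = □[ p ≔ ren ρ σ t ]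
renˢ ρ σ (elim□ p t)  = elim□ p (ren (lift (#ᵘ p) ρ) (lift (#ˡ p) σ) t)
renˢ ρ σ (t ▶□)       = ren ρ (lift 1 σ) t ▶□

-- The one-hole contexts consisting of a single term constructor.
data Context (m n : ℕ) : ℕ → ℕ → Set where
  surface : Surface m n i j → Context m n i j
  !λ□     : Context m n 0 1
  □▶_     : Term m n → Context m n 0 1

plug : Context m n i j → Term (i + m) (j + n) → Term m n
plug (surface S) r = plugˢ S r
plug !λ□         r = !λ r
plug (□▶ t)      r = r ▶ t

-- Positive elimination contexts; elimᴸ p L t is L[p:=t].
data PosCtx (m n : ℕ) : Set where
  □     : PosCtx m n
  elimᴸ : (p : Pat) → PosCtx (#ᵘ p + m) (#ˡ p + n) → Term m n → PosCtx m n

-- The numbers of unrestricted and linear variables in scope at the hole.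
holeᵘ holeˡ : PosCtx m n → ℕ
holeᵘ {m} □           = m
holeᵘ (elimᴸ p L t)   = holeᵘ L
holeˡ {n = n} □       = n
holeˡ (elimᴸ p L t)   = holeˡ L

fill : (L : PosCtx m n) → Term (holeᵘ L) (holeˡ L) → Term m n
fill □             r = r
fill (elimᴸ p L t) r = fill L r [ p ≔ t ]

-- The inclusion of the variables in scope outside L among those at its hole.
inᵘ : (L : PosCtx m n) → Fin m → Fin (holeᵘ L)
inᵘ □             u = u
inᵘ (elimᴸ p L t) u = inᵘ L (#ᵘ p ↑ʳ u)

inˡ : (L : PosCtx m n) → Fin n → Fin (holeˡ L)
inˡ □             a = a
inˡ (elimᴸ p L t) a = inˡ L (#ˡ p ↑ʳ a)

renᴸ : (Fin m → Fin m′) → (Fin n → Fin n′) → PosCtx m n → PosCtx m′ n′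
renᴸ ρ σ □             = □
renᴸ ρ σ (elimᴸ p L t) =
  elimᴸ p (renᴸ (lift (#ᵘ p) ρ) (lift (#ˡ p) σ) L) (ren ρ σ t)

-- The action of a renaming of L on the variables at its hole.
holeRenᵘ : (ρ : Fin m → Fin m′) (σ : Fin n → Fin n′) (L : PosCtx m n) →
           Fin (holeᵘ L) → Fin (holeᵘ (renᴸ ρ σ L))
holeRenᵘ ρ σ □             = ρ
holeRenᵘ ρ σ (elimᴸ p L t) = holeRenᵘ (lift (#ᵘ p) ρ) (lift (#ˡ p) σ) L

holeRenˡ : (ρ : Fin m → Fin m′) (σ : Fin n → Fin n′) (L : PosCtx m n) →
           Fin (holeˡ L) → Fin (holeˡ (renᴸ ρ σ L))
holeRenˡ ρ σ □             = σ
holeRenˡ ρ σ (elimᴸ p L t) = holeRenˡ (lift (#ᵘ p) ρ) (lift (#ˡ p) σ) L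

-- In tLK the terms of L must avoid the variables bound by K: if L and K
-- live in the same scope, then L ↓ K is L weakened to the scope of K's
-- hole, and tLK is fill K (fill (L ↓ K) t).  The variables at the holes of
-- L and K are embedded by outᵘ, outˡ and inᵘ (L ↓ K), inˡ (L ↓ K).
_↓_ : PosCtx m n → (K : PosCtx m n) → PosCtx (holeᵘ K) (holeˡ K)
L ↓ K = renᴸ (inᵘ K) (inˡ K) L

outᵘ : (L K : PosCtx m n) → Fin (holeᵘ L) → Fin (holeᵘ (L ↓ K))
outᵘ L K = holeRenᵘ (inᵘ K) (inˡ K) L

outˡ : (L K : PosCtx m n) → Fin (holeˡ L) → Fin (holeˡ (L ↓ K))
outˡ L K = holeRenˡ (inᵘ K) (inˡ K) L

------------------------------------------------------------------------
-- Reduction and structural equivalence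

-- t{a:=s}{b:=r} for the two most recently bound a, b (b ∉ fv(s)).
_⟪_,_⟫ : Term m (2 + n) → Term m n → Term m n → Term m n
t ⟪ s , r ⟫ = t ⟪ zero ≔ wk 0 1 s ⟫ ⟪ zero ≔ r ⟫

-- A term moved under a positive elimination context is weakened, which
-- expresses that L and K capture none of its variables.
data _↦_ {m n : ℕ} : Term m n → Term m n → Set where

  ⅋• : ∀ L {t r} →
    fill L (⅋λ t) • r
      ↦ fill L (contra⋆ (t ⟪ zero ≔ wk 0 1 (ren (inᵘ L) (inˡ L) r) ⟫))

  ⅋▼ : ∀ L {t r} →
    fill L (⅋λ t) ▼ r
      ↦ fill L (contra⋆ (t ⟪ suc zero ≔ wk 0 1 (ren (inᵘ L) (inˡ L) r) ⟫))

  ⊗⊗ : ∀ L {t s r} →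
    t [ pair ≔ fill L ⟨ s , r ⟩ ]
      ↦ fill L (ren (inᵘ L) (lift 2 (inˡ L)) t ⟪ s , r ⟫)

  !! : ∀ L {t s} →
    t [ bang ≔ fill L (!λ s) ]
      ↦ fill L (ren (lift 1 (inᵘ L)) (inˡ L) t ⟪ contra⋆ s ⟫ᵘ)

  ¿▶ : ∀ L {t s} →
    t ▶ fill L (¿λ s)
      ↦ fill L (s ⟪ contra⋆ (ren (inᵘ L) (lift 1 (inˡ L)) t) ⟫ᵘ)

  ⅋♯⊗ : ∀ L K {t s r} →
    fill L (⅋λ t) ♯ fill K ⟨ s , r ⟩
      ↦ fill K (fill (L ↓ K)
          (ren (outᵘ L K) (lift 2 (outˡ L K)) t
            ⟪ ren (inᵘ (L ↓ K)) (inˡ (L ↓ K)) s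
            , ren (inᵘ (L ↓ K)) (inˡ (L ↓ K)) r ⟫))

  ⊗♯⅋ : ∀ L K {t s r} →
    fill L ⟨ s , r ⟩ ♯ fill K (⅋λ t)
      ↦ fill K (fill (L ↓ K)
          (ren (inᵘ (L ↓ K)) (lift 2 (inˡ (L ↓ K))) t
            ⟪ ren (outᵘ L K) (outˡ L K) s
            , ren (outᵘ L K) (outˡ L K) r ⟫))

  !♯¿ : ∀ L K {t r} →
    fill L (!λ t) ♯ fill K (¿λ r)
      ↦ fill K (fill (L ↓ K)
          (ren (lift 1 (inᵘ (L ↓ K))) (inˡ (L ↓ K)) r
            ⟪ contra⋆ (ren (outᵘ L K) (lift 1 (outˡ L K)) t) ⟫ᵘ))

  ¿♯! : ∀ L K {t r} →
    fill L (¿λ r) ♯ fill K (!λ t)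
      ↦ fill K (fill (L ↓ K)
          (ren (lift 1 (outᵘ L K)) (outˡ L K) r
            ⟪ contra⋆ (ren (inᵘ (L ↓ K)) (lift 1 (inˡ (L ↓ K))) t) ⟫ᵘ))

-- Exchanges two adjacent groups of i and j indices.
exchange : ∀ i j → Fin (i + (j + n)) → Fin (j + (i + n))
exchange {n} i j x =
  [ (λ y → j ↑ʳ (y ↑ˡ n)) , (λ z → lift j (i ↑ʳ_) z) ]′ (splitAt i x)

data _≈_ {m n : ℕ} : Term m n → Term m n → Set where

  -- S is weakened by p because fv(p) ∩ fv(S) = ∅, and r by S because r is
  -- free for S; t may use the variables bound by p and those bound by S.
  surface : (S : Surface m n i j) (p : Pat)
            {t : Term (#ᵘ p + (i + m)) (#ˡ p + (j + n))} {r : Term m n} →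
    plugˢ (renˢ (#ᵘ p ↑ʳ_) (#ˡ p ↑ʳ_) S)
          (ren (exchange (#ᵘ p) i) (exchange (#ˡ p) j) t) [ p ≔ r ]
      ≈ plugˢ S (t [ p ≔ wk i j r ])

  star-star : ∀ {t} → t [ star ≔ ⋆ ] ≈ t

  star-swap : ∀ {t s} → t [ star ≔ s ] ≈ s [ star ≔ t ]

  contra-cut : ∀ {t r} → Linear t → occ zero t ≡ 1 →
    contra⋆ t ♯ r ≈ t ⟪ zero ≔ r ⟫

-- Contextual closure of a relation R, with both sides of R of the same type
-- in the same contexts.  A context C is typed by its action on typed terms,
-- so that t and t′ are replaced for each other at one and the same type.
data Closure {X : Set} (R : ∀ {m n} → Term m n → Term m n → Set)
     {m n : ℕ} (Δ : Vec (Formula X) m) (Γ : LCtx (Formula X) n)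
     (A : Formula X) : Term m n → Term m n → Set where

  axiom : ∀ {t t′} → R t t′ →
    Δ ⨾ Γ ⊢ t ∶ A → Δ ⨾ Γ ⊢ t′ ∶ A →
    Closure R Δ Γ A t t′

  context : ∀ {i j} {Δ′ : Vec (Formula X) (i + m)} {Γ′ : LCtx (Formula X) (j + n)}
    {A′ t t′} (C : Context m n i j) →
    (∀ {r} → Δ′ ⨾ Γ′ ⊢ r ∶ A′ → Δ ⨾ Γ ⊢ plug C r ∶ A) →
    Closure R Δ′ Γ′ A′ t t′ →
    Closure R Δ Γ A (plug C t) (plug C t′)

_⨾_⊢_⟶⁻_∶_ : Vec (Formula X) m → LCtx (Formula X) n →
               Term m n → Term m n → Formula X → Set
Δ ⨾ Γ ⊢ t ⟶⁻ s ∶ A = Closure _↦_ Δ Γ A t s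

_⨾_⊢_≋_∶_ : Vec (Formula X) m → LCtx (Formula X) n →
              Term m n → Term m n → Formula X → Set
Δ ⨾ Γ ⊢ t ≋ s ∶ A = EqClosure (Closure _≈_ Δ Γ A) t s

_⨾_⊢_⟶_∶_ : Vec (Formula X) m → LCtx (Formula X) n →
              Term m n → Term m n → Formula X → Set
Δ ⨾ Γ ⊢ t ⟶ s ∶ A = ∃₂ λ t′ s′ →
  (Δ ⨾ Γ ⊢ t ≋ t′ ∶ A) × (Δ ⨾ Γ ⊢ t′ ⟶⁻ s′ ∶ A) × (Δ ⨾ Γ ⊢ s′ ≋ s ∶ A)

_⨾_⊢_≐_∶_ : Vec (Formula X) m → LCtx (Formula X) n →
              Term m n → Term m n → Formula X → Set
Δ ⨾ Γ ⊢ t ≐ s ∶ A =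
  EqClosure (λ t s → (Δ ⨾ Γ ⊢ t ⟶ s ∶ A) ⊎ (Δ ⨾ Γ ⊢ t ≋ s ∶ A)) t s

------------------------------------------------------------------------
-- The translation of μDCLL into λ_MELL

_ᵀ : Type X → Formula X
⊥       ᵀ = ⊥
atom α  ᵀ = atom α
(A ⊃ B) ᵀ = ¿ ((A ᵀ) ^⊥) ⅋ (B ᵀ)
(A ⊸ B) ᵀ = ((A ᵀ) ^⊥) ⅋ (B ᵀ)

-- Linear and continuation variables are both translated to linear
-- variables, along ρ and κ respectively.
translate : (Fin n → Fin l) → (Fin k → Fin l) → μTerm m n k → Term m l
translate ρ κ (lin x)   = lvar (ρ x)
translate ρ κ (unr u)   = uvar u
translate ρ κ (Λ M)     =
  ⅋λ ((translate (λ x → 2 ↑ʳ ρ x) (λ γ → 2 ↑ʳ κ γ) M [ bang ≔ lvar zero ])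
       ♯ lvar (suc zero))
translate ρ κ (M ＠ N)  =
  translate ρ κ M • (!λ (wk 0 1 (translate ρ κ N) ♯ lvar zero))
translate ρ κ (ƛ M)     =
  ⅋λ (translate (insertAt (λ x → 2 ↑ʳ ρ x) zero zero) (λ γ → 2 ↑ʳ κ γ) M
       ♯ lvar (suc zero))
translate ρ κ (M • N)   = translate ρ κ M • translate ρ κ N
translate ρ κ ([ γ ] M) = translate ρ κ M ♯ lvar (κ γ)
translate ρ κ (μ M)     =
  contra⋆ (translate (λ x → suc (ρ x)) (lift 1 κ) M)

_ᴴ : μTerm m n k → Term m (n + k)
_ᴴ {n = n} {k = k} = translate (_↑ˡ k) (n ↑ʳ_)

-- Γᴴ,(Σᴴ)^⊥
linearᴴ : LCtx (Type X) n → LCtx (Type X) k → LCtx (Formula X) (n + k)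
linearᴴ Γ Σ = map (Maybe.map _ᵀ) Γ ++ map (Maybe.map (λ A → (A ᵀ) ^⊥)) Σ

{-# OPTIONS --safe #-}

-- Both sides of every equation are translated into terms Tr mu υ ξ κ M in
-- which the μ of μDCLL is rendered not by contra-substitution but by the term
--
--   mu(a.t) = (℘(a,b). t[⋆:=b]) ▼ ⋆,
--
-- which reduces to t{a\\⋆}[⋆:=⋆] ≡ t{a\\⋆}.  Since mu is built from term
-- constructors it is a congruence and commutes with substitution, neither of
-- which has to be proved for contra-substitution.  The axiom
-- t{a\\⋆} ♯ r ≡ t{a:=r} yields mu(a.t) ♯ r ≐ t{a:=r}, t ♯ s ≐ s ♯ t and
-- (N • P) ♯ γ ≐ P ♯ (N ▼ γ).  By the last of these, replacing [γ]P by [γ](N • P)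
-- amounts to substituting N ▼ γ for γ, and the axiom for N • μγ.M becomes
--
--   N • mu(a.t) ≐ mu(a. (N • mu(a.t)) ♯ a) ≐ mu(a. mu(a.t) ♯ (N ▼ a))
--               ≐ mu(a. t{a:=N▼a}).

module Submission where

open import Defs renaming (refl to ≐-refl; sym to ≐-sym; trans to ≐-trans)
open import Data.Bool.Base using (true; false; if_then_else_)
open import Data.Empty using (⊥-elim)
open import Data.Fin.Base using (Fin; zero; suc; _↑ˡ_; _↑ʳ_; lift)
open import Data.Fin.Properties
  using (_≟_; splitAt-↑ˡ; splitAt-↑ʳ; ↑ʳ-injective; lift-injective; suc-injective)
open import Data.Maybe.Base using (Maybe; just; nothing)
import Data.Maybe.Base as Maybe
open import Data.Nat.Base using (ℕ; zero; suc; _+_; _≤_; z≤n; s≤s; _<ᵇ_)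
open import Data.Product.Base using (_×_; _,_; proj₁; ∃; ∃₂)
open import Data.Sum.Base using (_⊎_; inj₁; inj₂; [_,_]′)
open import Data.Unit.Base using (tt)
open import Data.Vec.Base using (Vec; []; _∷_; _++_; lookup; map)
open import Data.Vec.Functional using (insertAt)
open import Data.Vec.Properties using (lookup-replicate; lookup-map; lookup-++ʳ)
open import Function.Base using (_∘_; id)
open import Function.Definitions using (Injective)
import Relation.Binary.Construct.Closure.Equivalence as EqC
open import Relation.Binary.PropositionalEquality hiding ([_])
open import Relation.Nullary using (yes; no; does; ¬_)

-- Closure of `≐` under renaming or substitution is never proved, although every binder of the
-- translation weakens its subterms. Instead the translation takes terms for its free variables, and
-- the inductions quantify over these environments: a weakened or substituted translation is again a
-- translation, under another environment, so that the induction hypothesis applies to it as it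
-- stands. Congruence under `mu` and under `!λ` is accordingly stated for bodies that are already
-- renamed.
--
-- Contra-substitution branches on which subterm contains the variable. Typing settles every such
-- test, because it determines the number of occurrences of each linear variable. The same count
-- yields the linearity that the axiom on `contra⋆ t ♯ r` demands.
--
-- The exchange of `contra⋆` for `mu` is an induction on typing derivations, general enough to vary
-- the environment as well.

private
  variable
    X Y : Set
    m n k m′ n′ m″ n″ k″ i j l l′ : ℕ
    Γ Γ₁ Γ₂ Γ₃ Γ⁻ Γ₁₂ Γ₃₄ Γ₄ : LCtx X n
    Δ Δ′ : Vec (Formula X) m
    Θ Θ₁ Θ₂ : LCtx (Formula X) l
    A B C : Formula X
    t t′ s s′ r r′ : Term m n

-- Renaming and substitution

split-elim : ∀ k {P : Fin (k + n) → Set} →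
             (∀ y → P (y ↑ˡ n)) → (∀ z → P (k ↑ʳ z)) → ∀ x → P x
split-elim zero    L R x       = R x
split-elim (suc k) L R zero    = L zero
split-elim (suc k) L R (suc x) = split-elim k (L ∘ suc) R x

lift-∘ : ∀ k {f : Fin m′ → Fin m″} {g : Fin m → Fin m′} {h : Fin m → Fin m″} →
         (∀ x → f (g x) ≡ h x) → ∀ x → lift k f (lift k g x) ≡ lift k h x
lift-∘ zero    p x       = p x
lift-∘ (suc k) p zero    = refl
lift-∘ (suc k) p (suc x) = cong suc (lift-∘ k p x)

lift-id : ∀ k {f : Fin m → Fin m} → (∀ x → f x ≡ x) → ∀ x → lift k f x ≡ x
lift-id zero    p x       = p x
lift-id (suc k) p zero    = refl
lift-id (suc k) p (suc x) = cong suc (lift-id k p x)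

lift-↑ˡ : ∀ k (f : Fin m → Fin n) y → lift k f (y ↑ˡ m) ≡ y ↑ˡ n
lift-↑ˡ (suc k) f zero    = refl
lift-↑ˡ (suc k) f (suc y) = cong suc (lift-↑ˡ k f y)

lift-↑ʳ : ∀ k (f : Fin m → Fin n) z → lift k f (k ↑ʳ z) ≡ k ↑ʳ f z
lift-↑ʳ zero    f z = refl
lift-↑ʳ (suc k) f z = cong suc (lift-↑ʳ k f z)

liftᵘ-↑ˡ : ∀ i j (σ : Fin m → Term m′ n′) y → liftᵘ i j σ (y ↑ˡ m) ≡ uvar (y ↑ˡ m′)
liftᵘ-↑ˡ i j σ y = cong [ _ , _ ]′ (splitAt-↑ˡ i y _)

liftᵘ-↑ʳ : ∀ i j (σ : Fin m → Term m′ n′) z → liftᵘ i j σ (i ↑ʳ z) ≡ wk i j (σ z)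
liftᵘ-↑ʳ i j σ z = cong [ _ , _ ]′ (splitAt-↑ʳ i _ z)

liftˡ-↑ˡ : ∀ i j (τ : Fin n → Term m′ n′) y → liftˡ i j τ (y ↑ˡ n) ≡ lvar (y ↑ˡ n′)
liftˡ-↑ˡ i j τ y = cong [ _ , _ ]′ (splitAt-↑ˡ j y _)

liftˡ-↑ʳ : ∀ i j (τ : Fin n → Term m′ n′) z → liftˡ i j τ (j ↑ʳ z) ≡ wk i j (τ z)
liftˡ-↑ʳ i j τ z = cong [ _ , _ ]′ (splitAt-↑ʳ j _ z)

-- The composite is a third renaming tied to the other two by pointwise equations: `lift` commutes
-- with composition only pointwise, and this form passes under binders without function
-- extensionality. The later lemmas on `ren` and `sub` follow the same pattern.
ren-ren : {ρ′ : Fin m′ → Fin m″} {σ′ : Fin n′ → Fin n″} {ρ : Fin m → Fin m′} {σ : Fin n → Fin n′}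
          {ρ″ : Fin m → Fin m″} {σ″ : Fin n → Fin n″} →
          (∀ u → ρ′ (ρ u) ≡ ρ″ u) → (∀ a → σ′ (σ a) ≡ σ″ a) →
          ∀ t → ren ρ′ σ′ (ren ρ σ t) ≡ ren ρ″ σ″ t
ren-ren p q (lvar a)      = cong lvar (q a)
ren-ren p q (uvar u)      = cong uvar (p u)
ren-ren p q ⟨ t , s ⟩     = cong₂ ⟨_,_⟩ (ren-ren p q t) (ren-ren p q s)
ren-ren p q (elim π t s)  =
  cong₂ (elim π) (ren-ren (lift-∘ (#ᵘ π) p) (lift-∘ (#ˡ π) q) t) (ren-ren p q s)
ren-ren p q (⅋λ t)        = cong ⅋λ_ (ren-ren p (lift-∘ 2 q) t)
ren-ren p q (t • s)       = cong₂ _•_ (ren-ren p q t) (ren-ren p q s)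
ren-ren p q (t ▼ s)       = cong₂ _▼_ (ren-ren p q t) (ren-ren p q s)
ren-ren p q (!λ t)        = cong !λ_ (ren-ren p (lift-∘ 1 q) t)
ren-ren p q (¿λ t)        = cong ¿λ_ (ren-ren (lift-∘ 1 p) q t)
ren-ren p q (t ▶ s)       = cong₂ _▶_ (ren-ren p (lift-∘ 1 q) t) (ren-ren p q s)
ren-ren p q (t ♯ s)       = cong₂ _♯_ (ren-ren p q t) (ren-ren p q s)
ren-ren p q ⋆             = refl

ren-id : {ρ : Fin m → Fin m} {σ : Fin n → Fin n} →
         (∀ u → ρ u ≡ u) → (∀ a → σ a ≡ a) → ∀ t → ren ρ σ t ≡ t
ren-id p q (lvar a)      = cong lvar (q a)
ren-id p q (uvar u)      = cong uvar (p u)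
ren-id p q ⟨ t , s ⟩     = cong₂ ⟨_,_⟩ (ren-id p q t) (ren-id p q s)
ren-id p q (elim π t s)  =
  cong₂ (elim π) (ren-id (lift-id (#ᵘ π) p) (lift-id (#ˡ π) q) t) (ren-id p q s)
ren-id p q (⅋λ t)        = cong ⅋λ_ (ren-id p (lift-id 2 q) t)
ren-id p q (t • s)       = cong₂ _•_ (ren-id p q t) (ren-id p q s)
ren-id p q (t ▼ s)       = cong₂ _▼_ (ren-id p q t) (ren-id p q s)
ren-id p q (!λ t)        = cong !λ_ (ren-id p (lift-id 1 q) t)
ren-id p q (¿λ t)        = cong ¿λ_ (ren-id (lift-id 1 p) q t)
ren-id p q (t ▶ s)       = cong₂ _▶_ (ren-id p (lift-id 1 q) t) (ren-id p q s)
ren-id p q (t ♯ s)       = cong₂ _♯_ (ren-id p q t) (ren-id p q s)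
ren-id p q ⋆             = refl

ren-wk : ∀ i j (ρ : Fin m → Fin m′) (σ : Fin n → Fin n′) t →
         ren (lift i ρ) (lift j σ) (wk i j t) ≡ wk i j (ren ρ σ t)
ren-wk i j ρ σ t =
  trans (ren-ren (lift-↑ʳ i ρ) (lift-↑ʳ j σ) t)
        (sym (ren-ren (λ _ → refl) (λ _ → refl) t))

liftᵘ-lift : ∀ i j {σ : Fin m′ → Term m″ n″} {ρ : Fin m → Fin m′} {σ′ : Fin m → Term m″ n″} →
             (∀ u → σ (ρ u) ≡ σ′ u) → ∀ u → liftᵘ i j σ (lift i ρ u) ≡ liftᵘ i j σ′ u
liftᵘ-lift i j {σ} {ρ} {σ′} p = split-elim i
  (λ y → trans (cong (liftᵘ i j σ) (lift-↑ˡ i ρ y))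
               (trans (liftᵘ-↑ˡ i j σ y) (sym (liftᵘ-↑ˡ i j σ′ y))))
  (λ z → trans (cong (liftᵘ i j σ) (lift-↑ʳ i ρ z))
               (trans (liftᵘ-↑ʳ i j σ (ρ z))
                      (trans (cong (wk i j) (p z)) (sym (liftᵘ-↑ʳ i j σ′ z)))))

liftˡ-lift : ∀ i j {τ : Fin n′ → Term m″ n″} {θ : Fin n → Fin n′} {τ′ : Fin n → Term m″ n″} →
             (∀ a → τ (θ a) ≡ τ′ a) → ∀ a → liftˡ i j τ (lift j θ a) ≡ liftˡ i j τ′ a
liftˡ-lift i j {τ} {θ} {τ′} p = split-elim j
  (λ y → trans (cong (liftˡ i j τ) (lift-↑ˡ j θ y))
               (trans (liftˡ-↑ˡ i j τ y) (sym (liftˡ-↑ˡ i j τ′ y))))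
  (λ z → trans (cong (liftˡ i j τ) (lift-↑ʳ j θ z))
               (trans (liftˡ-↑ʳ i j τ (θ z))
                      (trans (cong (wk i j) (p z)) (sym (liftˡ-↑ʳ i j τ′ z)))))

sub-ren : {σ : Fin m′ → Term m″ n″} {τ : Fin n′ → Term m″ n″}
          {ρ : Fin m → Fin m′} {θ : Fin n → Fin n′}
          {σ′ : Fin m → Term m″ n″} {τ′ : Fin n → Term m″ n″} →
          (∀ u → σ (ρ u) ≡ σ′ u) → (∀ a → τ (θ a) ≡ τ′ a) →
          ∀ t → sub σ τ (ren ρ θ t) ≡ sub σ′ τ′ t
sub-ren p q (lvar a)      = q a
sub-ren p q (uvar u)      = p u
sub-ren p q ⟨ t , s ⟩     = cong₂ ⟨_,_⟩ (sub-ren p q t) (sub-ren p q s)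
sub-ren p q (elim π t s)  =
  cong₂ (elim π) (sub-ren (liftᵘ-lift (#ᵘ π) (#ˡ π) p) (liftˡ-lift (#ᵘ π) (#ˡ π) q) t) (sub-ren p q s)
sub-ren p q (⅋λ t)        = cong ⅋λ_ (sub-ren (cong (wk 0 2) ∘ p) (liftˡ-lift 0 2 q) t)
sub-ren p q (t • s)       = cong₂ _•_ (sub-ren p q t) (sub-ren p q s)
sub-ren p q (t ▼ s)       = cong₂ _▼_ (sub-ren p q t) (sub-ren p q s)
sub-ren p q (!λ t)        = cong !λ_ (sub-ren (cong (wk 0 1) ∘ p) (liftˡ-lift 0 1 q) t)
sub-ren p q (¿λ t)        = cong ¿λ_ (sub-ren (liftᵘ-lift 1 0 p) (cong (wk 1 0) ∘ q) t)
sub-ren p q (t ▶ s)       = cong₂ _▶_ (sub-ren (cong (wk 0 1) ∘ p) (liftˡ-lift 0 1 q) t) (sub-ren p q s)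
sub-ren p q (t ♯ s)       = cong₂ _♯_ (sub-ren p q t) (sub-ren p q s)
sub-ren p q ⋆             = refl

ren-liftᵘ : ∀ i j {ρ : Fin m′ → Fin m″} {θ : Fin n′ → Fin n″}
            {σ : Fin m → Term m′ n′} {σ′ : Fin m → Term m″ n″} →
            (∀ u → ren ρ θ (σ u) ≡ σ′ u) →
            ∀ u → ren (lift i ρ) (lift j θ) (liftᵘ i j σ u) ≡ liftᵘ i j σ′ u
ren-liftᵘ i j {ρ} {θ} {σ} {σ′} p = split-elim i
  (λ y → trans (cong (ren _ _) (liftᵘ-↑ˡ i j σ y))
               (trans (cong uvar (lift-↑ˡ i ρ y)) (sym (liftᵘ-↑ˡ i j σ′ y))))
  (λ z → trans (cong (ren _ _) (liftᵘ-↑ʳ i j σ z))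
               (trans (ren-wk i j ρ θ (σ z))
                      (trans (cong (wk i j) (p z)) (sym (liftᵘ-↑ʳ i j σ′ z)))))

ren-liftˡ : ∀ i j {ρ : Fin m′ → Fin m″} {θ : Fin n′ → Fin n″}
            {τ : Fin n → Term m′ n′} {τ′ : Fin n → Term m″ n″} →
            (∀ a → ren ρ θ (τ a) ≡ τ′ a) →
            ∀ a → ren (lift i ρ) (lift j θ) (liftˡ i j τ a) ≡ liftˡ i j τ′ a
ren-liftˡ i j {ρ} {θ} {τ} {τ′} p = split-elim j
  (λ y → trans (cong (ren _ _) (liftˡ-↑ˡ i j τ y))
               (trans (cong lvar (lift-↑ˡ j θ y)) (sym (liftˡ-↑ˡ i j τ′ y))))
  (λ z → trans (cong (ren _ _) (liftˡ-↑ʳ i j τ z))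
               (trans (ren-wk i j ρ θ (τ z))
                      (trans (cong (wk i j) (p z)) (sym (liftˡ-↑ʳ i j τ′ z)))))

ren-sub : {ρ : Fin m′ → Fin m″} {θ : Fin n′ → Fin n″}
          {σ : Fin m → Term m′ n′} {τ : Fin n → Term m′ n′}
          {σ′ : Fin m → Term m″ n″} {τ′ : Fin n → Term m″ n″} →
          (∀ u → ren ρ θ (σ u) ≡ σ′ u) → (∀ a → ren ρ θ (τ a) ≡ τ′ a) →
          ∀ t → ren ρ θ (sub σ τ t) ≡ sub σ′ τ′ t
ren-sub p q (lvar a)      = q a
ren-sub p q (uvar u)      = p u
ren-sub p q ⟨ t , s ⟩     = cong₂ ⟨_,_⟩ (ren-sub p q t) (ren-sub p q s)
ren-sub p q (elim π t s)  =
  cong₂ (elim π) (ren-sub (ren-liftᵘ (#ᵘ π) (#ˡ π) p) (ren-liftˡ (#ᵘ π) (#ˡ π) q) t) (ren-sub p q s)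
ren-sub p q (⅋λ t)        = cong ⅋λ_ (ren-sub (ren-liftᵘ 0 2 p) (ren-liftˡ 0 2 q) t)
ren-sub p q (t • s)       = cong₂ _•_ (ren-sub p q t) (ren-sub p q s)
ren-sub p q (t ▼ s)       = cong₂ _▼_ (ren-sub p q t) (ren-sub p q s)
ren-sub p q (!λ t)        = cong !λ_ (ren-sub (ren-liftᵘ 0 1 p) (ren-liftˡ 0 1 q) t)
ren-sub p q (¿λ t)        = cong ¿λ_ (ren-sub (ren-liftᵘ 1 0 p) (ren-liftˡ 1 0 q) t)
ren-sub p q (t ▶ s)       = cong₂ _▶_ (ren-sub (ren-liftᵘ 0 1 p) (ren-liftˡ 0 1 q) t) (ren-sub p q s)
ren-sub p q (t ♯ s)       = cong₂ _♯_ (ren-sub p q t) (ren-sub p q s)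
ren-sub p q ⋆             = refl

liftᵘ-var : ∀ i j {σ : Fin m → Term m n} → (∀ u → σ u ≡ uvar u) →
            ∀ u → liftᵘ i j σ u ≡ uvar u
liftᵘ-var i j {σ} p = split-elim i
  (liftᵘ-↑ˡ i j σ) (λ z → trans (liftᵘ-↑ʳ i j σ z) (cong (wk i j) (p z)))

liftˡ-var : ∀ i j {τ : Fin n → Term m n} → (∀ a → τ a ≡ lvar a) →
            ∀ a → liftˡ i j τ a ≡ lvar a
liftˡ-var i j {τ} p = split-elim j
  (liftˡ-↑ˡ i j τ) (λ z → trans (liftˡ-↑ʳ i j τ z) (cong (wk i j) (p z)))

sub-id : {σ : Fin m → Term m n} {τ : Fin n → Term m n} →
         (∀ u → σ u ≡ uvar u) → (∀ a → τ a ≡ lvar a) → ∀ t → sub σ τ t ≡ t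
sub-id p q (lvar a)      = q a
sub-id p q (uvar u)      = p u
sub-id p q ⟨ t , s ⟩     = cong₂ ⟨_,_⟩ (sub-id p q t) (sub-id p q s)
sub-id p q (elim π t s)  =
  cong₂ (elim π) (sub-id (liftᵘ-var (#ᵘ π) (#ˡ π) p) (liftˡ-var (#ᵘ π) (#ˡ π) q) t) (sub-id p q s)
sub-id p q (⅋λ t)        = cong ⅋λ_ (sub-id (liftᵘ-var 0 2 p) (liftˡ-var 0 2 q) t)
sub-id p q (t • s)       = cong₂ _•_ (sub-id p q t) (sub-id p q s)
sub-id p q (t ▼ s)       = cong₂ _▼_ (sub-id p q t) (sub-id p q s)
sub-id p q (!λ t)        = cong !λ_ (sub-id (liftᵘ-var 0 1 p) (liftˡ-var 0 1 q) t)
sub-id p q (¿λ t)        = cong ¿λ_ (sub-id (liftᵘ-var 1 0 p) (liftˡ-var 1 0 q) t)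
sub-id p q (t ▶ s)       = cong₂ _▶_ (sub-id (liftᵘ-var 0 1 p) (liftˡ-var 0 1 q) t) (sub-id p q s)
sub-id p q (t ♯ s)       = cong₂ _♯_ (sub-id p q t) (sub-id p q s)
sub-id p q ⋆             = refl

sub-cong : {σ σ′ : Fin m → Term m′ n′} {τ τ′ : Fin n → Term m′ n′} →
           (∀ u → σ u ≡ σ′ u) → (∀ a → τ a ≡ τ′ a) → ∀ t → sub σ τ t ≡ sub σ′ τ′ t
sub-cong p q t =
  trans (cong (sub _ _) (sym (ren-id (λ _ → refl) (λ _ → refl) t))) (sub-ren p q t)

sub-wk : ∀ i j (σ : Fin m → Term m′ n′) (τ : Fin n → Term m′ n′) t →
         sub (liftᵘ i j σ) (liftˡ i j τ) (wk i j t) ≡ wk i j (sub σ τ t)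
sub-wk i j σ τ t =
  trans (sub-ren (liftᵘ-↑ʳ i j σ) (liftˡ-↑ʳ i j τ) t)
        (sym (ren-sub (λ _ → refl) (λ _ → refl) t))

wk-sub : ∀ s (t : Term m n) → wk 0 1 t ⟪ zero ≔ s ⟫ ≡ t
wk-sub s t = trans (sub-ren (λ _ → refl) (λ _ → refl) t) (sub-id (λ _ → refl) (λ _ → refl) t)

-- Contra-substitution commutes with injective renaming

Inj : (Fin n → Fin n′) → Set
Inj = Injective _≡_ _≡_

does-≟-inj : {θ : Fin n → Fin n′} → Inj θ → ∀ a b → does (θ a ≟ θ b) ≡ does (a ≟ b)
does-≟-inj {θ = θ} inj a b with a ≟ b | θ a ≟ θ b
... | yes _ | yes _ = refl
... | no  _ | no  _ = refl
... | yes p | no ¬q = ⊥-elim (¬q (cong θ p))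
... | no ¬p | yes q = ⊥-elim (¬p (inj q))

-- A renaming that identified `a` with another variable would add occurrences; injectivity excludes
-- this and is inherited by `lift`.
occ-ren : {ρ : Fin m → Fin m′} {θ : Fin n → Fin n′} → Inj θ →
          ∀ a t → occ (θ a) (ren ρ θ t) ≡ occ a t
occ-ren inj a (lvar b)     = cong (if_then 1 else 0) (does-≟-inj inj a b)
occ-ren inj a (uvar u)     = refl
occ-ren inj a ⟨ t , s ⟩    = cong₂ _+_ (occ-ren inj a t) (occ-ren inj a s)
occ-ren {θ = θ} inj a (elim π t s) =
  cong₂ _+_ (trans (cong (λ b → occ b (ren _ (lift (#ˡ π) θ) t)) (sym (lift-↑ʳ (#ˡ π) θ a)))
                   (occ-ren (lift-injective θ inj (#ˡ π)) (#ˡ π ↑ʳ a) t))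
            (occ-ren inj a s)
occ-ren inj a (⅋λ t)       = occ-ren (lift-injective _ inj 2) (2 ↑ʳ a) t
occ-ren inj a (t • s)      = cong₂ _+_ (occ-ren inj a t) (occ-ren inj a s)
occ-ren inj a (t ▼ s)      = cong₂ _+_ (occ-ren inj a t) (occ-ren inj a s)
occ-ren inj a (!λ t)       = occ-ren (lift-injective _ inj 1) (1 ↑ʳ a) t
occ-ren inj a (¿λ t)       = occ-ren inj a t
occ-ren inj a (t ▶ s)      =
  cong₂ _+_ (occ-ren (lift-injective _ inj 1) (1 ↑ʳ a) t) (occ-ren inj a s)
occ-ren inj a (t ♯ s)      = cong₂ _+_ (occ-ren inj a t) (occ-ren inj a s)
occ-ren inj a ⋆            = refl

-- Rewriting with `occ-ren` turns the occurrence test on the renamed term into the test on the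
-- original one, so both sides take the same branch. Where `s` moves under a binder, `ren-wk`
-- exchanges the renaming with the weakening.
contra-ren : {ρ : Fin m → Fin m′} {θ : Fin n → Fin n′} → Inj θ →
             ∀ a t s → ren ρ θ (contra a t s) ≡ contra (θ a) (ren ρ θ t) (ren ρ θ s)
contra-ren inj a (lvar b) s = refl
contra-ren inj a (uvar u) s = refl
contra-ren {ρ = ρ} inj a ⟨ t₁ , t₂ ⟩ s rewrite occ-ren {ρ = ρ} inj a t₁ with 0 <ᵇ occ a t₁
... | true  = contra-ren inj a t₁ (s ▼ t₂)
... | false = contra-ren inj a t₂ (s • t₁)
contra-ren {ρ = ρ} {θ} inj a (elim pair t₁ t₂) s
  rewrite occ-ren {ρ = ρ} (lift-injective θ inj 2) (2 ↑ʳ a) t₁ with 0 <ᵇ occ (2 ↑ʳ a) t₁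
... | true  = cong (λ r → elim pair r (ren ρ θ t₂))
  (trans (contra-ren (lift-injective θ inj 2) (2 ↑ʳ a) t₁ (wk 0 2 s))
         (cong (contra (2 ↑ʳ θ a) (ren ρ (lift 2 θ) t₁)) (ren-wk 0 2 ρ θ s)))
... | false = trans (contra-ren inj a t₂ _)
  (cong (λ r → contra (θ a) (ren ρ θ t₂) (⅋λ (ren ρ (lift 2 θ) t₁ ♯ r))) (ren-wk 0 2 ρ θ s))
contra-ren {ρ = ρ} {θ} inj a (elim bang t₁ t₂) s
  rewrite occ-ren {ρ = lift 1 ρ} inj a t₁ with 0 <ᵇ occ a t₁
... | true  = cong (λ r → elim bang r (ren ρ θ t₂))
  (trans (contra-ren inj a t₁ (wk 1 0 s))
         (cong (contra (θ a) (ren (lift 1 ρ) θ t₁)) (ren-wk 1 0 ρ θ s)))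
... | false = trans (contra-ren inj a t₂ _)
  (cong (λ r → contra (θ a) (ren ρ θ t₂) (¿λ (ren (lift 1 ρ) θ t₁ ♯ r))) (ren-wk 1 0 ρ θ s))
contra-ren {ρ = ρ} inj a (elim star t₁ t₂) s rewrite occ-ren {ρ = ρ} inj a t₁ with 0 <ᵇ occ a t₁
... | true  = cong (λ r → elim star r _) (contra-ren inj a t₁ s)
... | false = contra-ren inj a t₂ (t₁ ♯ s)
contra-ren {θ = θ} inj a (⅋λ t) s =
  cong (λ r → elim pair r _) (contra-ren (lift-injective θ inj 2) (2 ↑ʳ a) t ⋆)
contra-ren {ρ = ρ} inj a (t₁ • t₂) s rewrite occ-ren {ρ = ρ} inj a t₁ with 0 <ᵇ occ a t₁
... | true  = contra-ren inj a t₁ ⟨ t₂ , s ⟩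
... | false = contra-ren inj a t₂ (t₁ ▼ s)
contra-ren {ρ = ρ} inj a (t₁ ▼ t₂) s rewrite occ-ren {ρ = ρ} inj a t₁ with 0 <ᵇ occ a t₁
... | true  = contra-ren inj a t₁ ⟨ s , t₂ ⟩
... | false = contra-ren inj a t₂ (t₁ • s)
contra-ren inj a (!λ t) s = refl
contra-ren inj a (¿λ t) s = cong (λ r → elim bang r _) (contra-ren inj a t ⋆)
contra-ren inj a (t₁ ▶ t₂) s = cong (λ r → elim star r _) (contra-ren inj a t₂ (!λ t₁))
contra-ren {ρ = ρ} inj a (t₁ ♯ t₂) s rewrite occ-ren {ρ = ρ} inj a t₁ with 0 <ᵇ occ a t₁
... | true  = cong (λ r → elim star r _) (contra-ren inj a t₁ t₂)
... | false = cong (λ r → elim star r _) (contra-ren inj a t₂ t₁)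
contra-ren inj a ⋆ s = refl

contra⋆-ren : {ρ : Fin m → Fin m′} {θ : Fin n → Fin n′} → Inj θ →
              ∀ t → ren ρ θ (contra⋆ t) ≡ contra⋆ (ren ρ (lift 1 θ) t)
contra⋆-ren {ρ = ρ} {θ} inj t =
  trans (ren-sub {σ′ = uvar ∘ ρ} {τ′ = insertAt (lvar ∘ θ) zero ⋆}
           (λ _ → refl) (λ { zero → refl ; (suc a) → refl }) (contra zero t ⋆))
 (trans (sym (sub-ren (λ _ → refl) (λ { zero → refl ; (suc a) → refl }) (contra zero t ⋆)))
        (cong _⟪ zero ≔ ⋆ ⟫ (contra-ren (lift-injective θ inj 1) zero t ⋆)))

-- Linear contexts

⊎-comm : Γ₁ ⊎ Γ₂ ≃ Γ → Γ₂ ⊎ Γ₁ ≃ Γ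
⊎-comm []        = []
⊎-comm (none p)  = none (⊎-comm p)
⊎-comm (left p)  = right (⊎-comm p)
⊎-comm (right p) = left (⊎-comm p)

⊎-identityˡ : {Γ : LCtx X n} → ∅ ⊎ Γ ≃ Γ
⊎-identityˡ {Γ = []}          = []
⊎-identityˡ {Γ = nothing ∷ Γ} = none ⊎-identityˡ
⊎-identityˡ {Γ = just A ∷ Γ}  = right ⊎-identityˡ

⊎-identityʳ : {Γ : LCtx X n} → Γ ⊎ ∅ ≃ Γ
⊎-identityʳ = ⊎-comm ⊎-identityˡ

∅⊎⇒≡ : {Γ Γ′ : LCtx X n} → ∅ ⊎ Γ ≃ Γ′ → Γ ≡ Γ′
∅⊎⇒≡ []        = refl
∅⊎⇒≡ (none p)  = cong (nothing ∷_) (∅⊎⇒≡ p)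
∅⊎⇒≡ (right p) = cong (just _ ∷_) (∅⊎⇒≡ p)

⊎-assocʳ : Γ₁ ⊎ Γ₂ ≃ Γ₁₂ → Γ₁₂ ⊎ Γ₃ ≃ Γ → ∃ λ Γ₂₃ → (Γ₂ ⊎ Γ₃ ≃ Γ₂₃) × (Γ₁ ⊎ Γ₂₃ ≃ Γ)
⊎-assocʳ []        []        = _ , [] , []
⊎-assocʳ (none p)  (none q)  with _ , r , s ← ⊎-assocʳ p q = _ , none r , none s
⊎-assocʳ (none p)  (right q) with _ , r , s ← ⊎-assocʳ p q = _ , right r , right s
⊎-assocʳ (left p)  (left q)  with _ , r , s ← ⊎-assocʳ p q = _ , none r , left s
⊎-assocʳ (right p) (left q)  with _ , r , s ← ⊎-assocʳ p q = _ , left r , right s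

⊎-assocˡ : Γ₁ ⊎ Γ₁₂ ≃ Γ → Γ₂ ⊎ Γ₃ ≃ Γ₁₂ → ∃ λ Γ₁₃ → (Γ₁ ⊎ Γ₂ ≃ Γ₁₃) × (Γ₁₃ ⊎ Γ₃ ≃ Γ)
⊎-assocˡ p q with _ , r , s ← ⊎-assocʳ (⊎-comm q) (⊎-comm p) = _ , ⊎-comm r , ⊎-comm s

-- Linear and continuation variables are split separately but share one context after translation;
-- this regroups the four pieces by subterm.
⊎-interchange : Γ₁ ⊎ Γ₂ ≃ Γ₁₂ → Γ₃ ⊎ Γ₄ ≃ Γ₃₄ → Γ₁₂ ⊎ Γ₃₄ ≃ Γ →
                ∃₂ λ Γ₁₃ Γ₂₄ → (Γ₁ ⊎ Γ₃ ≃ Γ₁₃) × (Γ₂ ⊎ Γ₄ ≃ Γ₂₄) × (Γ₁₃ ⊎ Γ₂₄ ≃ Γ)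
⊎-interchange p q r
  with _ , p₁ , p₂ ← ⊎-assocʳ p r
  with _ , q₁ , q₂ ← ⊎-assocˡ p₁ q
  with _ , r₁ , r₂ ← ⊎-assocʳ (⊎-comm q₁) q₂
  with _ , s₁ , s₂ ← ⊎-assocˡ p₂ r₂ = _ , _ , s₁ , r₁ , s₂

-- The two cases are the two branches of `contra` at a binary constructor. The last component of the
-- second case makes the test for `a` in the left subterm false; in the first case `lookup-single-⊎`
-- makes it true.
single-split : ∀ (a : Fin n) {A} → single a A ⊎ Γ⁻ ≃ Γ → Γ₁ ⊎ Γ₂ ≃ Γ →
  (∃ λ Γ₁⁻ → (single a A ⊎ Γ₁⁻ ≃ Γ₁) × (Γ₁⁻ ⊎ Γ₂ ≃ Γ⁻)) ⊎
  (∃ λ Γ₂⁻ → (single a A ⊎ Γ₂⁻ ≃ Γ₂) × (Γ₁ ⊎ Γ₂⁻ ≃ Γ⁻) × lookup Γ₁ a ≡ nothing)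
single-split zero (left p) (left q) rewrite ∅⊎⇒≡ p =
  inj₁ (_ , left ⊎-identityˡ , none q)
single-split zero (left p) (right q) rewrite ∅⊎⇒≡ p =
  inj₂ (_ , left ⊎-identityˡ , none q , refl)
single-split (suc a) (none p) (none q) with single-split a p q
... | inj₁ (_ , r , s)     = inj₁ (_ , none r , none s)
... | inj₂ (_ , r , s , e) = inj₂ (_ , none r , none s , e)
single-split (suc a) (right p) (left q) with single-split a p q
... | inj₁ (_ , r , s)     = inj₁ (_ , right r , left s)
... | inj₂ (_ , r , s , e) = inj₂ (_ , none r , left s , e)
single-split (suc a) (right p) (right q) with single-split a p q
... | inj₁ (_ , r , s)     = inj₁ (_ , none r , right s)
... | inj₂ (_ , r , s , e) = inj₂ (_ , right r , right s , e)

single-⊎-∅ : ∀ (a : Fin n) {A : X} → ¬ (single a A ⊎ Γ ≃ ∅)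
single-⊎-∅ (suc a) (none p) = single-⊎-∅ a p

single-⊎-single : ∀ (a b : Fin n) {A B : X} → single a A ⊎ Γ ≃ single b B → A ≡ B × Γ ≡ ∅
single-⊎-single zero    zero    (left p) = refl , cong (nothing ∷_) (∅⊎⇒≡ p)
single-⊎-single (suc a) zero    (right p) = ⊥-elim (single-⊎-∅ a p)
single-⊎-single (suc a) (suc b) (none p)
  with refl , refl ← single-⊎-single a b p = refl , refl

-- T i Θ A says that the variable i is interpreted at type A by something
-- that uses exactly the linear variables of Θ; then Env T Γ Θ says that all
-- variables of Γ are so interpreted, and that Θ is the disjoint union of the
-- linear variables used.
Env : {X Y : Set} {n l : ℕ} → (Fin n → LCtx Y l → X → Set) → LCtx X n → LCtx Y l → Set
Env T []            Θ = Θ ≡ ∅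
Env T (nothing ∷ Γ) Θ = Env (T ∘ suc) Γ Θ
Env T (just A ∷ Γ)  Θ =
  ∃₂ λ Θ₁ Θ₂ → (Θ₁ ⊎ Θ₂ ≃ Θ) × T zero Θ₁ A × Env (T ∘ suc) Γ Θ₂

module _ {X Y : Set} where

  Env-∅ : (T : Fin n → LCtx Y l → X → Set) → Env T ∅ ∅
  Env-∅ {n = zero}  T = refl
  Env-∅ {n = suc n} T = Env-∅ (T ∘ suc)

  Env-∅⁻ : (T : Fin n → LCtx Y l → X → Set) {Θ : LCtx Y l} → Env T ∅ Θ → Θ ≡ ∅
  Env-∅⁻ {n = zero}  T e = e
  Env-∅⁻ {n = suc n} T e = Env-∅⁻ (T ∘ suc) e

  Env-single⁻ : (T : Fin n → LCtx Y l → X → Set) (a : Fin n) {A : X} {Θ : LCtx Y l} →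
                Env T (single a A) Θ → T a Θ A
  Env-single⁻ T zero (_ , _ , p , x , e)
    with refl ← Env-∅⁻ (T ∘ suc) e
    with refl ← ∅⊎⇒≡ (⊎-comm p) = x
  Env-single⁻ T (suc a) e = Env-single⁻ (T ∘ suc) a e

  Env-split : (T : Fin n → LCtx Y l → X → Set) {Γ Γ₁ Γ₂ : LCtx X n} {Θ : LCtx Y l} →
              Γ₁ ⊎ Γ₂ ≃ Γ → Env T Γ Θ →
              ∃₂ λ Θ₁ Θ₂ → (Θ₁ ⊎ Θ₂ ≃ Θ) × Env T Γ₁ Θ₁ × Env T Γ₂ Θ₂
  Env-split T []       refl = _ , _ , ⊎-identityʳ , refl , refl
  Env-split T (none p) e    = Env-split (T ∘ suc) p e
  Env-split T (left p) (_ , _ , q , x , e)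
    with _ , _ , r , e₁ , e₂ ← Env-split (T ∘ suc) p e
    with _ , q₁ , q₂ ← ⊎-assocˡ q r = _ , _ , q₂ , (_ , _ , q₁ , x , e₁) , e₂
  Env-split T (right p) (_ , _ , q , x , e)
    with _ , _ , r , e₁ , e₂ ← Env-split (T ∘ suc) p e
    with _ , q₁ , q₂ ← ⊎-assocˡ q (⊎-comm r) = _ , _ , ⊎-comm q₂ , e₁ , (_ , _ , q₁ , x , e₂)

  Env-map : (f : LCtx Y l → LCtx Y l′) → f ∅ ≡ ∅ →
            (∀ {Θ₁ Θ₂ Θ} → Θ₁ ⊎ Θ₂ ≃ Θ → f Θ₁ ⊎ f Θ₂ ≃ f Θ) →
            (T : Fin n → LCtx Y l → X → Set) (T′ : Fin n → LCtx Y l′ → X → Set) →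
            (∀ i {Θ A} → T i Θ A → T′ i (f Θ) A) →
            ∀ Γ {Θ} → Env T Γ Θ → Env T′ Γ (f Θ)
  Env-map f f∅ f⊎ T T′ h []            refl = f∅
  Env-map f f∅ f⊎ T T′ h (nothing ∷ Γ) e    = Env-map f f∅ f⊎ (T ∘ suc) (T′ ∘ suc) (h ∘ suc) Γ e
  Env-map f f∅ f⊎ T T′ h (just A ∷ Γ)  (_ , _ , p , x , e) =
    _ , _ , f⊎ p , h zero x , Env-map f f∅ f⊎ (T ∘ suc) (T′ ∘ suc) (h ∘ suc) Γ e

  Env-bind : (T : Fin n → LCtx Y l → X → Set) (T′ : Fin (suc n) → LCtx Y (suc l) → X → Set) →
             {A : X} {B : Y} → T′ zero (just B ∷ ∅) A →
             (∀ i {Θ A} → T i Θ A → T′ (suc i) (nothing ∷ Θ) A) →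
             ∀ Γ {Θ} → Env T Γ Θ → Env T′ (just A ∷ Γ) (just B ∷ Θ)
  Env-bind T T′ x h Γ e =
    _ , _ , left ⊎-identityˡ , x , Env-map (nothing ∷_) refl none T (T′ ∘ suc) h Γ e

-- `Env (Sing θ) Γ Θ` says that `Θ` is the image of `Γ` along `θ`. Disjointness in `Env` already
-- forces `θ` to be injective on the domain of `Γ`.
Sing : {Y : Set} → (Fin n → Fin l) → Fin n → LCtx Y l → Y → Set
Sing θ i Θ A = Θ ≡ single (θ i) A

Sing-lift : ∀ k (θ : Fin n → Fin l) {A : Y} Γ {Θ} →
            Env (Sing (lift k θ)) Γ Θ → Env (Sing (lift (suc k) θ)) (just A ∷ Γ) (just A ∷ Θ)
Sing-lift k θ = Env-bind (Sing (lift k θ)) (Sing (lift (suc k) θ)) refl (λ i → cong (nothing ∷_))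

Sing-lift₂ : ∀ (θ : Fin n → Fin l) {A B : Y} Γ {Θ} → Env (Sing θ) Γ Θ →
             Env (Sing (lift 2 θ)) (just A ∷ just B ∷ Γ) (just A ∷ just B ∷ Θ)
Sing-lift₂ θ Γ e = Sing-lift 1 θ (just _ ∷ Γ) (Sing-lift 0 θ Γ e)

Sing-id : (Γ : LCtx Y n) → Env (Sing id) Γ Γ
Sing-id []            = refl
Sing-id (nothing ∷ Γ) =
  Env-map (nothing ∷_) refl none (Sing id) (Sing suc) (λ i → cong (nothing ∷_)) Γ (Sing-id Γ)
Sing-id (just A ∷ Γ)  = Env-bind (Sing id) (Sing id) refl (λ i → cong (nothing ∷_)) Γ (Sing-id Γ)

pad : ∀ j → LCtx Y n → LCtx Y (j + n)
pad zero    Γ = Γ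
pad (suc j) Γ = nothing ∷ pad j Γ

pad-∅ : ∀ j → pad j (∅ {n} {Y}) ≡ ∅
pad-∅ zero    = refl
pad-∅ (suc j) = cong (nothing ∷_) (pad-∅ j)

pad-⊎ : ∀ j {Γ₁ Γ₂ Γ : LCtx Y n} → Γ₁ ⊎ Γ₂ ≃ Γ → pad j Γ₁ ⊎ pad j Γ₂ ≃ pad j Γ
pad-⊎ zero    p = p
pad-⊎ (suc j) p = none (pad-⊎ j p)

pad-single : ∀ j (a : Fin n) {A : Y} → pad j (single a A) ≡ single (j ↑ʳ a) A
pad-single zero    a = refl
pad-single (suc j) a = cong (nothing ∷_) (pad-single j a)

Sing-↑ʳ : ∀ j (Γ : LCtx Y n) → Env (Sing (j ↑ʳ_)) Γ (pad j Γ)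
Sing-↑ʳ j Γ = Env-map (pad j) (pad-∅ j) (pad-⊎ j) (Sing id) (Sing (j ↑ʳ_))
  (λ { a refl → pad-single j a }) Γ (Sing-id Γ)

-- Typing

ext-lookup : {ρ : Fin m → Fin m′} {Δ : Vec Y m} {Δ′ : Vec Y m′} {B : Y} →
             (∀ u → lookup Δ′ (ρ u) ≡ lookup Δ u) →
             ∀ u → lookup (B ∷ Δ′) (lift 1 ρ u) ≡ lookup (B ∷ Δ) u
ext-lookup h zero    = refl
ext-lookup h (suc u) = h u

ren-typed : {ρ : Fin m → Fin m′} {θ : Fin n → Fin n′} →
            (∀ u → lookup Δ′ (ρ u) ≡ lookup Δ u) → Env (Sing θ) Γ Θ →
            Δ ⨾ Γ ⊢ t ∶ A → Δ′ ⨾ Θ ⊢ ren ρ θ t ∶ A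
ren-typed {θ = θ} h e (lvar a) with refl ← Env-single⁻ (Sing θ) a e = lvar (θ a)
ren-typed {ρ = ρ} {θ = θ} h e (uvar u) with refl ← Env-∅⁻ (Sing θ) e =
  subst (_ ⨾ _ ⊢ _ ∶_) (h u) (uvar (ρ u))
ren-typed {θ = θ} h e (⊗I p x y) with _ , _ , q , e₁ , e₂ ← Env-split (Sing θ) p e =
  ⊗I q (ren-typed h e₁ x) (ren-typed h e₂ y)
ren-typed {θ = θ} h e (⊗E {Γ₂ = Γ₂} p x y)
  with _ , _ , q , e₁ , e₂ ← Env-split (Sing θ) p e =
  ⊗E q (ren-typed h e₁ x) (ren-typed h (Sing-lift₂ θ Γ₂ e₂) y)
ren-typed {Γ = Γ} {θ = θ} h e (⅋I x) = ⅋I (ren-typed h (Sing-lift₂ θ Γ e) x)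
ren-typed {θ = θ} h e (⅋E₁ p x y) with _ , _ , q , e₁ , e₂ ← Env-split (Sing θ) p e =
  ⅋E₁ q (ren-typed h e₁ x) (ren-typed h e₂ y)
ren-typed {θ = θ} h e (⅋E₂ p x y) with _ , _ , q , e₁ , e₂ ← Env-split (Sing θ) p e =
  ⅋E₂ q (ren-typed h e₁ x) (ren-typed h e₂ y)
ren-typed {θ = θ} h e (!I x) with refl ← Env-∅⁻ (Sing θ) e =
  !I (ren-typed h (Sing-lift 0 θ ∅ (Env-∅ (Sing θ))) x)
ren-typed {θ = θ} h e (!E p x y) with _ , _ , q , e₁ , e₂ ← Env-split (Sing θ) p e =
  !E q (ren-typed h e₁ x) (ren-typed (ext-lookup h) e₂ y)
ren-typed h e (¿I x) = ¿I (ren-typed (ext-lookup h) e x)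
ren-typed {θ = θ} h e (¿E x y) =
  ¿E (ren-typed h e x) (ren-typed h (Sing-lift 0 θ ∅ (Env-∅ (Sing θ))) y)
ren-typed {θ = θ} h e (cut p x y) with _ , _ , q , e₁ , e₂ ← Env-split (Sing θ) p e =
  cut q (ren-typed h e₁ x) (ren-typed h e₂ y)
ren-typed {θ = θ} h e 𝟏I with refl ← Env-∅⁻ (Sing θ) e = 𝟏I
ren-typed {θ = θ} h e (𝟏E p x y) with _ , _ , q , e₁ , e₂ ← Env-split (Sing θ) p e =
  𝟏E q (ren-typed h e₁ x) (ren-typed h e₂ y)

wk-typed : (Bs : Vec (Formula X) i) → ∀ j → {Δ : Vec (Formula X) m} {Γ : LCtx (Formula X) n} →
           Δ ⨾ Γ ⊢ t ∶ A → (Bs ++ Δ) ⨾ pad j Γ ⊢ wk i j t ∶ A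
wk-typed Bs j {Δ} {Γ} = ren-typed (lookup-++ʳ Bs Δ) (Sing-↑ʳ j Γ)

wkᵘ-typed : Δ ⨾ Γ ⊢ t ∶ A → (B ∷ Δ) ⨾ Γ ⊢ wk 1 0 t ∶ A
wkᵘ-typed = wk-typed (_ ∷ []) 0

wkˡ-typed : Δ ⨾ Γ ⊢ t ∶ A → Δ ⨾ (nothing ∷ Γ) ⊢ wk 0 1 t ∶ A
wkˡ-typed = wk-typed [] 1

wkˡˡ-typed : Δ ⨾ Γ ⊢ t ∶ A → Δ ⨾ (nothing ∷ nothing ∷ Γ) ⊢ wk 0 2 t ∶ A
wkˡˡ-typed = wk-typed [] 2

Typed : Vec (Formula X) m → (Fin n → Term m l) → Fin n → LCtx (Formula X) l → Formula X → Set
Typed Δ τ i Θ A = Δ ⨾ Θ ⊢ τ i ∶ A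

Typed-lift : (τ : Fin n → Term m l) {Δ : Vec (Formula X) m} {A : Formula X} → ∀ Γ {Θ} →
             Env (Typed Δ τ) Γ Θ → Env (Typed Δ (liftˡ 0 1 τ)) (just A ∷ Γ) (just A ∷ Θ)
Typed-lift τ {Δ} = Env-bind (Typed Δ τ) (Typed Δ (liftˡ 0 1 τ)) (lvar zero) (λ _ → wkˡ-typed)

Typed-lift₂ : (τ : Fin n → Term m l) {Δ : Vec (Formula X) m} {A B : Formula X} → ∀ Γ {Θ} →
              Env (Typed Δ τ) Γ Θ →
              Env (Typed Δ (liftˡ 0 2 τ)) (just A ∷ just B ∷ Γ) (just A ∷ just B ∷ Θ)
Typed-lift₂ τ {Δ} Γ e =
  Env-bind (Typed Δ (liftˡ 0 1 τ)) (Typed Δ (liftˡ 0 2 τ)) (lvar zero)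
    (λ { zero    x → wkˡ-typed x
       ; (suc a) x → subst (Δ ⨾ _ ⊢_∶ _) (ren-ren (λ _ → refl) (λ _ → refl) (τ a)) (wkˡ-typed x) })
    (just _ ∷ Γ) (Typed-lift τ Γ e)

sub-typed : {σ : Fin m → Term m′ n′} {τ : Fin n → Term m′ n′} →
            (∀ u → Δ′ ⨾ ∅ ⊢ σ u ∶ lookup Δ u) → Env (Typed Δ′ τ) Γ Θ →
            Δ ⨾ Γ ⊢ t ∶ A → Δ′ ⨾ Θ ⊢ sub σ τ t ∶ A
sub-typed {Δ′ = Δ′} {τ = τ} h e (lvar a) = Env-single⁻ (Typed Δ′ τ) a e
sub-typed {Δ′ = Δ′} {τ = τ} h e (uvar u) with refl ← Env-∅⁻ (Typed Δ′ τ) e = h u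
sub-typed {Δ′ = Δ′} {τ = τ} h e (⊗I p x y)
  with _ , _ , q , e₁ , e₂ ← Env-split (Typed Δ′ τ) p e =
  ⊗I q (sub-typed h e₁ x) (sub-typed h e₂ y)
sub-typed {Δ′ = Δ′} {τ = τ} h e (⊗E {Γ₂ = Γ₂} p x y)
  with _ , _ , q , e₁ , e₂ ← Env-split (Typed Δ′ τ) p e =
  ⊗E q (sub-typed h e₁ x) (sub-typed (wkˡˡ-typed ∘ h) (Typed-lift₂ τ Γ₂ e₂) y)
sub-typed {Γ = Γ} {τ = τ} h e (⅋I x) =
  ⅋I (sub-typed (wkˡˡ-typed ∘ h) (Typed-lift₂ τ Γ e) x)
sub-typed {Δ′ = Δ′} {τ = τ} h e (⅋E₁ p x y)
  with _ , _ , q , e₁ , e₂ ← Env-split (Typed Δ′ τ) p e =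
  ⅋E₁ q (sub-typed h e₁ x) (sub-typed h e₂ y)
sub-typed {Δ′ = Δ′} {τ = τ} h e (⅋E₂ p x y)
  with _ , _ , q , e₁ , e₂ ← Env-split (Typed Δ′ τ) p e =
  ⅋E₂ q (sub-typed h e₁ x) (sub-typed h e₂ y)
sub-typed {Δ′ = Δ′} {τ = τ} h e (!I x) with refl ← Env-∅⁻ (Typed Δ′ τ) e =
  !I (sub-typed (wkˡ-typed ∘ h) (Typed-lift τ ∅ (Env-∅ (Typed Δ′ τ))) x)
sub-typed {Δ′ = Δ′} {Δ = Δ} {σ = σ} {τ = τ} h e (!E {Γ₂ = Γ₂} p x y)
  with _ , _ , q , e₁ , e₂ ← Env-split (Typed Δ′ τ) p e =
  !E q (sub-typed h e₁ x)
    (sub-typed (λ { zero → uvar zero ; (suc u) → wkᵘ-typed (h u) })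
      (Env-map id refl id (Typed Δ′ τ) (Typed (_ ∷ Δ′) (liftˡ 1 0 τ)) (λ _ → wkᵘ-typed) Γ₂ e₂) y)
sub-typed {Δ′ = Δ′} {Γ = Γ} {τ = τ} h e (¿I x) =
  ¿I (sub-typed (λ { zero → uvar zero ; (suc u) → wkᵘ-typed (h u) })
       (Env-map id refl id (Typed Δ′ τ) (Typed (_ ∷ Δ′) (liftˡ 1 0 τ)) (λ _ → wkᵘ-typed) Γ e) x)
sub-typed {Δ′ = Δ′} {τ = τ} h e (¿E x y) =
  ¿E (sub-typed h e x) (sub-typed (wkˡ-typed ∘ h) (Typed-lift τ ∅ (Env-∅ (Typed Δ′ τ))) y)
sub-typed {Δ′ = Δ′} {τ = τ} h e (cut p x y)
  with _ , _ , q , e₁ , e₂ ← Env-split (Typed Δ′ τ) p e =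
  cut q (sub-typed h e₁ x) (sub-typed h e₂ y)
sub-typed {Δ′ = Δ′} {τ = τ} h e 𝟏I with refl ← Env-∅⁻ (Typed Δ′ τ) e = 𝟏I
sub-typed {Δ′ = Δ′} {τ = τ} h e (𝟏E {t = t} p x y)
  with _ , _ , q , e₁ , e₂ ← Env-split (Typed Δ′ τ) p e =
  -- A unit eliminator binds nothing, yet `sub` still applies `wk 0 0` to the substituted terms,
  -- which is the identity only propositionally.
  𝟏E q (sub-typed h e₁ x) (subst (_ ⨾ _ ⊢_∶ _) (sub-cong wk₀₀ wk₀₀ t) (sub-typed h e₂ y))
  where
  wk₀₀ : {f : Fin k → Term m n} → ∀ x → f x ≡ wk 0 0 (f x)
  wk₀₀ x = sym (ren-id (λ _ → refl) (λ _ → refl) _)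

-- Occurrence counts and linearity of typable terms

count : Maybe Y → ℕ
count (just _) = 1
count nothing  = 0

count-∅ : (a : Fin n) → count (lookup (∅ {T = Y}) a) ≡ 0
count-∅ a = cong count (lookup-replicate a nothing)

count-⊎ : {Γ₁ Γ₂ Γ : LCtx Y n} → Γ₁ ⊎ Γ₂ ≃ Γ →
          ∀ a → count (lookup Γ₁ a) + count (lookup Γ₂ a) ≡ count (lookup Γ a)
count-⊎ (none p)  zero    = refl
count-⊎ (left p)  zero    = refl
count-⊎ (right p) zero    = refl
count-⊎ (none p)  (suc a) = count-⊎ p a
count-⊎ (left p)  (suc a) = count-⊎ p a
count-⊎ (right p) (suc a) = count-⊎ p a

count-single : ∀ (a b : Fin n) {A : Y} →
               (if does (a ≟ b) then 1 else 0) ≡ count (lookup (single b A) a)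
count-single zero    zero    = refl
count-single zero    (suc b) = refl
count-single (suc a) zero    = sym (count-∅ a)
count-single (suc a) (suc b) = count-single a b

-- The rules split the context disjointly and the leaves use all of it, so a variable occurs once if
-- it is assigned a type and not at all otherwise. This decides the tests in `contra` and gives the
-- side condition of `contra-cut`.
occ-typed : Δ ⨾ Γ ⊢ t ∶ A → ∀ a → occ a t ≡ count (lookup Γ a)
occ-typed (lvar b)     a = count-single a b
occ-typed (uvar u)     a = sym (count-∅ a)
occ-typed (⊗I p x y)   a = trans (cong₂ _+_ (occ-typed x a) (occ-typed y a)) (count-⊎ p a)
occ-typed (⊗E p x y)   a =
  trans (cong₂ _+_ (occ-typed y (2 ↑ʳ a)) (occ-typed x a)) (count-⊎ (⊎-comm p) a)
occ-typed (⅋I x)       a = occ-typed x (2 ↑ʳ a)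
occ-typed (⅋E₁ p x y)  a = trans (cong₂ _+_ (occ-typed x a) (occ-typed y a)) (count-⊎ p a)
occ-typed (⅋E₂ p x y)  a = trans (cong₂ _+_ (occ-typed x a) (occ-typed y a)) (count-⊎ p a)
occ-typed (!I x)       a = occ-typed x (suc a)
occ-typed (!E p x y)   a =
  trans (cong₂ _+_ (occ-typed y a) (occ-typed x a)) (count-⊎ (⊎-comm p) a)
occ-typed (¿I x)       a = occ-typed x a
occ-typed (¿E x y)     a =
  cong₂ _+_ (trans (occ-typed y (suc a)) (count-∅ a)) (occ-typed x a)
occ-typed (cut p x y)  a = trans (cong₂ _+_ (occ-typed x a) (occ-typed y a)) (count-⊎ p a)
occ-typed 𝟏I           a = sym (count-∅ a)
occ-typed (𝟏E p x y)   a =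
  trans (cong₂ _+_ (occ-typed y a) (occ-typed x a)) (count-⊎ (⊎-comm p) a)

boundLinear-typed : Δ ⨾ Γ ⊢ t ∶ A → BoundLinear t
boundLinear-typed (lvar b)     = tt
boundLinear-typed (uvar u)     = tt
boundLinear-typed (⊗I p x y)   = boundLinear-typed x , boundLinear-typed y
boundLinear-typed (⊗E p x y)   =
  occ-typed y zero , occ-typed y (suc zero) , boundLinear-typed y , boundLinear-typed x
boundLinear-typed (⅋I x)       = occ-typed x zero , occ-typed x (suc zero) , boundLinear-typed x
boundLinear-typed (⅋E₁ p x y)  = boundLinear-typed x , boundLinear-typed y
boundLinear-typed (⅋E₂ p x y)  = boundLinear-typed x , boundLinear-typed y
boundLinear-typed (!I x)       =
  occ-typed x zero , (λ a → trans (occ-typed x (suc a)) (count-∅ a)) , boundLinear-typed x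
boundLinear-typed (!E p x y)   = boundLinear-typed y , boundLinear-typed x
boundLinear-typed (¿I x)       = boundLinear-typed x
boundLinear-typed (¿E x y)     =
  occ-typed y zero , (λ a → trans (occ-typed y (suc a)) (count-∅ a)) ,
  boundLinear-typed y , boundLinear-typed x
boundLinear-typed (cut p x y)  = boundLinear-typed x , boundLinear-typed y
boundLinear-typed 𝟏I           = tt
boundLinear-typed (𝟏E p x y)   = boundLinear-typed y , boundLinear-typed x

linear-typed : Δ ⨾ Γ ⊢ t ∶ A → Linear t
linear-typed {Γ = Γ} x =
  (λ a → subst (_≤ 1) (sym (occ-typed x a)) (count≤1 (lookup Γ a))) , boundLinear-typed x
  where
  count≤1 : (c : Maybe Y) → count c ≤ 1
  count≤1 (just _) = s≤s z≤n
  count≤1 nothing  = z≤n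

-- Typing of contra-substitution

⊥-involutive : (A : Formula X) → A ^⊥ ^⊥ ≡ A
⊥-involutive (atom α)  = refl
⊥-involutive (natom α) = refl
⊥-involutive (A ⊗ B)   = cong₂ _⊗_ (⊥-involutive A) (⊥-involutive B)
⊥-involutive (A ⅋ B)   = cong₂ _⅋_ (⊥-involutive A) (⊥-involutive B)
⊥-involutive 𝟏         = refl
⊥-involutive ⊥         = refl
⊥-involutive (! A)     = cong !_ (⊥-involutive A)
⊥-involutive (¿ A)     = cong ¿_ (⊥-involutive A)

⊥⊥⁺ : Δ ⨾ Γ ⊢ t ∶ A → Δ ⨾ Γ ⊢ t ∶ A ^⊥ ^⊥
⊥⊥⁺ {A = A} = subst (_ ⨾ _ ⊢ _ ∶_) (sym (⊥-involutive A))

⊥⊥⁻ : Δ ⨾ Γ ⊢ t ∶ A ^⊥ ^⊥ → Δ ⨾ Γ ⊢ t ∶ A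
⊥⊥⁻ {A = A} = subst (_ ⨾ _ ⊢ _ ∶_) (⊥-involutive A)

lookup-single-⊎ : ∀ (a : Fin n) {A : Y} {Γ Γ′ : LCtx Y n} →
                  single a A ⊎ Γ ≃ Γ′ → lookup Γ′ a ≡ just A
lookup-single-⊎ zero    (left p)  = refl
lookup-single-⊎ (suc a) (none p)  = lookup-single-⊎ a p
lookup-single-⊎ (suc a) (right p) = lookup-single-⊎ a p

∈fv-just : ∀ (a : Fin n) → Δ ⨾ Γ ⊢ t ∶ B → lookup Γ a ≡ just A → a ∈fv t ≡ true
∈fv-just a x e = cong (0 <ᵇ_) (trans (occ-typed x a) (cong count e))

∈fv-nothing : ∀ (a : Fin n) → Δ ⨾ Γ ⊢ t ∶ B → lookup Γ a ≡ nothing → a ∈fv t ≡ false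
∈fv-nothing a x e = cong (0 <ᵇ_) (trans (occ-typed x a) (cong count e))

-- Contra-substitution turns `t` inside out: `s` refutes the conclusion of `t`, and each constructor
-- on the path to `a` is replaced by its dual applied to `s`, until the term that arrives at `a`
-- refutes `A`. Where the subterm has type `⊥`, as under `⅋λ` and `¿λ`, the refutation passed on is
-- `⋆`, of type `𝟏`, and `s` is consumed by an eliminator instead.
contra-typed : ∀ (a : Fin n) → single a A ⊎ Γ⁻ ≃ Γ → Γ⁻ ⊎ Γ₃ ≃ Γ₄ →
               Δ ⨾ Γ ⊢ t ∶ B → Δ ⨾ Γ₃ ⊢ s ∶ B ^⊥ → Δ ⨾ Γ₄ ⊢ contra a t s ∶ A ^⊥
contra-typed a q r (lvar b) y
  with refl , refl ← single-⊎-single a b q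
  with refl ← ∅⊎⇒≡ r = y
contra-typed a q r (uvar u) y = ⊥-elim (single-⊎-∅ a q)
contra-typed a q r (⊗I p x₁ x₂) y with single-split a q p
... | inj₁ (_ , q₁ , q₂)
  rewrite ∈fv-just a x₁ (lookup-single-⊎ a q₁)
  with _ , r₁ , r₂ ← ⊎-assocʳ q₂ r = contra-typed a q₁ r₂ x₁ (⅋E₂ (⊎-comm r₁) y (⊥⊥⁺ x₂))
... | inj₂ (_ , q₁ , q₂ , e)
  rewrite ∈fv-nothing a x₁ e
  with _ , r₁ , r₂ ← ⊎-assocʳ (⊎-comm q₂) r = contra-typed a q₁ r₂ x₂ (⅋E₁ (⊎-comm r₁) y (⊥⊥⁺ x₁))
contra-typed a q r (⊗E p x₂ x₁) y with single-split a q (⊎-comm p)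
... | inj₁ (_ , q₁ , q₂)
  rewrite ∈fv-just (2 ↑ʳ a) x₁ (lookup-single-⊎ a q₁)
  with _ , r₁ , r₂ ← ⊎-assocʳ (⊎-comm q₂) r =
  ⊗E r₂ x₂ (contra-typed (2 ↑ʳ a) (right (right q₁)) (left (left r₁)) x₁ (wkˡˡ-typed y))
... | inj₂ (_ , q₁ , q₂ , e)
  rewrite ∈fv-nothing (2 ↑ʳ a) x₁ e
  with _ , r₁ , r₂ ← ⊎-assocʳ (⊎-comm q₂) r =
  contra-typed a q₁ r₂ x₂ (⅋I (cut (left (left r₁)) x₁ (wkˡˡ-typed y)))
contra-typed a q r (⅋I {A = A} {B} x) y =
  ⊗E (⊎-comm r) (⊥⊥⁻ {A = A ⊗ B} y)
     (contra-typed (2 ↑ʳ a) (right (right q)) ⊎-identityʳ x 𝟏I)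
contra-typed a q r (⅋E₁ p x₁ x₂) y with single-split a q p
... | inj₁ (_ , q₁ , q₂)
  rewrite ∈fv-just a x₁ (lookup-single-⊎ a q₁)
  with _ , r₁ , r₂ ← ⊎-assocʳ q₂ r = contra-typed a q₁ r₂ x₁ (⊗I r₁ x₂ y)
... | inj₂ (_ , q₁ , q₂ , e)
  rewrite ∈fv-nothing a x₁ e
  with _ , r₁ , r₂ ← ⊎-assocʳ (⊎-comm q₂) r = contra-typed a q₁ r₂ x₂ (⊥⊥⁺ (⅋E₂ r₁ x₁ y))
contra-typed a q r (⅋E₂ p x₁ x₂) y with single-split a q p
... | inj₁ (_ , q₁ , q₂)
  rewrite ∈fv-just a x₁ (lookup-single-⊎ a q₁)
  with _ , r₁ , r₂ ← ⊎-assocʳ q₂ r = contra-typed a q₁ r₂ x₁ (⊗I (⊎-comm r₁) y x₂)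
... | inj₂ (_ , q₁ , q₂ , e)
  rewrite ∈fv-nothing a x₁ e
  with _ , r₁ , r₂ ← ⊎-assocʳ (⊎-comm q₂) r = contra-typed a q₁ r₂ x₂ (⊥⊥⁺ (⅋E₁ r₁ x₁ y))
contra-typed a q r (!I x) y = ⊥-elim (single-⊎-∅ a q)
contra-typed a q r (!E {A = A} p x₂ x₁) y with single-split a q (⊎-comm p)
... | inj₁ (_ , q₁ , q₂)
  rewrite ∈fv-just a x₁ (lookup-single-⊎ a q₁)
  with _ , r₁ , r₂ ← ⊎-assocʳ (⊎-comm q₂) r =
  !E r₂ x₂ (contra-typed a q₁ r₁ x₁ (wkᵘ-typed y))
... | inj₂ (_ , q₁ , q₂ , e)
  rewrite ∈fv-nothing a x₁ e
  with _ , r₁ , r₂ ← ⊎-assocʳ (⊎-comm q₂) r =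
  contra-typed a q₁ r₂ x₂
    (¿I (subst (λ C → (C ∷ _) ⨾ _ ⊢ _ ∶ ⊥) (sym (⊥-involutive A)) (cut r₁ x₁ (wkᵘ-typed y))))
contra-typed a q r (¿I x) y = !E (⊎-comm r) y (contra-typed a q ⊎-identityʳ x 𝟏I)
contra-typed a q r (¿E x₂ x₁) y =
  𝟏E (⊎-comm r) y (contra-typed a q ⊎-identityʳ x₂ (!I x₁))
contra-typed a q r (cut p x₁ x₂) y with single-split a q p
... | inj₁ (_ , q₁ , q₂)
  rewrite ∈fv-just a x₁ (lookup-single-⊎ a q₁) = 𝟏E (⊎-comm r) y (contra-typed a q₁ q₂ x₁ x₂)
... | inj₂ (_ , q₁ , q₂ , e)
  rewrite ∈fv-nothing a x₁ e = 𝟏E (⊎-comm r) y (contra-typed a q₁ (⊎-comm q₂) x₂ (⊥⊥⁺ x₁))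
contra-typed a q r 𝟏I y = ⊥-elim (single-⊎-∅ a q)
contra-typed a q r (𝟏E p x₂ x₁) y with single-split a q (⊎-comm p)
... | inj₁ (_ , q₁ , q₂)
  rewrite ∈fv-just a x₁ (lookup-single-⊎ a q₁)
  with _ , r₁ , r₂ ← ⊎-assocʳ (⊎-comm q₂) r = 𝟏E r₂ x₂ (contra-typed a q₁ r₁ x₁ y)
... | inj₂ (_ , q₁ , q₂ , e)
  rewrite ∈fv-nothing a x₁ e
  with _ , r₁ , r₂ ← ⊎-assocʳ (⊎-comm q₂) r = contra-typed a q₁ r₂ x₂ (cut r₁ x₁ y)

contra⋆-typed : Δ ⨾ (just A ∷ Γ) ⊢ t ∶ ⊥ → Δ ⨾ Γ ⊢ contra⋆ t ∶ A ^⊥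
contra⋆-typed {Δ = Δ} {Γ = Γ} x =
  sub-typed {τ = insertAt lvar zero ⋆} uvar
    (Env-map id refl id (Sing id) (Typed Δ lvar) (λ { i refl → lvar i }) Γ (Sing-id Γ))
    (contra-typed zero (left ⊎-identityˡ) ⊎-identityʳ x 𝟏I)

-- Typed equality and the operator mu

infix 4 _⨾_⊢_∼_∶_

-- The reflexive case of `≐` carries no typing, whereas the congruences of binary constructors need
-- the side that stays fixed to be typed. Bundling both typings also makes every equation proved
-- below a typing result.
record _⨾_⊢_∼_∶_ {X : Set} {m n : ℕ} (Δ : Vec (Formula X) m) (Γ : LCtx (Formula X) n)
                 (t s : Term m n) (A : Formula X) : Set where
  constructor ⟪_,_,_⟫∼
  field
    typedˡ : Δ ⨾ Γ ⊢ t ∶ A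
    typedʳ : Δ ⨾ Γ ⊢ s ∶ A
    equal  : Δ ⨾ Γ ⊢ t ≐ s ∶ A

open _⨾_⊢_∼_∶_

∼-refl : Δ ⨾ Γ ⊢ t ∶ A → Δ ⨾ Γ ⊢ t ∼ t ∶ A
∼-refl x = ⟪ x , x , EqC.reflexive _ ⟫∼

∼-sym : Δ ⨾ Γ ⊢ t ∼ s ∶ A → Δ ⨾ Γ ⊢ s ∼ t ∶ A
∼-sym ⟪ x , y , e ⟫∼ = ⟪ y , x , EqC.symmetric _ e ⟫∼

∼-trans : Δ ⨾ Γ ⊢ t ∼ s ∶ A → Δ ⨾ Γ ⊢ s ∼ r ∶ A → Δ ⨾ Γ ⊢ t ∼ r ∶ A
∼-trans ⟪ x , _ , e ⟫∼ ⟪ _ , y , f ⟫∼ = ⟪ x , y , EqC.transitive _ e f ⟫∼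

∼-reflexive : t ≡ s → Δ ⨾ Γ ⊢ s ∶ A → Δ ⨾ Γ ⊢ t ∼ s ∶ A
∼-reflexive refl = ∼-refl

∼-resp-≡ : t ≡ t′ → s ≡ s′ → Δ ⨾ Γ ⊢ t′ ∼ s′ ∶ A → Δ ⨾ Γ ⊢ t ∼ s ∶ A
∼-resp-≡ refl refl x = x

∼-⊥⊥⁻ : Δ ⨾ Γ ⊢ t ∼ s ∶ A ^⊥ ^⊥ → Δ ⨾ Γ ⊢ t ∼ s ∶ A
∼-⊥⊥⁻ {A = A} = subst (_ ⨾ _ ⊢ _ ∼ _ ∶_) (⊥-involutive A)

∼-⊥⊥⁺ : Δ ⨾ Γ ⊢ t ∼ s ∶ A → Δ ⨾ Γ ⊢ t ∼ s ∶ A ^⊥ ^⊥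
∼-⊥⊥⁺ {A = A} = subst (_ ⨾ _ ⊢ _ ∼ _ ∶_) (sym (⊥-involutive A))

∼-↦ : t ↦ s → Δ ⨾ Γ ⊢ t ∶ A → Δ ⨾ Γ ⊢ s ∶ A → Δ ⨾ Γ ⊢ t ∼ s ∶ A
∼-↦ h x y =
  ⟪ x , y , EqC.return (inj₁ (_ , _ , EqC.reflexive _ , axiom h x y , EqC.reflexive _)) ⟫∼

∼-≈ : t ≈ s → Δ ⨾ Γ ⊢ t ∶ A → Δ ⨾ Γ ⊢ s ∶ A → Δ ⨾ Γ ⊢ t ∼ s ∶ A
∼-≈ h x y = ⟪ x , y , EqC.return (inj₂ (EqC.return (axiom h x y))) ⟫∼

∼-plug : {Δ : Vec (Formula X) m} {Δ′ : Vec (Formula X) (i + m)}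
         {Γ : LCtx (Formula X) n} {Γ′ : LCtx (Formula X) (j + n)}
         (K : Context m n i j) → (∀ {r} → Δ′ ⨾ Γ′ ⊢ r ∶ A → Δ ⨾ Γ ⊢ plug K r ∶ B) →
         ∀ {t s} → Δ′ ⨾ Γ′ ⊢ t ∼ s ∶ A → Δ ⨾ Γ ⊢ plug K t ∼ plug K s ∶ B
∼-plug {Δ = Δ} {Δ′} {Γ} {Γ′} K h ⟪ x , y , e ⟫∼ = ⟪ h x , h y , EqC.gmap (plug K) step e ⟫∼
  where
  ≋-plug : ∀ {t s} → Δ′ ⨾ Γ′ ⊢ t ≋ s ∶ _ → Δ ⨾ Γ ⊢ plug K t ≋ plug K s ∶ _
  ≋-plug = EqC.gmap (plug K) (context K h)

  step : ∀ {t s} → (Δ′ ⨾ Γ′ ⊢ t ⟶ s ∶ _) ⊎ (Δ′ ⨾ Γ′ ⊢ t ≋ s ∶ _) →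
         (Δ ⨾ Γ ⊢ plug K t ⟶ plug K s ∶ _) ⊎ (Δ ⨾ Γ ⊢ plug K t ≋ plug K s ∶ _)
  step (inj₁ (_ , _ , p , q , r)) = inj₁ (_ , _ , ≋-plug p , context K h q , ≋-plug r)
  step (inj₂ p)                   = inj₂ (≋-plug p)

⅋λ-∼ : Δ ⨾ (just A ∷ just B ∷ Γ) ⊢ t ∼ t′ ∶ ⊥ → Δ ⨾ Γ ⊢ ⅋λ t ∼ ⅋λ t′ ∶ (A ^⊥) ⅋ (B ^⊥)
⅋λ-∼ = ∼-plug (surface ⅋λ□) ⅋I

!λ-∼ : Δ ⨾ (just A ∷ ∅) ⊢ t ∼ t′ ∶ ⊥ → Δ ⨾ ∅ ⊢ !λ t ∼ !λ t′ ∶ ! (A ^⊥)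
!λ-∼ = ∼-plug !λ□ !I

•-∼ : Γ₁ ⊎ Γ₂ ≃ Γ → Δ ⨾ Γ₁ ⊢ t ∼ t′ ∶ A ⅋ B → Δ ⨾ Γ₂ ⊢ s ∼ s′ ∶ A ^⊥ →
      Δ ⨾ Γ ⊢ t • s ∼ t′ • s′ ∶ B
•-∼ p x y = ∼-trans (∼-plug (surface (□• _)) (λ z → ⅋E₁ p z (typedˡ y)) x)
                    (∼-plug (surface (_ •□)) (λ z → ⅋E₁ p (typedʳ x) z) y)

▼-∼ : Γ₁ ⊎ Γ₂ ≃ Γ → Δ ⨾ Γ₁ ⊢ t ∼ t′ ∶ A ⅋ B → Δ ⨾ Γ₂ ⊢ s ∼ s′ ∶ B ^⊥ →
      Δ ⨾ Γ ⊢ t ▼ s ∼ t′ ▼ s′ ∶ A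
▼-∼ p x y = ∼-trans (∼-plug (surface (□▼ _)) (λ z → ⅋E₂ p z (typedˡ y)) x)
                    (∼-plug (surface (_ ▼□)) (λ z → ⅋E₂ p (typedʳ x) z) y)

♯-∼ : Γ₁ ⊎ Γ₂ ≃ Γ → Δ ⨾ Γ₁ ⊢ t ∼ t′ ∶ B → Δ ⨾ Γ₂ ⊢ s ∼ s′ ∶ B ^⊥ →
      Δ ⨾ Γ ⊢ t ♯ s ∼ t′ ♯ s′ ∶ ⊥
♯-∼ p x y = ∼-trans (∼-plug (surface (□♯ _)) (λ z → cut p z (typedˡ y)) x)
                    (∼-plug (surface (_ ♯□)) (λ z → cut p (typedʳ x) z) y)

bang-∼ : Γ₁ ⊎ Γ₂ ≃ Γ → Δ ⨾ Γ₁ ⊢ s ∼ s′ ∶ ! A → (A ∷ Δ) ⨾ Γ₂ ⊢ t ∼ t′ ∶ B →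
         Δ ⨾ Γ ⊢ t [ bang ≔ s ] ∼ t′ [ bang ≔ s′ ] ∶ B
bang-∼ p x y = ∼-trans (∼-plug (surface □[ bang ≔ _ ]) (λ z → !E p (typedˡ x) z) y)
                       (∼-plug (surface (elim□ bang _)) (λ z → !E p z (typedʳ y)) x)

star-∼ : Γ₁ ⊎ Γ₂ ≃ Γ → Δ ⨾ Γ₁ ⊢ s ∼ s′ ∶ 𝟏 → Δ ⨾ Γ₂ ⊢ t ∼ t′ ∶ A →
         Δ ⨾ Γ ⊢ t [ star ≔ s ] ∼ t′ [ star ≔ s′ ] ∶ A
star-∼ p x y = ∼-trans (∼-plug (surface □[ star ≔ _ ]) (λ z → 𝟏E p (typedˡ x) z) y)
                       (∼-plug (surface (elim□ star _)) (λ z → 𝟏E p z (typedʳ y)) x)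

star-star-∼ : Δ ⨾ Γ ⊢ t ∶ A → Δ ⨾ Γ ⊢ t [ star ≔ ⋆ ] ∼ t ∶ A
star-star-∼ x = ∼-≈ star-star (𝟏E ⊎-identityˡ 𝟏I x) x

-- The binders `!λ` and `▶` admit no other linear variables in their bodies, so `a` has to be
-- abstracted by `⅋λ`, which binds a second variable. Linearity requires that one to be used: it
-- gets type `𝟏` and is consumed by the unit eliminator, and `▼ ⋆` supplies its value. The renaming
-- `lift 1 suc` keeps `a` at index 0 and makes room at index 1.
mu : Term m (suc n) → Term m n
mu t = (⅋λ (ren id (lift 1 suc) t [ star ≔ lvar (suc zero) ])) ▼ ⋆

-- The hypothesis concerns the renamed bodies because an equation between `t` and `t′` cannot be
-- transported along the renaming. For translations, the renaming is absorbed by the environment.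
mu-∼ : Δ ⨾ (just A ∷ nothing ∷ Γ) ⊢ ren id (lift 1 suc) t ∼ ren id (lift 1 suc) t′ ∶ ⊥ →
       Δ ⨾ Γ ⊢ mu t ∼ mu t′ ∶ A ^⊥
mu-∼ x = ▼-∼ ⊎-identityʳ
  (⅋λ-∼ (star-∼ (right (left ⊎-identityˡ)) (∼-refl (lvar (suc zero))) x)) (∼-refl 𝟏I)

mu-typed : Δ ⨾ (just A ∷ Γ) ⊢ t ∶ ⊥ → Δ ⨾ Γ ⊢ mu t ∶ A ^⊥
mu-typed {Γ = Γ} x = typedˡ (mu-∼ (∼-refl
  (ren-typed (λ _ → refl) (Sing-lift 0 suc Γ (Sing-↑ʳ 1 Γ)) x)))

-- The occurrence in `t` selects the clause of `contra` that leaves the eliminator outside; what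
-- remains is the `wk 0 0` inserted by `sub`.
contra⋆-star : ∀ (t : Term m (suc n)) → zero ∈fv t ≡ true →
               contra⋆ (t [ star ≔ ⋆ ]) ≡ contra⋆ t [ star ≔ ⋆ ]
contra⋆-star t e rewrite e = cong (λ r → r [ star ≔ ⋆ ])
  (sub-cong (λ u → ren-id (λ _ → refl) (λ _ → refl) _)
            (λ a → ren-id (λ _ → refl) (λ _ → refl) _) (contra zero t ⋆))

mu-contractum : (t : Term m (suc n)) →
  (ren id (lift 1 suc) t [ star ≔ lvar (suc zero) ]) ⟪ suc zero ≔ ⋆ ⟫ ≡ t [ star ≔ ⋆ ]
mu-contractum t = cong (λ r → r [ star ≔ ⋆ ]) (trans
  (sub-ren (λ _ → refl) (λ { zero → refl ; (suc a) → refl }) t) (sub-id (λ _ → refl) (λ _ → refl) t))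

contra⋆-∼-mu : Δ ⨾ (just A ∷ Γ) ⊢ t ∶ ⊥ → Δ ⨾ Γ ⊢ contra⋆ t ∼ mu t ∶ A ^⊥
contra⋆-∼-mu {t = t} x = ∼-sym (∼-trans
  (∼-↦ (subst (λ r → mu t ↦ r) contractum (⅋▼ □)) (mu-typed x) (𝟏E ⊎-identityˡ 𝟏I (contra⋆-typed x)))
  (star-star-∼ (contra⋆-typed x)))
  where
  contractum = trans (cong contra⋆ (mu-contractum t)) (contra⋆-star t (∈fv-just zero x refl))

sub-star : ∀ s (t : Term m n) → (wk 0 1 t [ star ≔ ⋆ ]) ⟪ zero ≔ s ⟫ ≡ t [ star ≔ ⋆ ]
sub-star s t = cong (λ r → r [ star ≔ ⋆ ]) (trans
  (sub-cong (λ u → ren-id (λ _ → refl) (λ _ → refl) _)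
            (λ a → ren-id (λ _ → refl) (λ _ → refl) _) (wk 0 1 t))
  (wk-sub s t))

-- By `occ-typed` the new variable is absent from the weakened term, so `contra` enters the right
-- side of `♯`, finds the variable there and returns the left side. The eliminator left behind is
-- the source of the stars in the simulation of both β-rules.
contra⋆-♯ʳ : Δ ⨾ Γ ⊢ t ∶ A → contra⋆ (wk 0 1 t ♯ lvar zero) ≡ t [ star ≔ ⋆ ]
contra⋆-♯ʳ {t = t} x rewrite occ-typed (wkˡ-typed x) zero = sub-star ⋆ t

contra⋆-♯ˡ : ∀ (t : Term m n) → contra⋆ (lvar zero ♯ wk 0 1 t) ≡ t [ star ≔ ⋆ ]
contra⋆-♯ˡ t = sub-star ⋆ t

♯-lvar-typed : Δ ⨾ Γ ⊢ t ∶ A → Δ ⨾ (just (A ^⊥) ∷ Γ) ⊢ wk 0 1 t ♯ lvar zero ∶ ⊥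
♯-lvar-typed x = cut (right ⊎-identityʳ) (wkˡ-typed x) (lvar zero)

≡-star-∼ : t ≡ s [ star ≔ ⋆ ] → Δ ⨾ Γ ⊢ s ∶ A → Δ ⨾ Γ ⊢ t ∼ s ∶ A
≡-star-∼ refl = star-star-∼

mu-η : Δ ⨾ Γ ⊢ t ∶ A → Δ ⨾ Γ ⊢ mu (wk 0 1 t ♯ lvar zero) ∼ t ∶ A
mu-η x = ∼-trans (∼-⊥⊥⁻ (∼-sym (contra⋆-∼-mu (♯-lvar-typed x)))) (≡-star-∼ (contra⋆-♯ʳ x) x)

contra⋆-♯ : Γ₁ ⊎ Γ₂ ≃ Γ → Δ ⨾ (just A ∷ Γ₁) ⊢ t ∶ ⊥ → Δ ⨾ Γ₂ ⊢ r ∶ A →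
            t ⟪ zero ≔ r ⟫ ≡ s → Δ ⨾ Γ ⊢ s ∶ ⊥ → Δ ⨾ Γ ⊢ contra⋆ t ♯ r ∼ s ∶ ⊥
contra⋆-♯ {t = t} p x y refl z =
  ∼-≈ (contra-cut {t = t} (linear-typed x) (occ-typed x zero))
      (cut p (contra⋆-typed x) (⊥⊥⁺ y)) z

mu-♯ : Γ₁ ⊎ Γ₂ ≃ Γ → Δ ⨾ (just A ∷ Γ₁) ⊢ t ∶ ⊥ → Δ ⨾ Γ₂ ⊢ r ∶ A →
       t ⟪ zero ≔ r ⟫ ≡ s → Δ ⨾ Γ ⊢ s ∶ ⊥ → Δ ⨾ Γ ⊢ mu t ♯ r ∼ s ∶ ⊥
mu-♯ p x y e z =
  ∼-trans (♯-∼ p (∼-sym (contra⋆-∼-mu x)) (∼-refl (⊥⊥⁺ y))) (contra⋆-♯ p x y e z)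

-- Apply `contra-cut` to `a ♯ s`: its contra-substitution is `s` up to a trivial eliminator, while
-- putting `t` for `a` gives `t ♯ s`.
♯-comm : Γ₁ ⊎ Γ₂ ≃ Γ → Δ ⨾ Γ₁ ⊢ t ∶ B → Δ ⨾ Γ₂ ⊢ s ∶ B ^⊥ → Δ ⨾ Γ ⊢ t ♯ s ∼ s ♯ t ∶ ⊥
♯-comm {t = t} {s = s} p x y = ∼-sym (∼-trans
  (♯-∼ (⊎-comm p) (∼-sym (≡-star-∼ (contra⋆-♯ˡ s) y)) (∼-refl (⊥⊥⁺ x)))
  (contra⋆-♯ (⊎-comm p) (cut (left ⊎-identityˡ) (lvar zero) (wkˡ-typed y)) x
    (cong (t ♯_) (wk-sub t s)) (cut p x y)))

-- Apply `contra-cut` to `(t • a) ♯ s`: contra-substitution passes `s` through the cut and then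
-- through the application, which gives `t ▼ s`, while putting `r` for `a` gives the left-hand side.
-- `♯-comm` restores the order.
•-♯ : Γ₁ ⊎ Γ₂ ≃ Γ₁₂ → Γ₁₂ ⊎ Γ₃ ≃ Γ →
      Δ ⨾ Γ₁ ⊢ t ∶ A ⅋ B → Δ ⨾ Γ₂ ⊢ r ∶ A ^⊥ → Δ ⨾ Γ₃ ⊢ s ∶ B ^⊥ →
      Δ ⨾ Γ ⊢ (t • r) ♯ s ∼ r ♯ (t ▼ s) ∶ ⊥
•-♯ {t = t} {r = r} {s = s} p q x y z
  with _ , q₁ , q₂ ← ⊎-assocʳ (⊎-comm p) q = ∼-trans
  (∼-sym (contra⋆-♯ (⊎-comm q₂)
    (cut (left q₁) (⅋E₁ (right ⊎-identityʳ) (wkˡ-typed x) (lvar zero)) (wkˡ-typed z)) y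
    (cong₂ (λ u v → (u • r) ♯ v) (wk-sub r t) (wk-sub r s)) (cut q (⅋E₁ p x y) z)))
 (∼-trans
  (♯-∼ (⊎-comm q₂) (≡-star-∼ contra⋆-•-♯ (⅋E₂ q₁ x z)) (∼-refl y))
  (♯-comm (⊎-comm q₂) (⅋E₂ q₁ x z) y))
  where
  contra⋆-•-♯ : contra⋆ ((wk 0 1 t • lvar zero) ♯ wk 0 1 s) ≡ (t ▼ s) [ star ≔ ⋆ ]
  contra⋆-•-♯ rewrite occ-typed (wkˡ-typed x) zero = sub-star ⋆ (t ▼ s)

-- The translation with terms for the free variables

infixr 5 _▹_

_▹_ : Y → (Fin n → Y) → Fin (suc n) → Y
x ▹ f = insertAt f zero x

▹-ext : {f g : Fin (suc n) → Y} → f zero ≡ g zero → (∀ i → f (suc i) ≡ g (suc i)) →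
        ∀ i → f i ≡ g i
▹-ext p q zero    = p
▹-ext p q (suc i) = q i

MuOp : Set
MuOp = ∀ {m n} → Term m (suc n) → Term m n

-- The translation with terms υ, ξ, κ for the free variables and op for μ;
-- with contra⋆ for op and variables for υ, ξ, κ it is translate.
Tr : MuOp → (Fin m → Term m′ l) → (Fin n → Term m′ l) → (Fin k → Term m′ l) →
     μTerm m n k → Term m′ l
Tr op υ ξ κ (lin x)   = ξ x
Tr op υ ξ κ (unr u)   = υ u
Tr op υ ξ κ (Λ M)     =
  ⅋λ (Tr op (uvar zero ▹ wk 1 2 ∘ υ) (wk 1 2 ∘ ξ) (wk 1 2 ∘ κ) M [ bang ≔ lvar zero ] ♯ lvar (suc zero))
Tr op υ ξ κ (M ＠ N)  = Tr op υ ξ κ M • (!λ (wk 0 1 (Tr op υ ξ κ N) ♯ lvar zero))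
Tr op υ ξ κ (ƛ M)     =
  ⅋λ (Tr op (wk 0 2 ∘ υ) (lvar zero ▹ wk 0 2 ∘ ξ) (wk 0 2 ∘ κ) M ♯ lvar (suc zero))
Tr op υ ξ κ (M • N)   = Tr op υ ξ κ M • Tr op υ ξ κ N
Tr op υ ξ κ ([ γ ] M) = Tr op υ ξ κ M ♯ κ γ
Tr op υ ξ κ (μ M)     = op (Tr op (wk 0 1 ∘ υ) (wk 0 1 ∘ ξ) (lvar zero ▹ wk 0 1 ∘ κ) M)

translate≡Tr : {ρ : Fin n → Fin l} {θ : Fin k → Fin l}
  {υ : Fin m → Term m l} {ξ : Fin n → Term m l} {κ : Fin k → Term m l} →
  (∀ u → uvar u ≡ υ u) → (∀ x → lvar (ρ x) ≡ ξ x) → (∀ γ → lvar (θ γ) ≡ κ γ) →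
  ∀ M → translate ρ θ M ≡ Tr contra⋆ υ ξ κ M
translate≡Tr p q c (lin x)   = q x
translate≡Tr p q c (unr u)   = p u
translate≡Tr p q c (Λ M)     =
  cong (λ r → ⅋λ (r [ bang ≔ lvar zero ] ♯ lvar (suc zero)))
    (translate≡Tr (▹-ext refl (cong (wk 1 2) ∘ p)) (cong (wk 1 2) ∘ q) (cong (wk 1 2) ∘ c) M)
translate≡Tr p q c (M ＠ N)  =
  cong₂ (λ r s → r • (!λ (wk 0 1 s ♯ lvar zero))) (translate≡Tr p q c M) (translate≡Tr p q c N)
translate≡Tr p q c (ƛ M)     =
  cong (λ r → ⅋λ (r ♯ lvar (suc zero)))
    (translate≡Tr (cong (wk 0 2) ∘ p) (▹-ext refl (cong (wk 0 2) ∘ q)) (cong (wk 0 2) ∘ c) M)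
translate≡Tr p q c (M • N)   = cong₂ _•_ (translate≡Tr p q c M) (translate≡Tr p q c N)
translate≡Tr p q c ([ γ ] M) = cong₂ _♯_ (translate≡Tr p q c M) (c γ)
translate≡Tr p q c (μ M)     =
  cong contra⋆
    (translate≡Tr (cong (wk 0 1) ∘ p) (cong (wk 0 1) ∘ q) (▹-ext refl (cong (wk 0 1) ∘ c)) M)

-- Injectivity is there for `contra⋆`; the renamings met by the translation are weakenings and their
-- lifts, all injective.
CommutesWithRen : MuOp → Set
CommutesWithRen op =
  ∀ {m m′ n n′} {ρ : Fin m → Fin m′} {θ : Fin n → Fin n′} → Inj θ →
  ∀ t → ren ρ θ (op t) ≡ op (ren ρ (lift 1 θ) t)

mu-ren : CommutesWithRen mu
mu-ren {ρ = ρ} {θ} _ t = cong (λ r → (⅋λ (r [ star ≔ lvar (suc zero) ])) ▼ ⋆)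
  (trans (ren-ren {ρ″ = ρ} {σ″ = lift 2 θ ∘ lift 1 suc} (λ _ → refl) (λ _ → refl) t)
    (sym (ren-ren (λ _ → refl) (λ { zero → refl ; (suc a) → refl }) t)))

mu-sub : ∀ (σ : Fin m → Term m′ n′) (τ : Fin n → Term m′ n′) t →
         sub σ τ (mu t) ≡ mu (sub (liftᵘ 0 1 σ) (liftˡ 0 1 τ) t)
mu-sub σ τ t = cong (λ r → (⅋λ (r [ star ≔ lvar (suc zero) ])) ▼ ⋆)
  (trans (sub-ren {σ′ = wk 0 2 ∘ σ} {τ′ = lvar zero ▹ wk 0 2 ∘ τ}
           (λ u → ren-id (λ _ → refl) (λ _ → refl) _)
           (▹-ext refl (λ a → ren-id (λ _ → refl) (λ _ → refl) _)) t)
    (sym (ren-sub (λ u → ren-ren (λ _ → refl) (λ _ → refl) (σ u))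
           (▹-ext refl (λ a → ren-ren (λ _ → refl) (λ _ → refl) (τ a))) t)))

module _ {op : MuOp} (op-ren : CommutesWithRen op) where

  ren-Tr : {ρ : Fin m′ → Fin m″} {θ : Fin l → Fin l′} → Inj θ →
    {υ : Fin m → Term m′ l} {ξ : Fin n → Term m′ l} {κ : Fin k → Term m′ l}
    {υ′ : Fin m → Term m″ l′} {ξ′ : Fin n → Term m″ l′} {κ′ : Fin k → Term m″ l′} →
    (∀ u → ren ρ θ (υ u) ≡ υ′ u) → (∀ x → ren ρ θ (ξ x) ≡ ξ′ x) → (∀ γ → ren ρ θ (κ γ) ≡ κ′ γ) →
    ∀ M → ren ρ θ (Tr op υ ξ κ M) ≡ Tr op υ′ ξ′ κ′ M
  ren-Tr inj p q c (lin x) = q x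
  ren-Tr inj p q c (unr u) = p u
  ren-Tr {ρ = ρ} {θ} inj p q c (Λ M) =
    cong (λ r → ⅋λ (r [ bang ≔ lvar zero ] ♯ lvar (suc zero)))
      (ren-Tr (lift-injective θ inj 2)
        (▹-ext refl (λ u → trans (ren-wk 1 2 ρ θ _) (cong (wk 1 2) (p u))))
        (λ x → trans (ren-wk 1 2 ρ θ _) (cong (wk 1 2) (q x)))
        (λ γ → trans (ren-wk 1 2 ρ θ _) (cong (wk 1 2) (c γ))) M)
  ren-Tr {ρ = ρ} {θ} inj p q c (M ＠ N) =
    cong₂ (λ r s → r • (!λ (s ♯ lvar zero))) (ren-Tr inj p q c M)
      (trans (ren-wk 0 1 ρ θ _) (cong (wk 0 1) (ren-Tr inj p q c N)))
  ren-Tr {ρ = ρ} {θ} inj p q c (ƛ M) =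
    cong (λ r → ⅋λ (r ♯ lvar (suc zero)))
      (ren-Tr (lift-injective θ inj 2)
        (λ u → trans (ren-wk 0 2 ρ θ _) (cong (wk 0 2) (p u)))
        (▹-ext refl (λ x → trans (ren-wk 0 2 ρ θ _) (cong (wk 0 2) (q x))))
        (λ γ → trans (ren-wk 0 2 ρ θ _) (cong (wk 0 2) (c γ))) M)
  ren-Tr inj p q c (M • N)   = cong₂ _•_ (ren-Tr inj p q c M) (ren-Tr inj p q c N)
  ren-Tr inj p q c ([ γ ] M) = cong₂ _♯_ (ren-Tr inj p q c M) (c γ)
  ren-Tr {ρ = ρ} {θ} inj p q c (μ M) =
    trans (op-ren inj _) (cong op
      (ren-Tr (lift-injective θ inj 1)
        (λ u → trans (ren-wk 0 1 ρ θ _) (cong (wk 0 1) (p u)))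
        (λ x → trans (ren-wk 0 1 ρ θ _) (cong (wk 0 1) (q x)))
        (▹-ext refl (λ γ → trans (ren-wk 0 1 ρ θ _) (cong (wk 0 1) (c γ)))) M))

wk-Tr : {op : MuOp} → CommutesWithRen op → ∀ i j
        (υ : Fin m → Term m′ l) (ξ : Fin n → Term m′ l) (κ : Fin k → Term m′ l) M →
        wk i j (Tr op υ ξ κ M) ≡ Tr op (wk i j ∘ υ) (wk i j ∘ ξ) (wk i j ∘ κ) M
wk-Tr op-ren i j υ ξ κ =
  ren-Tr op-ren (↑ʳ-injective j _ _) (λ _ → refl) (λ _ → refl) (λ _ → refl)

Tr-μren : (op : MuOp) {ρ : Fin m → Fin m″} {σ : Fin n → Fin n″} {θ : Fin k → Fin k″}
  {υ : Fin m″ → Term m′ l} {ξ : Fin n″ → Term m′ l} {κ : Fin k″ → Term m′ l}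
  {υ′ : Fin m → Term m′ l} {ξ′ : Fin n → Term m′ l} {κ′ : Fin k → Term m′ l} →
  (∀ u → υ (ρ u) ≡ υ′ u) → (∀ x → ξ (σ x) ≡ ξ′ x) → (∀ γ → κ (θ γ) ≡ κ′ γ) →
  ∀ M → Tr op υ ξ κ (μren ρ σ θ M) ≡ Tr op υ′ ξ′ κ′ M
Tr-μren op p q c (lin x)   = q x
Tr-μren op p q c (unr u)   = p u
Tr-μren op p q c (Λ M)     =
  cong (λ r → ⅋λ (r [ bang ≔ lvar zero ] ♯ lvar (suc zero)))
    (Tr-μren op (▹-ext refl (cong (wk 1 2) ∘ p)) (cong (wk 1 2) ∘ q) (cong (wk 1 2) ∘ c) M)
Tr-μren op p q c (M ＠ N)  =
  cong₂ (λ r s → r • (!λ (wk 0 1 s ♯ lvar zero))) (Tr-μren op p q c M) (Tr-μren op p q c N)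
Tr-μren op p q c (ƛ M)     =
  cong (λ r → ⅋λ (r ♯ lvar (suc zero)))
    (Tr-μren op (cong (wk 0 2) ∘ p) (▹-ext refl (cong (wk 0 2) ∘ q)) (cong (wk 0 2) ∘ c) M)
Tr-μren op p q c (M • N)   = cong₂ _•_ (Tr-μren op p q c M) (Tr-μren op p q c N)
Tr-μren op p q c ([ γ ] M) = cong₂ _♯_ (Tr-μren op p q c M) (c γ)
Tr-μren op p q c (μ M)     =
  cong op
    (Tr-μren op (cong (wk 0 1) ∘ p) (cong (wk 0 1) ∘ q) (▹-ext refl (cong (wk 0 1) ∘ c)) M)

module _ (υ : Fin m → Term m′ l) (ξ : Fin n → Term m′ l) (κ : Fin k → Term m′ l) where

  -- The weakened term does not mention the new variable, so the entry `t` is discarded. The amounts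
  -- `i` and `j` are free because `Λ`, `ƛ`, `μ` and the body of `mu` weaken by different numbers of
  -- variables.
  Tr-wkᵘ : ∀ i j t N →
    Tr mu (t ▹ wk i j ∘ υ) (wk i j ∘ ξ) (wk i j ∘ κ) (wkᵘ N) ≡ wk i j (Tr mu υ ξ κ N)
  Tr-wkᵘ i j t N = trans (Tr-μren mu (λ _ → refl) (λ _ → refl) (λ _ → refl) N)
                         (sym (wk-Tr mu-ren i j υ ξ κ N))

  Tr-wkˡ : ∀ i j t N →
    Tr mu (wk i j ∘ υ) (t ▹ wk i j ∘ ξ) (wk i j ∘ κ) (wkˡ N) ≡ wk i j (Tr mu υ ξ κ N)
  Tr-wkˡ i j t N = trans (Tr-μren mu (λ _ → refl) (λ _ → refl) (λ _ → refl) N)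
                         (sym (wk-Tr mu-ren i j υ ξ κ N))

  Tr-wkᶜ : ∀ i j t N →
    Tr mu (wk i j ∘ υ) (wk i j ∘ ξ) (t ▹ wk i j ∘ κ) (wkᶜ N) ≡ wk i j (Tr mu υ ξ κ N)
  Tr-wkᶜ i j t N = trans (Tr-μren mu (λ _ → refl) (λ _ → refl) (λ _ → refl) N)
                         (sym (wk-Tr mu-ren i j υ ξ κ N))

-- Substitution in the source becomes a change of environment. As `sub-Tr` does the same for
-- substitution in the target, the β-rules come down to comparing environments.
Tr-μsub : {σ : Fin m → μTerm m″ n″ k} {τ : Fin n → μTerm m″ n″ k}
  {υ : Fin m″ → Term m′ l} {ξ : Fin n″ → Term m′ l} {κ : Fin k → Term m′ l}
  {υ′ : Fin m → Term m′ l} {ξ′ : Fin n → Term m′ l} →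
  (∀ u → Tr mu υ ξ κ (σ u) ≡ υ′ u) → (∀ x → Tr mu υ ξ κ (τ x) ≡ ξ′ x) →
  ∀ M → Tr mu υ ξ κ (μsub σ τ M) ≡ Tr mu υ′ ξ′ κ M
Tr-μsub p q (lin x) = q x
Tr-μsub p q (unr u) = p u
Tr-μsub {σ = σ} {τ} {υ} {ξ} {κ} p q (Λ M) =
  cong (λ r → ⅋λ (r [ bang ≔ lvar zero ] ♯ lvar (suc zero)))
    (Tr-μsub (▹-ext refl (λ u → trans (Tr-wkᵘ υ ξ κ 1 2 (uvar zero) (σ u)) (cong (wk 1 2) (p u))))
             (λ x → trans (Tr-wkᵘ υ ξ κ 1 2 (uvar zero) (τ x)) (cong (wk 1 2) (q x))) M)
Tr-μsub p q (M ＠ N) =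
  cong₂ (λ r s → r • (!λ (wk 0 1 s ♯ lvar zero))) (Tr-μsub p q M) (Tr-μsub p q N)
Tr-μsub {σ = σ} {τ} {υ} {ξ} {κ} p q (ƛ M) =
  cong (λ r → ⅋λ (r ♯ lvar (suc zero)))
    (Tr-μsub (λ u → trans (Tr-wkˡ υ ξ κ 0 2 (lvar zero) (σ u)) (cong (wk 0 2) (p u)))
             (▹-ext refl (λ x → trans (Tr-wkˡ υ ξ κ 0 2 (lvar zero) (τ x)) (cong (wk 0 2) (q x)))) M)
Tr-μsub p q (M • N)   = cong₂ _•_ (Tr-μsub p q M) (Tr-μsub p q N)
Tr-μsub p q ([ γ ] M) = cong (_♯ _) (Tr-μsub p q M)
Tr-μsub {σ = σ} {τ} {υ} {ξ} {κ} p q (μ M) =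
  cong mu
    (Tr-μsub (λ u → trans (Tr-wkᶜ υ ξ κ 0 1 (lvar zero) (σ u)) (cong (wk 0 1) (p u)))
             (λ x → trans (Tr-wkᶜ υ ξ κ 0 1 (lvar zero) (τ x)) (cong (wk 0 1) (q x))) M)

-- Below `Λ` a substitution is lifted twice, past `⅋λ` and past the eliminator that binds `u`,
-- whereas `Tr` weakens in a single step.
sub-wk₁₂ : (σ : Fin m → Term m′ n′) (τ : Fin n → Term m′ n′) → ∀ {r} t → sub σ τ t ≡ r →
           sub (liftᵘ 1 0 (liftᵘ 0 2 σ)) (liftˡ 1 0 (liftˡ 0 2 τ)) (wk 1 2 t) ≡ wk 1 2 r
sub-wk₁₂ σ τ t refl =
  trans (sub-ren (λ u → ren-ren (λ _ → refl) (λ _ → refl) (σ u))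
                 (λ a → ren-ren (λ _ → refl) (λ _ → refl) (τ a)) t)
        (sym (ren-sub (λ _ → refl) (λ _ → refl) t))

sub-Tr : {σ : Fin m′ → Term m″ l′} {τ : Fin l → Term m″ l′}
  {υ : Fin m → Term m′ l} {ξ : Fin n → Term m′ l} {κ : Fin k → Term m′ l}
  {υ′ : Fin m → Term m″ l′} {ξ′ : Fin n → Term m″ l′} {κ′ : Fin k → Term m″ l′} →
  (∀ u → sub σ τ (υ u) ≡ υ′ u) → (∀ x → sub σ τ (ξ x) ≡ ξ′ x) → (∀ γ → sub σ τ (κ γ) ≡ κ′ γ) →
  ∀ M → sub σ τ (Tr mu υ ξ κ M) ≡ Tr mu υ′ ξ′ κ′ M
sub-Tr p q c (lin x) = q x
sub-Tr p q c (unr u) = p u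
sub-Tr {σ = σ} {τ} {υ} {ξ} {κ} p q c (Λ M) =
  cong (λ r → ⅋λ (r [ bang ≔ lvar zero ] ♯ lvar (suc zero)))
    (sub-Tr (▹-ext refl (λ u → sub-wk₁₂ σ τ (υ u) (p u)))
            (λ x → sub-wk₁₂ σ τ (ξ x) (q x)) (λ γ → sub-wk₁₂ σ τ (κ γ) (c γ)) M)
sub-Tr {σ = σ} {τ} {υ} {ξ} {κ} p q c (M ＠ N) =
  cong₂ (λ r s → r • (!λ (s ♯ lvar zero))) (sub-Tr p q c M)
    (trans (sub-wk 0 1 σ τ (Tr mu υ ξ κ N)) (cong (wk 0 1) (sub-Tr p q c N)))
sub-Tr {σ = σ} {τ} {υ} {ξ} {κ} p q c (ƛ M) =
  cong (λ r → ⅋λ (r ♯ lvar (suc zero)))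
    (sub-Tr (λ u → trans (sub-wk 0 2 σ τ (υ u)) (cong (wk 0 2) (p u)))
            (▹-ext refl (λ x → trans (sub-wk 0 2 σ τ (ξ x)) (cong (wk 0 2) (q x))))
            (λ γ → trans (sub-wk 0 2 σ τ (κ γ)) (cong (wk 0 2) (c γ))) M)
sub-Tr p q c (M • N)   = cong₂ _•_ (sub-Tr p q c M) (sub-Tr p q c N)
sub-Tr p q c ([ γ ] M) = cong₂ _♯_ (sub-Tr p q c M) (c γ)
sub-Tr {σ = σ} {τ} {υ} {ξ} {κ} p q c (μ M) =
  trans (mu-sub σ τ (Tr mu (wk 0 1 ∘ υ) (wk 0 1 ∘ ξ) (lvar zero ▹ wk 0 1 ∘ κ) M)) (cong mu
    (sub-Tr (λ u → trans (sub-wk 0 1 σ τ (υ u)) (cong (wk 0 1) (p u)))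
            (λ x → trans (sub-wk 0 1 σ τ (ξ x)) (cong (wk 0 1) (q x)))
            (▹-ext refl (λ γ → trans (sub-wk 0 1 σ τ (κ γ)) (cong (wk 0 1) (c γ)))) M))

-- Congruence of the translated constructors

Λ-∼ : (A ∷ Δ) ⨾ (nothing ∷ nothing ∷ Γ) ⊢ t ∼ t′ ∶ B →
      Δ ⨾ Γ ⊢ ⅋λ (t [ bang ≔ lvar zero ] ♯ lvar (suc zero))
            ∼ ⅋λ (t′ [ bang ≔ lvar zero ] ♯ lvar (suc zero)) ∶ ¿ (A ^⊥) ⅋ B
-- The bound `k` has type `B ^⊥`, so `⅋I` yields a doubly negated codomain.
Λ-∼ {B = B} x = subst (λ C → _ ⨾ _ ⊢ _ ∼ _ ∶ _ ⅋ C) (⊥-involutive B)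
  (⅋λ-∼ (♯-∼ (left (right ⊎-identityʳ))
    (bang-∼ (left ⊎-identityˡ) (∼-refl (lvar zero)) x) (∼-refl (lvar (suc zero)))))

-- The argument lies under `!λ`, so its equation is required after weakening, for the same reason as
-- in `mu-∼`.
＠-∼ : Δ ⨾ Γ ⊢ t ∼ t′ ∶ ¿ (A ^⊥) ⅋ B → Δ ⨾ ∅ ⊢ wk 0 1 s ∼ wk 0 1 s′ ∶ A →
      Δ ⨾ Γ ⊢ t • (!λ (wk 0 1 s ♯ lvar zero)) ∼ t′ • (!λ (wk 0 1 s′ ♯ lvar zero)) ∶ B
＠-∼ x y = •-∼ ⊎-identityʳ x (!λ-∼ (♯-∼ (right ⊎-identityʳ) y (∼-refl (lvar zero))))

ƛ-∼ : Δ ⨾ (just A ∷ nothing ∷ Γ) ⊢ t ∼ t′ ∶ B →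
      Δ ⨾ Γ ⊢ ⅋λ (t ♯ lvar (suc zero)) ∼ ⅋λ (t′ ♯ lvar (suc zero)) ∶ (A ^⊥) ⅋ B
ƛ-∼ {B = B} x = subst (λ C → _ ⨾ _ ⊢ _ ∼ _ ∶ _ ⅋ C) (⊥-involutive B)
  (⅋λ-∼ (♯-∼ (left (right ⊎-identityʳ)) x (∼-refl (lvar (suc zero)))))

-- Interpretations of the contexts of the source calculus

Lin Con : Vec (Formula X) m → (Fin n → Term m l) → Fin n → LCtx (Formula X) l → Type X → Set
Lin Δ ξ i Θ A = Δ ⨾ Θ ⊢ ξ i ∶ A ᵀ
Con Δ κ i Θ A = Δ ⨾ Θ ⊢ κ i ∶ (A ᵀ) ^⊥

record Interp {X : Set} {m n k l : ℕ} (Δ : Vec (Formula X) m)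
              (ξ : Fin n → Term m l) (κ : Fin k → Term m l)
              (Γ : LCtx (Type X) n) (Σ : LCtx (Type X) k) (Θ : LCtx (Formula X) l) : Set where
  constructor interp
  field
    {Θˡ Θᶜ} : LCtx (Formula X) l
    disjoint : Θˡ ⊎ Θᶜ ≃ Θ
    linear   : Env (Lin Δ ξ) Γ Θˡ
    continue : Env (Con Δ κ) Σ Θᶜ

module _ {X : Set} {m n k l : ℕ} {Δ : Vec (Formula X) m}
         {ξ : Fin n → Term m l} {κ : Fin k → Term m l} where

  interp-split : {Γ Γ₁ Γ₂ : LCtx (Type X) n} {Σ Σ₁ Σ₂ : LCtx (Type X) k} {Θ : LCtx (Formula X) l} →
    Γ₁ ⊎ Γ₂ ≃ Γ → Σ₁ ⊎ Σ₂ ≃ Σ → Interp Δ ξ κ Γ Σ Θ →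
    ∃₂ λ Θ₁ Θ₂ → (Θ₁ ⊎ Θ₂ ≃ Θ) × Interp Δ ξ κ Γ₁ Σ₁ Θ₁ × Interp Δ ξ κ Γ₂ Σ₂ Θ₂
  interp-split p q (interp d x y)
    with _ , _ , p′ , x₁ , x₂ ← Env-split (Lin Δ ξ) p x
    with _ , _ , q′ , y₁ , y₂ ← Env-split (Con Δ κ) q y
    with _ , _ , d₁ , d₂ , d′ ← ⊎-interchange p′ q′ d =
    _ , _ , d′ , interp d₁ x₁ y₁ , interp d₂ x₂ y₂

  interp-∅ : Interp Δ ξ κ ∅ ∅ ∅
  interp-∅ = interp ⊎-identityˡ (Env-∅ (Lin Δ ξ)) (Env-∅ (Con Δ κ))

  interp-∅⁻ : {Θ : LCtx (Formula X) l} → Interp Δ ξ κ ∅ ∅ Θ → Θ ≡ ∅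
  interp-∅⁻ (interp d x y)
    with refl ← Env-∅⁻ (Lin Δ ξ) x
    with refl ← Env-∅⁻ (Con Δ κ) y = sym (∅⊎⇒≡ d)

  interp-lin : {Θ : LCtx (Formula X) l} (x : Fin n) {A : Type X} →
               Interp Δ ξ κ (single x A) ∅ Θ → Δ ⨾ Θ ⊢ ξ x ∶ A ᵀ
  interp-lin x (interp d e e′)
    with refl ← Env-∅⁻ (Con Δ κ) e′
    with refl ← ∅⊎⇒≡ (⊎-comm d) = Env-single⁻ (Lin Δ ξ) x e

  interp-con : {Θ : LCtx (Formula X) l} (γ : Fin k) {A : Type X} →
               Interp Δ ξ κ ∅ (single γ A) Θ → Δ ⨾ Θ ⊢ κ γ ∶ (A ᵀ) ^⊥
  interp-con γ (interp d e e′)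
    with refl ← Env-∅⁻ (Lin Δ ξ) e
    with refl ← ∅⊎⇒≡ d = Env-single⁻ (Con Δ κ) γ e′

  module _ {Γ : LCtx (Type X) n} {Σ : LCtx (Type X) k} {Θ : LCtx (Formula X) l} where

    interp-wk : (Bs : Vec (Formula X) i) → ∀ j → Interp Δ ξ κ Γ Σ Θ →
                Interp (Bs ++ Δ) (wk i j ∘ ξ) (wk i j ∘ κ) Γ Σ (pad j Θ)
    interp-wk Bs j (interp d x y) = interp (pad-⊎ j d)
      (Env-map (pad j) (pad-∅ j) (pad-⊎ j)
        (Lin Δ ξ) (Lin (Bs ++ Δ) (wk _ j ∘ ξ)) (λ _ → wk-typed Bs j) Γ x)
      (Env-map (pad j) (pad-∅ j) (pad-⊎ j)
        (Con Δ κ) (Con (Bs ++ Δ) (wk _ j ∘ κ)) (λ _ → wk-typed Bs j) Σ y)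

    interp-▹ˡ : ∀ {A Θ₁ Θ₂ s} → Θ₁ ⊎ Θ ≃ Θ₂ → Δ ⨾ Θ₁ ⊢ s ∶ A ᵀ → Interp Δ ξ κ Γ Σ Θ →
                Interp Δ (s ▹ ξ) κ (just A ∷ Γ) Σ Θ₂
    interp-▹ˡ p s (interp d x y) with _ , q , r ← ⊎-assocˡ p d = interp r (_ , _ , q , s , x) y

    interp-▹ᶜ : ∀ {A Θ₁ Θ₂ s} → Θ₁ ⊎ Θ ≃ Θ₂ → Δ ⨾ Θ₁ ⊢ s ∶ (A ᵀ) ^⊥ → Interp Δ ξ κ Γ Σ Θ →
                Interp Δ ξ (s ▹ κ) Γ (just A ∷ Σ) Θ₂
    interp-▹ᶜ p s (interp d x y) with _ , q , r ← ⊎-assocˡ p (⊎-comm d) =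
      interp (⊎-comm r) x (_ , _ , q , s , y)

-- Contracting t[!u:=!s] with !s = !a.(s♯a) substitutes for u not s but
-- (s♯a){a\\⋆} = s[⋆:=⋆].
data Starred {X : Set} {m n : ℕ} (Δ : Vec (Formula X) m) :
             Term m n → Term m n → Formula X → Set where
  same    : Δ ⨾ ∅ ⊢ t ∶ A → Starred Δ t t A
  starred : Δ ⨾ ∅ ⊢ t ∶ A → Starred Δ (t [ star ≔ ⋆ ]) t A

starred-∼ : Starred Δ t t′ A → Δ ⨾ ∅ ⊢ t ∼ t′ ∶ A
starred-∼ (same x)    = ∼-refl x
starred-∼ (starred x) = star-star-∼ x

-- This closure under weakening is why `Starred` is a datatype: environments related by `∼` could
-- not be carried under binders.
starred-wk : {Δ : Vec (Formula X) m} (Bs : Vec (Formula X) i) → ∀ j {t t′ : Term m n} →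
             Starred Δ t t′ A → Starred (Bs ++ Δ) (wk i j t) (wk i j t′) A
starred-wk Bs j (same x) =
  same (subst (_ ⨾_⊢ _ ∶ _) (pad-∅ j) (wk-typed Bs j x))
starred-wk Bs j (starred x) =
  starred (subst (_ ⨾_⊢ _ ∶ _) (pad-∅ j) (wk-typed Bs j x))

-- Abstracting over the operator lets a single induction serve three purposes: exchanging `contra⋆`
-- for `mu`, removing stars from the environment with `mu` on both sides, and typing the
-- translation.
record IsMu (X : Set) (op : MuOp) : Set where
  field
    commutes : CommutesWithRen op
    ∼mu      : ∀ {m n} {Δ : Vec (Formula X) m} {Γ : LCtx (Formula X) n} {A t} →
               Δ ⨾ (just A ∷ Γ) ⊢ t ∶ ⊥ → Δ ⨾ Γ ⊢ op t ∼ mu t ∶ A ^⊥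

open IsMu

contra⋆-isMu : IsMu X contra⋆
contra⋆-isMu = record { commutes = contra⋆-ren ; ∼mu = contra⋆-∼-mu }

mu-isMu : IsMu X mu
mu-isMu = record { commutes = mu-ren ; ∼mu = ∼-refl ∘ mu-typed }

-- The renaming is the one by which mu places its argument under a second binder.
Tr-μ-body : {op : MuOp} → CommutesWithRen op →
  (υ : Fin m → Term m′ l) (ξ : Fin n → Term m′ l) (κ : Fin k → Term m′ l) → ∀ M →
  ren id (lift 1 suc) (Tr op (wk 0 1 ∘ υ) (wk 0 1 ∘ ξ) (lvar zero ▹ wk 0 1 ∘ κ) M) ≡
  Tr op (wk 0 2 ∘ υ) (wk 0 2 ∘ ξ) (lvar zero ▹ wk 0 2 ∘ κ) M
Tr-μ-body op-ren υ ξ κ = ren-Tr op-ren (lift-injective suc suc-injective 1)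
  (λ u → ren-ren (λ _ → refl) (λ _ → refl) (υ u))
  (λ x → ren-ren (λ _ → refl) (λ _ → refl) (ξ x))
  (▹-ext refl (λ γ → ren-ren (λ _ → refl) (λ _ → refl) (κ γ)))

tr-∼ : {op : MuOp} → IsMu X op → {Δ : Vec (Type X) m} {Δ′ : Vec (Formula X) m′}
  {υ υ′ : Fin m → Term m′ l} {ξ : Fin n → Term m′ l} {κ : Fin k → Term m′ l} →
  (∀ u → Starred Δ′ (υ u) (υ′ u) (lookup Δ u ᵀ)) →
  ∀ {Γ Σ Θ A M} → Interp Δ′ ξ κ Γ Σ Θ → Δ ⨾ Γ ⊢ M ∶ A ∣ Σ →
  Δ′ ⨾ Θ ⊢ Tr op υ ξ κ M ∼ Tr mu υ′ ξ κ M ∶ A ᵀ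
tr-∼ o h E (unr u) with refl ← interp-∅⁻ E = starred-∼ (h u)
tr-∼ o h E (lin x) = ∼-refl (interp-lin x E)
tr-∼ o h E (⊃I d) = Λ-∼ (tr-∼ o
  (λ { zero → same (uvar zero) ; (suc u) → starred-wk (_ ∷ []) 2 (h u) })
  (interp-wk (_ ∷ []) 2 E) d)
tr-∼ {op = op} o {υ = υ} {υ′} {ξ} {κ} h E (⊃E {M = M} {N} d e) = ＠-∼ (tr-∼ o h E d)
  (∼-resp-≡ (wk-Tr (commutes o) 0 1 υ ξ κ N) (wk-Tr mu-ren 0 1 υ′ ξ κ N)
    (tr-∼ o (starred-wk [] 1 ∘ h) interp-∅ e))
tr-∼ o h E (⊸I d) = ƛ-∼ (tr-∼ o (starred-wk [] 2 ∘ h)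
  (interp-▹ˡ (left ⊎-identityˡ) (lvar zero) (interp-wk [] 2 E)) d)
tr-∼ o h E (⊸E p q d e) with _ , _ , r , E₁ , E₂ ← interp-split p q E =
  •-∼ r (tr-∼ o h E₁ d) (∼-⊥⊥⁺ (tr-∼ o h E₂ e))
tr-∼ o h E (name {γ = γ} p d) with _ , _ , r , E₁ , E₂ ← interp-split ⊎-identityʳ p E =
  ♯-∼ r (tr-∼ o h E₁ d) (∼-refl (interp-con γ E₂))
tr-∼ {op = op} o {υ = υ} {υ′} {ξ} {κ} h E (unname {M = M} d) = ∼-⊥⊥⁻ (∼-trans
  -- The body is visited twice: here below one binder, for the typing that `∼mu` requires, and then
  -- below the two binders of `mu`, for the equation itself.
  (∼mu o (typedˡ (tr-∼ o (starred-wk [] 1 ∘ h)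
    (interp-▹ᶜ (left ⊎-identityˡ) (lvar zero) (interp-wk [] 1 E)) d)))
  (mu-∼ (∼-resp-≡ (Tr-μ-body (commutes o) υ ξ κ M) (Tr-μ-body mu-ren υ′ ξ κ M)
    (tr-∼ o (starred-wk [] 2 ∘ h)
      (interp-▹ᶜ (left ⊎-identityˡ) (lvar zero) (interp-wk [] 2 E)) d))))

-- Substitution for continuation variables

lookup-⊎-nothing : {Γ₁ Γ₂ Γ : LCtx Y n} → Γ₁ ⊎ Γ₂ ≃ Γ → ∀ a → lookup Γ a ≡ nothing →
                   lookup Γ₁ a ≡ nothing × lookup Γ₂ a ≡ nothing
lookup-⊎-nothing (none p)  zero    e = refl , refl
lookup-⊎-nothing (none p)  (suc a) e = lookup-⊎-nothing p a e
lookup-⊎-nothing (left p)  (suc a) e = lookup-⊎-nothing p a e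
lookup-⊎-nothing (right p) (suc a) e = lookup-⊎-nothing p a e

lookup-⊎-just : {Γ₁ Γ₂ Γ : LCtx Y n} {A : Y} → Γ₁ ⊎ Γ₂ ≃ Γ → ∀ a → lookup Γ a ≡ just A →
                (lookup Γ₁ a ≡ just A × lookup Γ₂ a ≡ nothing) ⊎
                (lookup Γ₁ a ≡ nothing × lookup Γ₂ a ≡ just A)
lookup-⊎-just (left p)  zero    e = inj₁ (e , refl)
lookup-⊎-just (right p) zero    e = inj₂ (refl , e)
lookup-⊎-just (none p)  (suc a) e = lookup-⊎-just p a e
lookup-⊎-just (left p)  (suc a) e = lookup-⊎-just p a e
lookup-⊎-just (right p) (suc a) e = lookup-⊎-just p a e

lookup-single-≢ : ∀ {a b : Fin n} {A : Y} → a ≢ b → lookup (single b A) a ≡ nothing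
lookup-single-≢ {a = zero}  {zero}  a≢b = ⊥-elim (a≢b refl)
lookup-single-≢ {a = zero}  {suc b} a≢b = refl
lookup-single-≢ {a = suc a} {zero}  a≢b = lookup-replicate a nothing
lookup-single-≢ {a = suc a} {suc b} a≢b = lookup-single-≢ (a≢b ∘ cong suc)

nothing≢just : {x : Maybe Y} {y : Y} → x ≡ nothing → x ≢ just y
nothing≢just refl ()

name-fresh : {Σ Σ′ : LCtx Y k} {A : Y} {γ δ : Fin k} → Σ ⊎ single δ A ≃ Σ′ →
             lookup Σ′ γ ≡ nothing → γ ≢ δ
name-fresh {δ = δ} p e refl = nothing≢just e (lookup-single-⊎ δ (⊎-comm p))

name-bound : {Σ Σ′ : LCtx Y k} {A : Y} (γ : Fin k) → Σ ⊎ single γ A ≃ Σ′ → lookup Σ γ ≡ nothing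
name-bound zero    (right p) = refl
name-bound (suc γ) (none p)  = name-bound γ p
name-bound (suc γ) (left p)  = name-bound γ p

module _ {X : Set} where

  -- Every continuation variable free in a typable term is assigned a type in `Σ`, so the traversal
  -- never meets `γ`.
  ◁-fresh : {Δ : Vec (Type X) m} {Γ : LCtx (Type X) n} {Σ : LCtx (Type X) k} → ∀ {M A} →
            Δ ⨾ Γ ⊢ M ∶ A ∣ Σ → ∀ {γ} → lookup Σ γ ≡ nothing → ∀ N → M ⟦ γ ◁ N ⟧ ≡ M
  ◁-fresh (unr u) e N = refl
  ◁-fresh (lin x) e N = refl
  ◁-fresh (⊃I d)  e N = cong Λ_ (◁-fresh d e (wkᵘ N))
  ◁-fresh (⊃E d d′) {γ} e N =
    cong₂ _＠_ (◁-fresh d e N) (◁-fresh d′ (lookup-replicate γ nothing) N)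
  ◁-fresh (⊸I d) e N = cong ƛ_ (◁-fresh d e (wkˡ N))
  ◁-fresh (⊸E p q d d′) {γ} e N with e₁ , e₂ ← lookup-⊎-nothing q γ e =
    cong₂ _•_ (◁-fresh d e₁ N) (◁-fresh d′ e₂ N)
  ◁-fresh (name {γ = δ} p d) {γ} e N with γ ≟ δ
  ... | yes γ≡δ = ⊥-elim (name-fresh p e γ≡δ)
  ... | no  γ≢δ = cong ([ δ ]_) (◁-fresh d (proj₁ (lookup-⊎-nothing p γ e)) N)
  ◁-fresh (unname d) e N = cong μ_ (◁-fresh d e (wkᶜ N))

  Tr-fresh : {Δ : Vec (Type X) m} {Γ : LCtx (Type X) n} {Σ : LCtx (Type X) k} → ∀ {M A} →
    {υ : Fin m → Term m′ l} {ξ : Fin n → Term m′ l} {κ κ′ : Fin k → Term m′ l} →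
    Δ ⨾ Γ ⊢ M ∶ A ∣ Σ → ∀ {γ} → lookup Σ γ ≡ nothing → (∀ {δ} → γ ≢ δ → κ δ ≡ κ′ δ) →
    Tr mu υ ξ κ M ≡ Tr mu υ ξ κ′ M
  Tr-fresh (unr u) e h = refl
  Tr-fresh (lin x) e h = refl
  Tr-fresh (⊃I d)  e h = cong (λ r → ⅋λ (r [ bang ≔ lvar zero ] ♯ lvar (suc zero)))
    (Tr-fresh d e (λ γ≢δ → cong (wk 1 2) (h γ≢δ)))
  Tr-fresh (⊃E d d′) {γ} e h = cong₂ (λ r s → r • (!λ (wk 0 1 s ♯ lvar zero)))
    (Tr-fresh d e h) (Tr-fresh d′ {γ} (lookup-replicate γ nothing) h)
  Tr-fresh (⊸I d) e h = cong (λ r → ⅋λ (r ♯ lvar (suc zero)))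
    (Tr-fresh d e (λ γ≢δ → cong (wk 0 2) (h γ≢δ)))
  Tr-fresh (⊸E p q d d′) {γ} e h with e₁ , e₂ ← lookup-⊎-nothing q γ e =
    cong₂ _•_ (Tr-fresh d e₁ h) (Tr-fresh d′ e₂ h)
  Tr-fresh (name p d) {γ} e h =
    cong₂ _♯_ (Tr-fresh d (proj₁ (lookup-⊎-nothing p γ e)) h) (h (name-fresh p e))
  Tr-fresh (unname d) {γ} e h = cong mu (Tr-fresh d {suc γ} e
    (λ { {zero} _ → refl ; {suc δ} γ≢δ → cong (wk 0 1) (h (γ≢δ ∘ cong suc)) }))

-- Comparing the translation with itself yields its typing, since `∼` carries the typings of both
-- sides.
tr-typed : {Δ : Vec (Type X) m} {Δ′ : Vec (Formula X) m′}
  {υ : Fin m → Term m′ l} {ξ : Fin n → Term m′ l} {κ : Fin k → Term m′ l} →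
  (∀ u → Δ′ ⨾ ∅ ⊢ υ u ∶ lookup Δ u ᵀ) →
  ∀ {Γ Σ Θ A M} → Interp Δ′ ξ κ Γ Σ Θ → Δ ⨾ Γ ⊢ M ∶ A ∣ Σ → Δ′ ⨾ Θ ⊢ Tr mu υ ξ κ M ∶ A ᵀ
tr-typed h E d = typedˡ (tr-∼ mu-isMu (same ∘ h) E d)

∅-wk-typed : (Bs : Vec (Formula X) i) → ∀ j {t : Term m n} →
             Δ ⨾ ∅ ⊢ t ∶ A → (Bs ++ Δ) ⨾ ∅ ⊢ wk i j t ∶ A
∅-wk-typed Bs j x = subst (_ ⨾_⊢ _ ∶ _) (pad-∅ j) (wk-typed Bs j x)

-- M{γ◁⋆N} is M{γ:=N▼γ} up to ∼, as (N•P)♯γ ∼ P♯(N▼γ).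
◁-∼ : {Δ : Vec (Type X) m} {Δ′ : Vec (Formula X) m′} {υ : Fin m → Term m′ l}
  {ξ : Fin n → Term m′ l} {κ κ′ : Fin k → Term m′ l} {γ : Fin k} → ∀ {Γ Σ Θ A C M} N →
  lookup Σ γ ≡ just C → κ′ γ ≡ Tr mu υ ξ κ N ▼ κ γ → (∀ {δ} → γ ≢ δ → κ δ ≡ κ′ δ) →
  (∀ u → Δ′ ⨾ ∅ ⊢ υ u ∶ lookup Δ u ᵀ) → Interp Δ′ ξ κ′ Γ Σ Θ → Δ ⨾ Γ ⊢ M ∶ A ∣ Σ →
  Δ′ ⨾ Θ ⊢ Tr mu υ ξ κ (M ⟦ γ ◁ N ⟧) ∼ Tr mu υ ξ κ′ M ∶ A ᵀ
◁-∼ {γ = γ} N e p q h E (unr u) = ⊥-elim (nothing≢just (lookup-replicate γ nothing) e)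
◁-∼ {γ = γ} N e p q h E (lin x) = ⊥-elim (nothing≢just (lookup-replicate γ nothing) e)
◁-∼ {υ = υ} {ξ} {κ} {γ = γ} N e p q h E (⊃I d) = Λ-∼ (◁-∼ (wkᵘ N) e
  (trans (cong (wk 1 2) p) (cong (_▼ wk 1 2 (κ γ)) (sym (Tr-wkᵘ υ ξ κ 1 2 (uvar zero) N))))
  (λ γ≢δ → cong (wk 1 2) (q γ≢δ))
  (λ { zero → uvar zero ; (suc u) → ∅-wk-typed (_ ∷ []) 2 (h u) })
  (interp-wk (_ ∷ []) 2 E) d)
◁-∼ {υ = υ} {ξ} {κ} {κ′} {γ} N e p q h E (⊃E {N = N′} d d′) = ＠-∼ (◁-∼ N e p q h E d)
  -- An argument of `＠` is typed without continuation variables, so `γ` cannot occur in it and both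
  -- translations agree.
  (∼-reflexive (cong (wk 0 1)
    (trans (cong (Tr mu υ ξ κ) (◁-fresh d′ fresh N)) (Tr-fresh d′ fresh q)))
    (∅-wk-typed [] 1 (tr-typed h interp-∅ d′)))
  where
  fresh : lookup ∅ γ ≡ nothing
  fresh = lookup-replicate γ nothing
◁-∼ {υ = υ} {ξ} {κ} {γ = γ} N e p q h E (⊸I d) = ƛ-∼ (◁-∼ (wkˡ N) e
  (trans (cong (wk 0 2) p) (cong (_▼ wk 0 2 (κ γ)) (sym (Tr-wkˡ υ ξ κ 0 2 (lvar zero) N))))
  (λ γ≢δ → cong (wk 0 2) (q γ≢δ)) (∅-wk-typed [] 2 ∘ h)
  (interp-▹ˡ (left ⊎-identityˡ) (lvar zero) (interp-wk [] 2 E)) d)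
◁-∼ {υ = υ} {ξ} {κ} {κ′} {γ} N e p q h E (⊸E r s d d′)
  with _ , _ , r′ , E₁ , E₂ ← interp-split r s E | lookup-⊎-just s γ e
... | inj₁ (e₁ , e₂) = •-∼ r′ (◁-∼ N e₁ p q h E₁ d)
  (∼-⊥⊥⁺ (∼-reflexive
    (trans (cong (Tr mu υ ξ κ) (◁-fresh d′ e₂ N)) (Tr-fresh d′ e₂ q)) (tr-typed h E₂ d′)))
... | inj₂ (e₁ , e₂) = •-∼ r′
  (∼-reflexive
    (trans (cong (Tr mu υ ξ κ) (◁-fresh d e₁ N)) (Tr-fresh d e₁ q)) (tr-typed h E₁ d))
  (∼-⊥⊥⁺ (◁-∼ N e₂ p q h E₂ d′))
◁-∼ {υ = υ} {ξ} {κ} {κ′} {γ} N e p q h E (name {γ = δ} {M = M} r d)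
  with γ ≟ δ | interp-split ⊎-identityʳ r E
... | yes refl | _ , _ , s , E₁ , E₂
  -- The typings of the translated `N` and of `κ γ` are not hypotheses; they come from inverting the
  -- typing of `κ′ γ`.
  with ⅋E₂ s′ x y ← subst (_ ⨾ _ ⊢_∶ _) p (interp-con γ E₂)
  with _ , s₁ , s₂ ← ⊎-assocˡ s s′ =
  -- The named subterm is left untouched by the replacement, and by linearity `γ` does not occur in
  -- it, so its translations under `κ` and `κ′` coincide.
  ∼-resp-≡ (cong (λ t → (_ • t) ♯ κ γ) (Tr-fresh d (name-bound γ r) q)) (cong (Tr mu υ ξ κ′ M ♯_) p)
    (•-♯ (⊎-comm s₁) s₂ x (⊥⊥⁺ (tr-typed h E₁ d)) y)
... | no γ≢δ | _ , _ , s , E₁ , E₂ with lookup-⊎-just r γ e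
...   | inj₁ (e₁ , _) = ♯-∼ s (◁-∼ N e₁ p q h E₁ d)
  (∼-reflexive (q γ≢δ) (interp-con δ E₂))
...   | inj₂ (_ , e₂) = ⊥-elim (nothing≢just (lookup-single-≢ γ≢δ) e₂)
◁-∼ {υ = υ} {ξ} {κ} {κ′} {γ} N e p q h E (unname {M = M} d) = ∼-⊥⊥⁻ (mu-∼ (∼-resp-≡
  (Tr-μ-body mu-ren υ ξ κ (M ⟦ suc γ ◁ wkᶜ N ⟧)) (Tr-μ-body mu-ren υ ξ κ′ M)
  (◁-∼ (wkᶜ N) e
    (trans (cong (wk 0 2) p) (cong (_▼ wk 0 2 (κ γ)) (sym (Tr-wkᶜ υ ξ κ 0 2 (lvar zero) N))))
    (λ { {zero} _ → refl ; {suc δ} γ≢δ → cong (wk 0 2) (q (γ≢δ ∘ cong suc)) })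
    (∅-wk-typed [] 2 ∘ h)
    (interp-▹ᶜ (left ⊎-identityˡ) (lvar zero) (interp-wk [] 2 E)) d)))

-- Simulation of the axioms

ren≡sub : (ρ : Fin m → Fin m′) (θ : Fin n → Fin n′) → ∀ t → ren ρ θ t ≡ sub (uvar ∘ ρ) (lvar ∘ θ) t
ren≡sub ρ θ t = trans (cong (ren ρ θ) (sym (sub-id (λ _ → refl) (λ _ → refl) t)))
                      (ren-sub (λ _ → refl) (λ _ → refl) t)

-- Translated abstractions have bodies of the form `_ ♯ k`. Once the argument is substituted,
-- contra-substitution for `k` returns the left side of this cut with a trivial eliminator.
⅋•-∼ : Δ ⨾ Γ ⊢ (⅋λ t) • r ∶ A → Δ ⨾ Γ ⊢ s ∶ A → t ⟪ zero ≔ wk 0 1 r ⟫ ≡ wk 0 1 s ♯ lvar zero →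
       Δ ⨾ Γ ⊢ (⅋λ t) • r ∼ s ∶ A
⅋•-∼ {t = t} {r = r} {s = s} x y e =
  ∼-trans (∼-↦ (subst ((⅋λ t) • r ↦_) contractum (⅋• □)) x (𝟏E ⊎-identityˡ 𝟏I y)) (star-star-∼ y)
  where
  contractum : contra⋆ (t ⟪ zero ≔ wk 0 1 (ren id id r) ⟫) ≡ s [ star ≔ ⋆ ]
  contractum = trans (cong (λ u → contra⋆ (t ⟪ zero ≔ wk 0 1 u ⟫)) (ren-id (λ _ → refl) (λ _ → refl) r))
                     (trans (cong contra⋆ e) (contra⋆-♯ʳ y))

bang-∼-sub : (A ∷ Δ) ⨾ Γ ⊢ t ∶ B → Δ ⨾ ∅ ⊢ s ∶ A → Δ ⨾ Γ ⊢ t ⟪ s [ star ≔ ⋆ ] ⟫ᵘ ∶ B →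
             Δ ⨾ Γ ⊢ t [ bang ≔ !λ (wk 0 1 s ♯ lvar zero) ] ∼ t ⟪ s [ star ≔ ⋆ ] ⟫ᵘ ∶ B
bang-∼-sub {t = t} {s = s} x y z =
  ∼-↦ (subst (t [ bang ≔ _ ] ↦_) contractum (!! □)) (!E ⊎-identityˡ (⊥⊥⁻-! (!I (♯-lvar-typed y))) x) z
  where
  contractum : ren (lift 1 id) id t ⟪ contra⋆ (wk 0 1 s ♯ lvar zero) ⟫ᵘ ≡ t ⟪ s [ star ≔ ⋆ ] ⟫ᵘ
  contractum = cong₂ _⟪_⟫ᵘ (ren-id (lift-id 1 (λ _ → refl)) (λ _ → refl) t) (contra⋆-♯ʳ y)

  ⊥⊥⁻-! : Δ ⨾ Γ ⊢ r ∶ ! (A ^⊥ ^⊥) → Δ ⨾ Γ ⊢ r ∶ ! A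
  ⊥⊥⁻-! {A = A} = subst (λ C → _ ⨾ _ ⊢ _ ∶ ! C) (⊥-involutive A)

module _ {X : Set} {m m′ n k l : ℕ} {Δ : Vec (Type X) m} {Δ′ : Vec (Formula X) m′}
         {υ : Fin m → Term m′ l} {ξ : Fin n → Term m′ l} {κ : Fin k → Term m′ l}
         (h : ∀ u → Δ′ ⨾ ∅ ⊢ υ u ∶ lookup Δ u ᵀ) where

  β⊃-∼ : ∀ {Γ Σ Θ A} M N → Interp Δ′ ξ κ Γ Σ Θ →
         Δ ⨾ Γ ⊢ (Λ M) ＠ N ∶ A ∣ Σ → Δ ⨾ Γ ⊢ M ⟦ N ⟧ᵘ ∶ A ∣ Σ →
         Δ′ ⨾ Θ ⊢ Tr mu υ ξ κ ((Λ M) ＠ N) ∼ Tr mu υ ξ κ (M ⟦ N ⟧ᵘ) ∶ A ᵀ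
  β⊃-∼ {Γ} {Σ} {Θ} {A} M N E d@(⊃E (⊃I d₁) d₂) _ = ∼-trans
    (⅋•-∼ (tr-typed h E d) (typedˡ step) substitute)
    (∼-trans step (∼-resp-≡ sub≡ (Tr-μsub (▹-ext refl (λ _ → refl)) (λ _ → refl) M) starred∼))
    where
    arg : Term m′ l
    arg = Tr mu υ ξ κ N

    body : Term (suc m′) l
    body = Tr mu (uvar zero ▹ wk 1 0 ∘ υ) (wk 1 0 ∘ ξ) (wk 1 0 ∘ κ) M

    body-typed : _ ⨾ Θ ⊢ body ∶ A ᵀ
    body-typed = tr-typed (λ { zero → uvar zero ; (suc u) → ∅-wk-typed (_ ∷ []) 0 (h u) })
      (interp-wk (_ ∷ []) 0 E) d₁

    arg-typed : Δ′ ⨾ ∅ ⊢ arg ∶ _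
    arg-typed = tr-typed h interp-∅ d₂

    -- The variable `u` may occur any number of times and at any depth, so the star on the argument
    -- is removed by changing the environment of the whole translation.
    starred∼ : Δ′ ⨾ Θ ⊢ Tr mu (arg [ star ≔ ⋆ ] ▹ υ) ξ κ M ∼ Tr mu (arg ▹ υ) ξ κ M ∶ A ᵀ
    starred∼ = tr-∼ mu-isMu (λ { zero → starred arg-typed ; (suc u) → same (h u) }) E d₁

    sub≡ : body ⟪ arg [ star ≔ ⋆ ] ⟫ᵘ ≡ Tr mu (arg [ star ≔ ⋆ ] ▹ υ) ξ κ M
    sub≡ = sub-Tr (▹-ext refl (λ u → wk-sub₁₀ (υ u))) (λ x → wk-sub₁₀ (ξ x)) (λ γ → wk-sub₁₀ (κ γ)) M
      where
      wk-sub₁₀ : ∀ r → wk 1 0 r ⟪ arg [ star ≔ ⋆ ] ⟫ᵘ ≡ r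
      wk-sub₁₀ r = trans (sub-ren (λ _ → refl) (λ _ → refl) r) (sub-id (λ _ → refl) (λ _ → refl) r)

    step : Δ′ ⨾ Θ ⊢ body [ bang ≔ !λ (wk 0 1 arg ♯ lvar zero) ] ∼ body ⟪ arg [ star ≔ ⋆ ] ⟫ᵘ ∶ A ᵀ
    step = bang-∼-sub body-typed arg-typed
      (subst (Δ′ ⨾ Θ ⊢_∶ A ᵀ) (sym sub≡) (typedˡ starred∼))

    substitute : _ ≡ wk 0 1 (body [ bang ≔ !λ (wk 0 1 arg ♯ lvar zero) ]) ♯ lvar zero
    substitute = cong (λ r → r [ bang ≔ _ ] ♯ lvar zero) (trans
      (sub-Tr {υ′ = uvar zero ▹ wk 1 1 ∘ υ} {wk 1 1 ∘ ξ} {wk 1 1 ∘ κ}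
        (▹-ext refl (λ u → sub₁₂ (υ u))) (λ x → sub₁₂ (ξ x)) (λ γ → sub₁₂ (κ γ)) M)
      (sym (ren-Tr mu-ren (lift-injective suc suc-injective 0)
        (▹-ext refl (λ u → ren-ren (λ _ → refl) (λ _ → refl) (υ u)))
        (λ x → ren-ren (λ _ → refl) (λ _ → refl) (ξ x))
        (λ γ → ren-ren (λ _ → refl) (λ _ → refl) (κ γ)) M)))
      where
      sub₁₂ : ∀ {r} s → sub (liftᵘ 1 0 uvar) (liftˡ 1 0 (insertAt lvar zero r)) (wk 1 2 s) ≡ wk 1 1 s
      sub₁₂ s = trans (sub-ren (λ _ → refl) (λ _ → refl) s) (sym (ren≡sub _ _ s))

  β⊸-∼ : ∀ {Γ Σ Θ A} M N → Interp Δ′ ξ κ Γ Σ Θ →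
         Δ ⨾ Γ ⊢ (ƛ M) • N ∶ A ∣ Σ → Δ ⨾ Γ ⊢ M ⟦ N ⟧ˡ ∶ A ∣ Σ →
         Δ′ ⨾ Θ ⊢ Tr mu υ ξ κ ((ƛ M) • N) ∼ Tr mu υ ξ κ (M ⟦ N ⟧ˡ) ∶ A ᵀ
  β⊸-∼ M N E d e = ⅋•-∼ (tr-typed h E d) (tr-typed h E e) (cong (_♯ lvar zero) (trans
    (sub-Tr {υ′ = wk 0 1 ∘ υ} {wk 0 1 ∘ (Tr mu υ ξ κ N ▹ ξ)} {wk 0 1 ∘ κ}
      (λ u → sub₀₂ (υ u)) (▹-ext refl (λ x → sub₀₂ (ξ x))) (λ γ → sub₀₂ (κ γ)) M)
    (trans (sym (wk-Tr mu-ren 0 1 υ (Tr mu υ ξ κ N ▹ ξ) κ M))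
      (cong (wk 0 1) (sym (Tr-μsub {υ = υ} {ξ} {κ} (λ _ → refl) (▹-ext refl (λ _ → refl)) M))))))
    where
    sub₀₂ : ∀ {r} s → wk 0 2 s ⟪ zero ≔ r ⟫ ≡ wk 0 1 s
    sub₀₂ s = trans (sub-ren (λ _ → refl) (λ _ → refl) s) (sym (ren≡sub _ _ s))

  -- The cut with `c` makes the `mu` in argument position contract, with `N ▼ c` as the term for
  -- `γ`; `◁-∼`, read from right to left, turns this into the replacement with `c` for `γ`. An
  -- arbitrary `c` allows use below the binders of an enclosing `mu`.
  •μ-♯ : ∀ {Γ Σ Θ Θ₁ Θ₂ A c} M N → Interp Δ′ ξ κ Γ Σ Θ → Θ ⊎ Θ₁ ≃ Θ₂ →
         Δ ⨾ Γ ⊢ N • (μ M) ∶ A ∣ Σ → Δ′ ⨾ Θ₁ ⊢ c ∶ (A ᵀ) ^⊥ →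
         Δ′ ⨾ Θ₂ ⊢ Tr mu υ ξ κ (N • (μ M)) ♯ c ∼ Tr mu υ ξ (c ▹ κ) (M ⟦ zero ◁ wkᶜ N ⟧) ∶ ⊥
  •μ-♯ {c = c} M N E p (⊸E q r d (unname e)) x
    with _ , _ , s , E₁ , E₂ ← interp-split q r E
    with _ , s₁ , s₂ ← ⊎-assocʳ (⊎-comm s) p = ∼-trans
    (•-♯ s p (tr-typed h E₁ d) (⊥⊥⁺ (tr-typed h E₂ (unname e))) x)
    (∼-trans
      (mu-♯ s₂
        (tr-typed (∅-wk-typed [] 1 ∘ h)
          (interp-▹ᶜ (left ⊎-identityˡ) (lvar zero) (interp-wk [] 1 E₂)) e)
        (⅋E₂ s₁ (tr-typed h E₁ d) x)
        (sub-Tr (λ u → wk-sub _ (υ u)) (λ x → wk-sub _ (ξ x)) (▹-ext refl (λ γ → wk-sub _ (κ γ))) M)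
        (tr-typed h E′ e))
      (∼-sym (◁-∼ {κ = c ▹ κ} {κ′ = (Tr mu υ ξ κ N ▼ c) ▹ κ} (wkᶜ N) refl
        (cong (_▼ c) (sym (Tr-μren mu (λ _ → refl) (λ _ → refl) (λ _ → refl) N)))
        (λ { {zero} z≢z → ⊥-elim (z≢z refl) ; {suc δ} _ → refl }) h E′ e)))
    where
    E′ = interp-▹ᶜ (⊎-comm s₂) (⅋E₂ s₁ (tr-typed h E₁ d) x) E₂

-- The environment is generalised because each congruence rule goes under the binders of the
-- translation, where the free variables are interpreted by weakened terms.
Tr-≐ : {Δ : Vec (Type X) m} {Δ′ : Vec (Formula X) m′}
  {υ : Fin m → Term m′ l} {ξ : Fin n → Term m′ l} {κ : Fin k → Term m′ l} →
  (∀ u → Δ′ ⨾ ∅ ⊢ υ u ∶ lookup Δ u ᵀ) →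
  ∀ {Γ Σ Θ A M N} → Interp Δ′ ξ κ Γ Σ Θ → Δ ⨾ Γ ⊢ M ≐ N ∶ A ∣ Σ →
  Δ′ ⨾ Θ ⊢ Tr mu υ ξ κ M ∼ Tr mu υ ξ κ N ∶ A ᵀ
Tr-≐ h E (≐-refl d)    = ∼-refl (tr-typed h E d)
Tr-≐ h E (≐-sym e)     = ∼-sym (Tr-≐ h E e)
Tr-≐ h E (≐-trans e f) = ∼-trans (Tr-≐ h E e) (Tr-≐ h E f)
Tr-≐ h E (Λ-cong e)    = Λ-∼ (Tr-≐
  (λ { zero → uvar zero ; (suc u) → ∅-wk-typed (_ ∷ []) 2 (h u) }) (interp-wk (_ ∷ []) 2 E) e)
Tr-≐ {υ = υ} {ξ} {κ} h E (＠-cong {N = N} {N′} e f) = ＠-∼ (Tr-≐ h E e)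
  (∼-resp-≡ (wk-Tr mu-ren 0 1 υ ξ κ N) (wk-Tr mu-ren 0 1 υ ξ κ N′)
    (Tr-≐ (∅-wk-typed [] 1 ∘ h) interp-∅ f))
Tr-≐ h E (ƛ-cong e) = ƛ-∼ (Tr-≐ (∅-wk-typed [] 2 ∘ h)
  (interp-▹ˡ (left ⊎-identityˡ) (lvar zero) (interp-wk [] 2 E)) e)
Tr-≐ h E (•-cong p q e f) with _ , _ , r , E₁ , E₂ ← interp-split p q E =
  •-∼ r (Tr-≐ h E₁ e) (∼-⊥⊥⁺ (Tr-≐ h E₂ f))
Tr-≐ h E (name-cong {γ = γ} p e) with _ , _ , r , E₁ , E₂ ← interp-split ⊎-identityʳ p E =
  ♯-∼ r (Tr-≐ h E₁ e) (∼-refl (interp-con γ E₂))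
Tr-≐ {υ = υ} {ξ} {κ} h E (μ-cong {M = M} {M′} e) = ∼-⊥⊥⁻ (mu-∼ (∼-resp-≡
  (Tr-μ-body mu-ren υ ξ κ M) (Tr-μ-body mu-ren υ ξ κ M′)
  (Tr-≐ (∅-wk-typed [] 2 ∘ h)
    (interp-▹ᶜ (left ⊎-identityˡ) (lvar zero) (interp-wk [] 2 E)) e)))
Tr-≐ h E (β⊃ {M = M} {N} d e) = β⊃-∼ h M N E d e
Tr-≐ h E (β⊸ {M = M} {N} d e) = β⊸-∼ h M N E d e
-- The left side is expanded by `mu-η`, which provides a cut with a bound variable; this variable,
-- at index 0 below both binders of `mu`, serves as `c` in `•μ-♯`.
Tr-≐ {υ = υ} {ξ} {κ} h E (•μ {M = M} {N} d e) = ∼-trans (∼-sym (mu-η (tr-typed h E d)))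
  (∼-⊥⊥⁻ (mu-∼ {t = wk 0 1 (Tr mu υ ξ κ (N • (μ M))) ♯ lvar zero} (∼-resp-≡
    (cong (_♯ lvar zero) (trans (ren-ren (λ _ → refl) (λ _ → refl) (Tr mu υ ξ κ (N • (μ M))))
                                (wk-Tr mu-ren 0 2 υ ξ κ (N • (μ M)))))
    (Tr-μ-body mu-ren υ ξ κ (M ⟦ zero ◁ wkᶜ N ⟧))
    (•μ-♯ (∅-wk-typed [] 2 ∘ h) M N (interp-wk [] 2 E) (right ⊎-identityʳ) d (lvar zero)))))
Tr-≐ {υ = υ} {ξ} {κ} h E (μη {M = M} d e) = ∼-trans
  (∼-reflexive (cong (λ r → mu (r ♯ lvar zero)) (Tr-wkᶜ υ ξ κ 0 1 (lvar zero) M)) (typedˡ η)) η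
  where
  η = mu-η (tr-typed h E e)

-- The translation of judgements as an instance

linearᴴ-⊎ : (Γ : LCtx (Formula X) n) {Γ′ : LCtx (Formula X) k} → (Γ ++ ∅) ⊎ pad n Γ′ ≃ (Γ ++ Γ′)
linearᴴ-⊎ []            = ⊎-identityˡ
linearᴴ-⊎ (nothing ∷ Γ) = none (linearᴴ-⊎ Γ)
linearᴴ-⊎ (just _ ∷ Γ)  = left (linearᴴ-⊎ Γ)

env-Γ : (Γ : LCtx (Type X) n) →
  Env (λ i Θ A → Θ ≡ single (i ↑ˡ k) (A ᵀ)) Γ (map (Maybe.map _ᵀ) Γ ++ ∅)
env-Γ []            = refl
env-Γ (nothing ∷ Γ) = Env-map (nothing ∷_) refl none _ _ (λ i → cong (nothing ∷_)) Γ (env-Γ Γ)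
env-Γ (just A ∷ Γ)  =
  Env-bind _ (λ i Θ A → Θ ≡ single (i ↑ˡ _) (A ᵀ)) refl (λ i → cong (nothing ∷_)) Γ (env-Γ Γ)

env-Σ : (Σ : LCtx (Type X) k) →
  Env (λ i Θ A → Θ ≡ single i ((A ᵀ) ^⊥)) Σ (map (Maybe.map (λ A → (A ᵀ) ^⊥)) Σ)
env-Σ []            = refl
env-Σ (nothing ∷ Σ) = Env-map (nothing ∷_) refl none _ _ (λ i → cong (nothing ∷_)) Σ (env-Σ Σ)
env-Σ (just A ∷ Σ)  =
  Env-bind _ (λ i Θ A → Θ ≡ single i ((A ᵀ) ^⊥)) refl (λ i → cong (nothing ∷_)) Σ (env-Σ Σ)

-- Every variable interprets itself: linear variables take the first `n` indices and continuation
-- variables the remaining `k`, the layout fixed by `linearᴴ`.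
interpᴴ : ∀ (Δ : Vec (Formula X) m) (Γ : LCtx (Type X) n) (Σ : LCtx (Type X) k) →
          Interp Δ (lvar ∘ (_↑ˡ k)) (lvar ∘ (n ↑ʳ_)) Γ Σ (linearᴴ Γ Σ)
interpᴴ {n = n} Δ Γ Σ = interp (linearᴴ-⊎ (map (Maybe.map _ᵀ) Γ))
  (Env-map id refl id _ (Lin Δ _) (λ { i refl → lvar _ }) Γ (env-Γ Γ))
  (Env-map (pad n) (pad-∅ n) (pad-⊎ n) _ (Con Δ _)
    (λ { i refl → subst (Δ ⨾_⊢ _ ∶ _) (sym (pad-single n i)) (lvar (n ↑ʳ i)) }) Σ (env-Σ Σ))

ᴴ-∼ : {Δ : Vec (Type X) m} {Γ : LCtx (Type X) n} {Σ : LCtx (Type X) k} → ∀ {A M} →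
      Δ ⨾ Γ ⊢ M ∶ A ∣ Σ →
      map _ᵀ Δ ⨾ linearᴴ Γ Σ ⊢ M ᴴ ∼ Tr mu uvar (lvar ∘ (_↑ˡ k)) (lvar ∘ (n ↑ʳ_)) M ∶ A ᵀ
ᴴ-∼ {Δ = Δ} {Γ} {Σ} {M = M} d = ∼-resp-≡
  (translate≡Tr (λ _ → refl) (λ _ → refl) (λ _ → refl) M) refl
  (tr-∼ contra⋆-isMu (λ u → same (subst (map _ᵀ Δ ⨾ ∅ ⊢ uvar u ∶_) (lookup-map u _ᵀ Δ) (uvar u)))
    (interpᴴ (map _ᵀ Δ) Γ Σ) d)

proposition92 : {X : Set} {m n k : ℕ} {Δ : Vec (Type X) m} {Γ : LCtx (Type X) n} {Σ : LCtx (Type X) k} {A : Type X} {M N : μTerm m n k} →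
    Δ ⨾ Γ ⊢ M ∶ A ∣ Σ → Δ ⨾ Γ ⊢ N ∶ A ∣ Σ →
    Δ ⨾ Γ ⊢ M ≐ N ∶ A ∣ Σ →
    map _ᵀ Δ ⨾ linearᴴ Γ Σ ⊢ M ᴴ ≐ N ᴴ ∶ A ᵀ
proposition92 {Δ = Δ} {Γ} {Σ} d e M≐N = equal (∼-trans (ᴴ-∼ d) (∼-trans
  (Tr-≐ (λ u → subst (map _ᵀ Δ ⨾ ∅ ⊢ uvar u ∶_) (lookup-map u _ᵀ Δ) (uvar u))
    (interpᴴ (map _ᵀ Δ) Γ Σ) M≐N)
  (∼-sym (ᴴ-∼ e))))
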